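{- Let $k\ge i\ge 1$. For $n\ge0$ let $O_{k,i}(n)$ be the number of overpartitions $\lambda$ of $n$ such that (1) $f_{\overline{1}}(\lambda)+f_2(\lambda)\le i-1$; (2) $f_{\overline{2t}}(\lambda)+f_{2t}(\lambda)+f_{\overline{2t+1}}(\lambda)+f_{2t+2}(\lambda)\le k-1$ for every integer $t\ge0$; (3) for every integer $t\ge0$, if $f_{2t+1}(\lambda)\ge1$ then $f_{2t+2}(\lambda)\le k-2$. For $k>i\ge1$ let $P_{k,i}(n)$ be the number of overpartitions of $n$ whose non-overlined parts are all $\not\equiv 0,\pm(2i-1)\pmod{4k-2}$ (overlined parts unrestricted), and let $P_{k,k}(n)$ be the number of overpartitions of $n$ into parts (overlined or not) not divisible by $2k-1$. Then $O_{k,i}(n)=P_{k,i}(n)$ for all $k\ge i\ge1$ and $n\ge0$.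
   Context: An overpartition of $n$ is a partition of $n$ in which the first occurrence of each part size may be overlined (so each size occurs overlined at most once). For $t\ge1$, $f_t(\lambda)$ (resp. $f_{\overline t}(\lambda)$) denotes the number of non-overlined (resp. overlined) parts of $\lambda$ equal to $t$; by convention $f_0=f_{\overline0}=0$. -}

module Defs where

open import Data.Nat using (ℕ; zero; suc; _+_; _*_; _∸_; _≤_; _<_; _≡ᵇ_)
open import Data.Nat.Divisibility using (_∣_)
open import Data.Integer as ℤ using (ℤ; +_)
open import Data.Integer.Divisibility as ℤd using ()
open import Data.Bool using (Bool; true; false; if_then_else_; _∧_; not)
open import Data.Product using (_×_; _,_; proj₁; proj₂)
open import Data.List using (List; []; _∷_; map)
open import Data.Nat.ListAction using (sum)
open import Data.List.Relation.Unary.All using (All)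
open import Data.List.Relation.Unary.Linked using (Linked)
open import Data.Refinement using (Refinement)
open import Relation.Binary.PropositionalEquality using (_≡_)
open import Relation.Nullary using (¬_)
open import Data.Sum using (_⊎_)

Part : Set
Part = ℕ × Bool

size : Part → ℕ
size = proj₁

overlined : Part → Bool
overlined = proj₂

-- Canonical ordering of parts in the list representation: sizes weakly
-- decreasing; a part may be followed by one of the same size only if the
-- latter is non-overlined.  Hence within one size the (at most one)
-- overlined copy comes first, and each size is overlined at most once.
Precedes : Part → Part → Set
Precedes p q = (size q < size p) ⊎ (size q ≡ size p × overlined q ≡ false)

IsOverpartition : ℕ → List Part → Set
IsOverpartition n l =
  All (λ p → 1 ≤ size p) l × Linked Precedes l × sum (map size l) ≡ n

f : ℕ → List Part → ℕ
f t [] = 0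
f t ((s , b) ∷ l) = (if (s ≡ᵇ t) ∧ not b then 1 else 0) + f t l

fbar : ℕ → List Part → ℕ
fbar t [] = 0
fbar t ((s , b) ∷ l) = (if (s ≡ᵇ t) ∧ b then 1 else 0) + fbar t l

-- Conditions (1)-(3) (written with "+ c ≤" to avoid truncated subtraction)
OCond : ℕ → ℕ → List Part → Set
OCond k i l =
  (fbar 1 l + f 2 l + 1 ≤ i)
  × (∀ t → fbar (2 * t) l + f (2 * t) l + fbar (2 * t + 1) l + f (2 * t + 2) l + 1 ≤ k)
  × (∀ t → 1 ≤ f (2 * t + 1) l → f (2 * t + 2) l + 2 ≤ k)

_≡_[mod_] : ℕ → ℤ → ℕ → Set
s ≡ a [mod m ] = (+ m) ℤd.∣ ((+ s) ℤ.- a)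

PCondLt : ℕ → ℕ → List Part → Set
PCondLt k i l = All (λ p → overlined p ≡ false →
    ¬ (size p ≡ + 0 [mod 4 * k ∸ 2 ])
  × ¬ (size p ≡ + (2 * i ∸ 1) [mod 4 * k ∸ 2 ])
  × ¬ (size p ≡ ℤ.- (+ (2 * i ∸ 1)) [mod 4 * k ∸ 2 ])) l

PCondEq : ℕ → List Part → Set
PCondEq k l = All (λ p → ¬ ((2 * k ∸ 1) ∣ size p)) l

-- The set of overpartitions of n satisfying a predicate (proof-irrelevant,
-- so equality of elements is equality of the underlying overpartitions).
OverpartitionsWith : ℕ → (List Part → Set) → Set
OverpartitionsWith n P = Refinement (List Part) (λ l → IsOverpartition n l × P l)

{-# OPTIONS --safe #-}

-- Let G m i be the generating function of the overpartitions with all parts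
-- larger than 2m that satisfy the conditions (2), (3) and
-- f̄₂ₘ₊₁ + f₂ₘ₊₂ ≤ i − 1.  Removing the parts of size 2m+1 and 2m+2 gives a
-- linear recursion expressing G m by G (m+1), and G m i tends to 1 for m → ∞.
-- The recursion is solved explicitly by an alternating sum in the style of
-- Andrews' J-functions; for m = 0 that sum collapses to
--     ∏ (1 + qˢ)/(1 − qˢ) · Σₙ (−1)ⁿ q^((2k−1)n² + 2(k−i)n),  n ∈ ℤ.
-- For i < k the Jacobi triple product turns the theta series into the product
-- counting P_{k,i}.  For i = k it is a theta series of Gauss, whose product is
-- the case k = 1 of the same solution (there G = 1) with q replaced by q^(2k−1).
-- To count overpartitions of n everything is done modulo q^(n+1), so that q is
-- nilpotent, 1 ± qˢ is invertible, and all sums and products are finite.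

module Submission where

open import Algebra.Bundles using (CommutativeMonoid; CommutativeRing)
import Algebra.Properties.AbelianGroup
import Algebra.Properties.CommutativeSemigroup
import Algebra.Properties.Ring
import Algebra.Properties.Semiring.Exp
import Algebra.Properties.Semiring.Mult.TCOptimised as Mult
import Algebra.Solver.Ring
open import Algebra.Solver.Ring.AlmostCommutativeRing using (_-Raw-AlmostCommutative⟶_; fromCommutativeRing)
open import Data.Bool using (Bool; true; false; if_then_else_; _∧_; _∨_; not; T)
import Data.Bool.Properties as Bool
import Data.Fin as Fin
open import Data.Integer as ℤ using (ℤ; +_; -[1+_])
import Data.Integer.Divisibility.Signed as ℤˢ
import Data.Integer.Properties as ℤ
import Data.Integer.Solver
open import Data.Irrelevant using ([_])
open import Data.List using (List; []; _∷_; _++_; map; filter; replicate; length; lookup; cartesianProduct; cartesianProductWith; upTo; applyUpTo)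
import Data.List.Membership.DecPropositional as DecMembership
open import Data.List.Membership.Propositional using (_∈_)
open import Data.List.Membership.Propositional.Properties using (∈-cartesianProductWith⁺; ∈-cartesianProductWith⁻; ∈-cartesianProduct⁺; ∈-upTo⁺; ∈-lookup; ∈-map⁺; ∈-map⁻; ∈-filter⁺; ∈-filter⁻)
import Data.List.Properties as List
open import Data.List.Relation.Unary.All as All using (All; []; _∷_)
import Data.List.Relation.Unary.All.Properties as All
open import Data.List.Relation.Unary.AllPairs using ([]; _∷_)
open import Data.List.Relation.Unary.Any using (here; there; index)
open import Data.List.Relation.Unary.Any.Properties using (lookup-index)
open import Data.List.Relation.Unary.Linked as Linked using (Linked; []; [-]; _∷_)
open import Data.List.Relation.Unary.Unique.Propositional using (Unique)
import Data.List.Relation.Unary.Unique.Propositional.Properties as Unique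
open import Data.Maybe using (Maybe; just; nothing)
open import Data.Nat as ℕ using (ℕ; zero; suc; _≤_; _<_; s≤s; z≤n; s≤s⁻¹; _∸_; _<ᵇ_; _≡ᵇ_)
open import Data.Nat.Divisibility using (_∣_; _∣?_; divides; ∣m+n∣m⇒∣n; ∣m∣n⇒∣m+n; n∣m*n; ∣-refl)
open import Data.Nat.ListAction using (sum)
open import Data.Nat.ListAction.Properties using (sum-++)
import Data.Nat.Properties as ℕ
open import Data.Nat.Solver using (module +-*-Solver)
open import Data.Product using (_×_; _,_; proj₁; ∃)
import Data.Product.Properties as Product
open import Data.Refinement using (Refinement; _,_; value-injective)
import Data.Sign as Sign
open import Data.Sum using (inj₁; inj₂)
open import Data.Unit using (tt)
open import Function using (_∘_; id; _⇔_; mk⇔; Equivalence; _↔_; mk↔ₛ′)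
open import Function.Construct.Composition using (_↔-∘_)
open import Function.Construct.Symmetry using (↔-sym)
open import Level using (0ℓ)
open import Relation.Binary.Definitions using (DecidableEquality)
open import Relation.Binary.PropositionalEquality as ≡ using (_≡_; _≢_; _≗_; module ≡-Reasoning)
import Relation.Binary.Reasoning.Setoid as SetoidReasoning
open import Relation.Nullary using (¬_; Dec; yes; no; does; contradiction; recompute; ¬?; _×-dec_)
open import Relation.Nullary.Decidable using (dec-true; dec-false; does-⇔)

-- Finite sums and products, and powers of a nilpotent element

-- Why the alternating sum solves the recursion: raising i by one changes its n-th summand by a
-- piece with factor 1 - q^(2n) and a piece with factor 1 - q^(2(n+m+1)). The first vanishes at n =
-- 0, so its index may be shifted by one; then both pieces are multiples of the same weight at m+1,
-- and a polynomial identity in a few powers of q remains. At the extreme multiplicity k - 1 of the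
-- size 2m+2 this identity carries an extra factor 1 - q^(2m+1), and condition (3) is what puts the
-- same factor into the recursion. The case i = k stands apart because 2i-1 and -(2i-1) then
-- coincide modulo 4k-2: Jacobi's product acquires a squared factor, which deleting a residue class
-- once does not produce. With x = q^(2k-1) the theta series has to be read as ∏ (1 - xˢ)/(1 + xˢ)
-- instead. The price of a nilpotent q is that it has no inverse, so z and p/z in the triple product
-- become two elements A and B with AB = p.

module IntegerSolver {c ℓ} (R : CommutativeRing c ℓ) where
  open CommutativeRing R
  open Mult semiring using (×-homo-+; ×1-homo-*; 1+×) renaming (_×_ to _·_)
  open Algebra.Properties.Ring ring using (-0#≈0#; -‿distribˡ-*; -‿distribʳ-*; -‿involutive)
  open Algebra.Properties.AbelianGroup +-abelianGroup using (⁻¹-∙-comm)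
  open SetoidReasoning setoid

  fromℤ : ℤ → Carrier
  fromℤ (+ n)    = n · 1#
  fromℤ -[1+ n ] = - (suc n · 1#)

  fromℤ-neg : ∀ n → fromℤ (ℤ.- (+ n)) ≈ - (n · 1#)
  fromℤ-neg zero    = sym -0#≈0#
  fromℤ-neg (suc n) = refl

  -‿homo : ∀ i → fromℤ (ℤ.- i) ≈ - fromℤ i
  -‿homo (+ n)    = fromℤ-neg n
  -‿homo -[1+ n ] = sym (-‿involutive _)

  ⊖-homo : ∀ m n → fromℤ (m ℤ.⊖ n) ≈ m · 1# - n · 1#
  ⊖-homo m zero = sym (begin
    m · 1# - 0# ≈⟨ +-congˡ -0#≈0# ⟩
    m · 1# + 0# ≈⟨ +-identityʳ _ ⟩
    m · 1#      ∎)
  ⊖-homo zero (suc n) = sym (+-identityˡ _)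
  ⊖-homo (suc m) (suc n) = begin
    fromℤ (suc m ℤ.⊖ suc n)                   ≡⟨ ≡.cong fromℤ (ℤ.[1+m]⊖[1+n]≡m⊖n m n) ⟩
    fromℤ (m ℤ.⊖ n)                           ≈⟨ ⊖-homo m n ⟩
    m · 1# - n · 1#                           ≈⟨ +-identityʳ _ ⟨
    m · 1# - n · 1# + 0#                      ≈⟨ +-congˡ (-‿inverseʳ 1#) ⟨
    (m · 1# - n · 1#) + (1# - 1#)             ≈⟨ +-assoc _ _ _ ⟩
    m · 1# + (- (n · 1#) + (1# - 1#))         ≈⟨ +-congˡ (+-comm _ _) ⟩
    m · 1# + ((1# - 1#) - n · 1#)             ≈⟨ +-congˡ (+-assoc _ _ _) ⟩
    m · 1# + (1# + (- 1# - n · 1#))           ≈⟨ +-assoc _ _ _ ⟨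
    (m · 1# + 1#) + (- 1# - n · 1#)           ≈⟨ +-cong (+-comm _ _) (⁻¹-∙-comm _ _) ⟩
    (1# + m · 1#) - (1# + n · 1#)             ≈⟨ +-cong (1+× m 1#) (-‿cong (1+× n 1#)) ⟨
    suc m · 1# - suc n · 1#                   ∎

  +-homo : ∀ i j → fromℤ (i ℤ.+ j) ≈ fromℤ i + fromℤ j
  +-homo (+ m)    (+ n)    = ×-homo-+ 1# m n
  +-homo (+ m)    -[1+ n ] = ⊖-homo m (suc n)
  +-homo -[1+ m ] (+ n)    = trans (⊖-homo n (suc m)) (+-comm _ _)
  +-homo -[1+ m ] -[1+ n ] = begin
    - (suc (suc (m ℕ.+ n)) · 1#)       ≡⟨ ≡.cong (λ t → - (t · 1#)) (≡.cong suc (≡.sym (ℕ.+-suc m n))) ⟩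
    - ((suc m ℕ.+ suc n) · 1#)         ≈⟨ -‿cong (×-homo-+ 1# (suc m) (suc n)) ⟩
    - (suc m · 1# + suc n · 1#)        ≈⟨ ⁻¹-∙-comm _ _ ⟨
    - (suc m · 1#) - (suc n · 1#)      ∎

  *-homo : ∀ i j → fromℤ (i ℤ.* j) ≈ fromℤ i * fromℤ j
  *-homo (+ m) (+ n) = trans (reflexive (≡.cong fromℤ (ℤ.+◃n≡+n (m ℕ.* n)))) (×1-homo-* m n)
  *-homo (+ m) -[1+ n ] = begin
    fromℤ (Sign.- ℤ.◃ (m ℕ.* suc n))   ≡⟨ ≡.cong fromℤ (ℤ.-◃n≡-n (m ℕ.* suc n)) ⟩
    fromℤ (ℤ.- (+ (m ℕ.* suc n)))      ≈⟨ fromℤ-neg (m ℕ.* suc n) ⟩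
    - ((m ℕ.* suc n) · 1#)             ≈⟨ -‿cong (×1-homo-* m (suc n)) ⟩
    - (m · 1# * (suc n · 1#))          ≈⟨ -‿distribʳ-* _ _ ⟩
    m · 1# * - (suc n · 1#)            ∎
  *-homo -[1+ m ] (+ n) = begin
    fromℤ (Sign.- ℤ.◃ (suc m ℕ.* n))   ≡⟨ ≡.cong fromℤ (ℤ.-◃n≡-n (suc m ℕ.* n)) ⟩
    fromℤ (ℤ.- (+ (suc m ℕ.* n)))      ≈⟨ fromℤ-neg (suc m ℕ.* n) ⟩
    - ((suc m ℕ.* n) · 1#)             ≈⟨ -‿cong (×1-homo-* (suc m) n) ⟩
    - (suc m · 1# * (n · 1#))          ≈⟨ -‿distribˡ-* _ _ ⟩
    - (suc m · 1#) * (n · 1#)          ∎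
  *-homo -[1+ m ] -[1+ n ] = begin
    (suc m ℕ.* suc n) · 1#             ≈⟨ ×1-homo-* (suc m) (suc n) ⟩
    suc m · 1# * (suc n · 1#)          ≈⟨ -‿involutive _ ⟨
    - - (suc m · 1# * (suc n · 1#))    ≈⟨ -‿cong (-‿distribʳ-* _ _) ⟩
    - (suc m · 1# * - (suc n · 1#))    ≈⟨ -‿distribˡ-* _ _ ⟩
    - (suc m · 1#) * - (suc n · 1#)    ∎

  morphism : ℤ.+-*-rawRing -Raw-AlmostCommutative⟶ fromCommutativeRing R
  morphism = record
    { ⟦_⟧ = fromℤ ; +-homo = +-homo ; *-homo = *-homo ; -‿homo = -‿homo
    ; 0-homo = refl ; 1-homo = refl }

  -- Coefficients are taken in ℤ, where equality can be decided, so that the solver sees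
  -- cancellations although equality in `R` itself is undecided.
  fromℤ-≟ : ∀ i j → Maybe (fromℤ i ≈ fromℤ j)
  fromℤ-≟ i j with i ℤ.≟ j
  ... | yes i≡j = just (reflexive (≡.cong fromℤ i≡j))
  ... | no  _   = nothing

  open Algebra.Solver.Ring ℤ.+-*-rawRing (fromCommutativeRing R) morphism fromℤ-≟ public
    using (solve; _:=_; con; _:+_; _:*_; _:-_; :-_)

module BigOp {c ℓ} (M : CommutativeMonoid c ℓ) where
  open CommutativeMonoid M
  open Algebra.Properties.CommutativeSemigroup commutativeSemigroup using (interchange)
  open SetoidReasoning setoid

  big : ℕ → (ℕ → Carrier) → Carrier
  big zero    f = ε
  big (suc n) f = big n f ∙ f n

  big-cong : ∀ n {f g} → (∀ i → i < n → f i ≈ g i) → big n f ≈ big n g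
  big-cong zero    eq = refl
  big-cong (suc n) eq = ∙-cong (big-cong n λ i i<n → eq i (ℕ.m<n⇒m<1+n i<n)) (eq n ℕ.≤-refl)

  big-ε : ∀ n {f} → (∀ i → i < n → f i ≈ ε) → big n f ≈ ε
  big-ε zero    eq = refl
  big-ε (suc n) eq = trans (∙-cong (big-ε n λ i i<n → eq i (ℕ.m<n⇒m<1+n i<n)) (eq n ℕ.≤-refl)) (identityˡ ε)

  big-head : ∀ n f → big (suc n) f ≈ f 0 ∙ big n (f ∘ suc)
  big-head zero    f = comm _ _
  big-head (suc n) f = trans (∙-congʳ (big-head n f)) (assoc _ _ _)

  big-∙ : ∀ n f g → big n (λ i → f i ∙ g i) ≈ big n f ∙ big n g
  big-∙ zero    f g = sym (identityˡ ε)
  big-∙ (suc n) f g = trans (∙-congʳ (big-∙ n f g)) (interchange _ _ _ _)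

  big-+ : ∀ m n f → big (m ℕ.+ n) f ≈ big m f ∙ big n (λ i → f (m ℕ.+ i))
  big-+ m zero f rewrite ℕ.+-identityʳ m = sym (identityʳ _)
  big-+ m (suc n) f rewrite ℕ.+-suc m n = trans (∙-congʳ (big-+ m n f)) (assoc _ _ _)

  big-* : ∀ n m f → big (n ℕ.* m) f ≈ big n (λ j → big m (λ r → f (j ℕ.* m ℕ.+ r)))
  big-* zero    m f = refl
  big-* (suc n) m f = begin
    big (m ℕ.+ n ℕ.* m) f  ≡⟨ ≡.cong (λ t → big t f) (ℕ.+-comm m (n ℕ.* m)) ⟩
    big (n ℕ.* m ℕ.+ m) f  ≈⟨ big-+ (n ℕ.* m) m f ⟩
    _                      ≈⟨ ∙-congʳ (big-* n m f) ⟩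
    _                      ∎

  big-single : ∀ n {f} i → i < n → (∀ j → j < n → j ≢ i → f j ≈ ε) → big n f ≈ f i
  big-single (suc n) {f} i i<1+n eq with i ℕ.≟ n
  ... | yes ≡.refl = trans (∙-congʳ (big-ε n λ j j<n → eq j (ℕ.m<n⇒m<1+n j<n) (ℕ.<⇒≢ j<n))) (identityˡ _)
  ... | no i≢n = begin
    big n f ∙ f n ≈⟨ ∙-cong (big-single n i (ℕ.≤∧≢⇒< (s≤s⁻¹ i<1+n) i≢n) λ j j<n → eq j (ℕ.m<n⇒m<1+n j<n))
                            (eq n ℕ.≤-refl (i≢n ∘ ≡.sym)) ⟩
    f i ∙ ε       ≈⟨ identityʳ _ ⟩
    f i           ∎

module RingLemmas {c ℓ} (R : CommutativeRing c ℓ) where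
  open CommutativeRing R
  open SetoidReasoning setoid
  open IntegerSolver R public using (solve; _:=_; con; _:+_; _:*_; _:-_; :-_)
  open Algebra.Properties.Ring ring public using (-0#≈0#)
  open Algebra.Properties.Semiring.Exp semiring public
    using (_^_; ^-congˡ; ^-congʳ; ^-homo-*; ^-assocʳ)

  open BigOp +-commutativeMonoid public using ()
    renaming ( big to Σ; big-cong to Σ-cong; big-ε to Σ-0; big-head to Σ-head; big-∙ to Σ-+; big-+ to Σ-split
             ; big-single to Σ-single)
  open BigOp *-commutativeMonoid public using ()
    renaming ( big to Π; big-cong to Π-cong; big-ε to Π-1; big-head to Π-head; big-∙ to Π-*; big-+ to Π-split
             ; big-* to Π-blocks; big-single to Π-single)

  Σ-distribˡ : ∀ n a f → a * Σ n f ≈ Σ n (λ i → a * f i)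
  Σ-distribˡ zero    a f = zeroʳ a
  Σ-distribˡ (suc n) a f = trans (distribˡ _ _ _) (+-congʳ (Σ-distribˡ n a f))

  Π-unit : ∀ n f g → (∀ i → i < n → f i * g i ≈ 1#) → Π n f * Π n g ≈ 1#
  Π-unit n f g fg≈1 = trans (sym (Π-* n f g)) (Π-1 n fg≈1)

  -- Powers of a nilpotent q are zero divisors, so cancellation always goes through an explicit
  -- inverse.
  unit-cancel : ∀ {u v a b} → u * v ≈ 1# → u * a ≈ u * b → a ≈ b
  unit-cancel {u} {v} {a} {b} uv≈1 ua≈ub = begin
    a           ≈⟨ expand a ⟨
    v * (u * a) ≈⟨ *-congˡ ua≈ub ⟩
    v * (u * b) ≈⟨ expand b ⟩
    b           ∎
    where
    expand : ∀ t → v * (u * t) ≈ t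
    expand t = begin
      v * (u * t) ≈⟨ *-assoc _ _ _ ⟨
      v * u * t   ≈⟨ *-congʳ (trans (*-comm v u) uv≈1) ⟩
      1# * t      ≈⟨ *-identityˡ t ⟩
      t           ∎

  geometric : ∀ n t → (1# - t) * Σ n (t ^_) ≈ 1# - t ^ n
  geometric zero    t = solve 1 (λ x → (con (+ 1) :- x) :* con (+ 0) := con (+ 1) :- con (+ 1)) refl t
  geometric (suc n) t = begin
    (1# - t) * (Σ n (t ^_) + t ^ n)           ≈⟨ distribˡ _ _ _ ⟩
    (1# - t) * Σ n (t ^_) + (1# - t) * t ^ n  ≈⟨ +-congʳ (geometric n t) ⟩
    1# - t ^ n + (1# - t) * t ^ n             ≈⟨ solve 2 (λ x y → con (+ 1) :- y :+ (con (+ 1) :- x) :* y := con (+ 1) :- x :* y) refl t (t ^ n) ⟩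
    1# - t * t ^ n                            ∎

Nilpotent : ∀ {c ℓ} (R : CommutativeRing c ℓ) → CommutativeRing.Carrier R → ℕ → Set ℓ
Nilpotent R q N = q ^ N ≈ 0#
  where
  open CommutativeRing R
  open RingLemmas R

module NilpotentPowers {c ℓ} (R : CommutativeRing c ℓ) (q : CommutativeRing.Carrier R) (N : ℕ)
  (q^N≈0 : Nilpotent R q N) where
  open CommutativeRing R
  open SetoidReasoning setoid
  open RingLemmas R

  pow-+ : ∀ {e} a b → e ≡ a ℕ.+ b → q ^ e ≈ q ^ a * q ^ b
  pow-+ a b ≡.refl = ^-homo-* q a b

  pow-≡ : ∀ {a b} → a ≡ b → q ^ a ≈ q ^ b
  pow-≡ = ^-congʳ q

  pow≈0 : ∀ {e} → N ≤ e → q ^ e ≈ 0#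
  pow≈0 {e} N≤e = begin
    q ^ e                  ≈⟨ pow-+ N (e ∸ N) (≡.sym (ℕ.m+[n∸m]≡n N≤e)) ⟩
    q ^ N * q ^ (e ∸ N)    ≈⟨ *-congʳ q^N≈0 ⟩
    0# * q ^ (e ∸ N)       ≈⟨ zeroˡ _ ⟩
    0#                     ∎

  V U : ℕ → Carrier
  V e = 1# - q ^ e
  U e = 1# + q ^ e

  V≈1 : ∀ {e} → N ≤ e → V e ≈ 1#
  V≈1 N≤e = trans (+-congˡ (trans (-‿cong (pow≈0 N≤e)) -0#≈0#)) (+-identityʳ 1#)

  U≈1 : ∀ {e} → N ≤ e → U e ≈ 1#
  U≈1 N≤e = trans (+-congˡ (pow≈0 N≤e)) (+-identityʳ 1#)

  -- The number of terms stays free because the counting vectors allow more than `N` multiplicities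
  -- per size.
  geometric-inverse : ∀ D e → N ≤ D → 1 ≤ e → V e * Σ D ((q ^ e) ^_) ≈ 1#
  geometric-inverse D e@(suc _) N≤D _ = begin
    V e * Σ D ((q ^ e) ^_)  ≈⟨ geometric D (q ^ e) ⟩
    1# - (q ^ e) ^ D        ≈⟨ +-congˡ (-‿cong (^-assocʳ q e D)) ⟩
    V (e ℕ.* D)             ≈⟨ V≈1 (ℕ.≤-trans N≤D (ℕ.m≤n*m D e)) ⟩
    1#                      ∎

  -- 1/(1 + x) is written as (1 - x)/(1 - x²), which reuses the geometric series.
  V⁻¹ U⁻¹ : ℕ → Carrier
  V⁻¹ e = Σ N ((q ^ e) ^_)
  U⁻¹ e = V e * V⁻¹ (e ℕ.+ e)

  V-inverse : ∀ e → 1 ≤ e → V e * V⁻¹ e ≈ 1#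
  V-inverse e = geometric-inverse N e ℕ.≤-refl

  U-inverse : ∀ e → 1 ≤ e → U e * U⁻¹ e ≈ 1#
  U-inverse e 1≤e = begin
    U e * (V e * V⁻¹ (e ℕ.+ e))   ≈⟨ *-assoc _ _ _ ⟨
    U e * V e * V⁻¹ (e ℕ.+ e)     ≈⟨ *-congʳ (solve 1 (λ x → (con (+ 1) :+ x) :* (con (+ 1) :- x) := con (+ 1) :- x :* x) refl (q ^ e)) ⟩
    (1# - q ^ e * q ^ e) * V⁻¹ (e ℕ.+ e) ≈⟨ *-congʳ (+-congˡ (-‿cong (^-homo-* q e e))) ⟨
    V (e ℕ.+ e) * V⁻¹ (e ℕ.+ e)   ≈⟨ V-inverse (e ℕ.+ e) (ℕ.≤-trans 1≤e (ℕ.m≤m+n e e)) ⟩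
    1#                            ∎

-- The explicit solution of the recursion

module ExplicitSolution {c ℓ} (R : CommutativeRing c ℓ) (q : CommutativeRing.Carrier R) (N : ℕ)
  (q^N≈0 : Nilpotent R q N)
  (k′ : ℕ) where
  open CommutativeRing R
  open SetoidReasoning setoid
  open RingLemmas R
  open NilpotentPowers R q N q^N≈0
  open +-*-Solver using () renaming (solve to solveℕ; _:+_ to _⊕_; _:*_ to _⊗_; _:=_ to _⊜_; con to nat)

  k h : ℕ
  k = suc k′
  h = suc (2 ℕ.* k′)

  -- In q-Pochhammer symbols w m n is (q;q²)ₘ₊₁ (q²ⁿ⁺²;q²)ₘ / (−q²ⁿ⁺¹;q)₂ₘ₊₁.  Up to
  -- normalisation it is forced by w-suc and w-shift, which are what makes H
  -- below satisfy the recursion.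
  w : ℕ → ℕ → Carrier
  w zero    n = V 1 * U⁻¹ (2 ℕ.* n ℕ.+ 1)
  w (suc m) n = V (2 ℕ.* suc m ℕ.+ 1) * V (2 ℕ.* (n ℕ.+ suc m)) * w m n
                * (U⁻¹ (2 ℕ.* (n ℕ.+ suc m)) * U⁻¹ (2 ℕ.* (n ℕ.+ suc m) ℕ.+ 1))

  pos₁ : ∀ n m → 1 ≤ 2 ℕ.* (n ℕ.+ suc m)
  pos₁ n m = ℕ.≤-trans (ℕ.≤-trans (s≤s z≤n) (ℕ.m≤n+m (suc m) n)) (ℕ.m≤n*m (n ℕ.+ suc m) 2)

  pos₂ : ∀ n → 1 ≤ n ℕ.+ 1
  pos₂ n = ℕ.m≤n+m 1 n

  w-suc : ∀ m n → U (2 ℕ.* (n ℕ.+ suc m)) * U (2 ℕ.* (n ℕ.+ suc m) ℕ.+ 1) * w (suc m) n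
                ≈ V (2 ℕ.* suc m ℕ.+ 1) * V (2 ℕ.* (n ℕ.+ suc m)) * w m n
  w-suc m n = begin
    a * b * (v * (i * j))     ≈⟨ solve 5 (λ a b i j v → a :* b :* (v :* (i :* j)) := (a :* i) :* (b :* j) :* v) refl a b i j v ⟩
    (a * i) * (b * j) * v     ≈⟨ *-congʳ (*-cong (U-inverse _ (pos₁ n m)) (U-inverse _ (pos₂ (2 ℕ.* (n ℕ.+ suc m))))) ⟩
    1# * 1# * v               ≈⟨ solve 1 (λ v → con (+ 1) :* con (+ 1) :* v := v) refl v ⟩
    v                         ∎
    where
    a b i j v : Carrier
    a = U (2 ℕ.* (n ℕ.+ suc m))
    b = U (2 ℕ.* (n ℕ.+ suc m) ℕ.+ 1)
    i = U⁻¹ (2 ℕ.* (n ℕ.+ suc m))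
    j = U⁻¹ (2 ℕ.* (n ℕ.+ suc m) ℕ.+ 1)
    v = V (2 ℕ.* suc m ℕ.+ 1) * V (2 ℕ.* (n ℕ.+ suc m)) * w m n

  -- Replacing n by n+1 moves the windows of both n-dependent Pochhammer symbols up by two. The
  -- result is `w (suc m) n` without its lowest factors `V (2n+2)`, `U (2n+1)`, `U (2n+2)` and
  -- without the new odd factor `V (2m+3)`.
  w-shift : ∀ m n → V (2 ℕ.* suc m ℕ.+ 1) * V (2 ℕ.* suc n) * w m (suc n)
                  ≈ U (2 ℕ.* n ℕ.+ 1) * U (2 ℕ.* suc n) * w (suc m) n
  w-shift zero n = begin
    v₃ * v * (V 1 * U⁻¹ (2 ℕ.* suc n ℕ.+ 1))
      ≈⟨ *-congˡ (*-congˡ (reflexive (≡.cong (λ t → U⁻¹ (2 ℕ.* t ℕ.+ 1)) (ℕ.+-comm 1 n)))) ⟩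
    v₃ * v * (V 1 * j)
      ≈⟨ solve 4 (λ a b c d → a :* b :* (c :* d) := con (+ 1) :* con (+ 1) :* (a :* b :* (c :* d))) refl v₃ v (V 1) j ⟩
    1# * 1# * (v₃ * v * (V 1 * j))
      ≈⟨ *-congʳ (*-cong (U-inverse _ (pos₂ (2 ℕ.* n))) (U-inverse _ (pos₁ n 0))) ⟨
    (a * i) * (b * b⁻¹) * (v₃ * v * (V 1 * j))
      ≈⟨ solve 8 (λ a i b b⁻¹ v₃ v v₁ j → (a :* i) :* (b :* b⁻¹) :* (v₃ :* v :* (v₁ :* j))
           := a :* b :* (v₃ :* v :* (v₁ :* i) :* (b⁻¹ :* j))) refl a i b b⁻¹ v₃ v (V 1) j ⟩
    a * b * (v₃ * v * (V 1 * i) * (b⁻¹ * j))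
      ≈⟨ *-cong (*-congˡ (reflexive (≡.cong (λ t → U (2 ℕ.* t)) (ℕ.+-comm n 1))))
                (*-congʳ (*-congʳ (*-congˡ (reflexive (≡.cong (λ t → V (2 ℕ.* t)) (ℕ.+-comm 1 n)))))) ⟩
    a * U (2 ℕ.* suc n) * w 1 n ∎
    where
    v₃ v a i b b⁻¹ j : Carrier
    v₃  = V 3
    v   = V (2 ℕ.* suc n)
    a   = U (2 ℕ.* n ℕ.+ 1)
    i   = U⁻¹ (2 ℕ.* n ℕ.+ 1)
    b   = U (2 ℕ.* (n ℕ.+ 1))
    b⁻¹ = U⁻¹ (2 ℕ.* (n ℕ.+ 1))
    j   = U⁻¹ (2 ℕ.* (n ℕ.+ 1) ℕ.+ 1)
  w-shift (suc m) n = begin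
    v′ * b * (v * d * w m (suc n) * r)
      ≈⟨ solve 6 (λ v′ b v d w r → v′ :* b :* (v :* d :* w :* r) := (v :* b :* w) :* (v′ :* d :* r)) refl v′ b v d (w m (suc n)) r ⟩
    (v * b * w m (suc n)) * (v′ * d * r)
      ≈⟨ *-congʳ (w-shift m n) ⟩
    (U (2 ℕ.* n ℕ.+ 1) * U (2 ℕ.* suc n) * w (suc m) n) * (v′ * d * r)
      ≈⟨ solve 6 (λ a b w v′ d r → (a :* b :* w) :* (v′ :* d :* r) := a :* b :* (v′ :* d :* w :* r))
           refl (U (2 ℕ.* n ℕ.+ 1)) (U (2 ℕ.* suc n)) (w (suc m) n) v′ d r ⟩
    U (2 ℕ.* n ℕ.+ 1) * U (2 ℕ.* suc n) * (v′ * d * w (suc m) n * r)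
      ≈⟨ *-congˡ (*-cong (*-congʳ (*-congˡ (reflexive (≡.cong (λ t → V (2 ℕ.* t)) eq))))
           (reflexive (≡.cong (λ t → U⁻¹ (2 ℕ.* t) * U⁻¹ (2 ℕ.* t ℕ.+ 1)) eq))) ⟩
    U (2 ℕ.* n ℕ.+ 1) * U (2 ℕ.* suc n) * w (suc (suc m)) n ∎
    where
    eq : suc n ℕ.+ suc m ≡ n ℕ.+ suc (suc m)
    eq = ≡.sym (ℕ.+-suc n (suc m))
    v v′ b d r : Carrier
    v = V (2 ℕ.* suc m ℕ.+ 1)
    v′ = V (2 ℕ.* suc (suc m) ℕ.+ 1)
    b = V (2 ℕ.* suc n)
    d = V (2 ℕ.* (suc n ℕ.+ suc m))
    r = U⁻¹ (2 ℕ.* (suc n ℕ.+ suc m)) * U⁻¹ (2 ℕ.* (suc n ℕ.+ suc m) ℕ.+ 1)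

  θ : ℕ → Carrier
  θ n = (- 1#) ^ n * q ^ (h ℕ.* (n ℕ.* n))

  θ-suc : ∀ n → θ (suc n) ≈ - (θ n * q ^ (h ℕ.* (2 ℕ.* n ℕ.+ 1)))
  θ-suc n = begin
    (- 1#) * (- 1#) ^ n * q ^ (h ℕ.* (suc n ℕ.* suc n))
      ≈⟨ *-congˡ (pow-+ (h ℕ.* (n ℕ.* n)) (h ℕ.* (2 ℕ.* n ℕ.+ 1))
           (solveℕ 2 (λ h n → h ⊗ ((nat 1 ⊕ n) ⊗ (nat 1 ⊕ n)) ⊜ h ⊗ (n ⊗ n) ⊕ h ⊗ (nat 2 ⊗ n ⊕ nat 1)) ≡.refl h n)) ⟩
    (- 1#) * (- 1#) ^ n * (q ^ (h ℕ.* (n ℕ.* n)) * q ^ (h ℕ.* (2 ℕ.* n ℕ.+ 1)))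
      ≈⟨ solve 3 (λ s a b → (:- con (+ 1)) :* s :* (a :* b) := :- (s :* a :* b)) refl _ _ _ ⟩
    - (θ n * q ^ (h ℕ.* (2 ℕ.* n ℕ.+ 1))) ∎

  θ≈0 : ∀ {n} → N ≤ n → θ n ≈ 0#
  θ≈0 {n} N≤n = trans (*-congˡ (pow≈0 (ℕ.≤-trans N≤n (ℕ.≤-trans (square n) (ℕ.m≤m+n (n ℕ.* n) _))))) (zeroʳ _)
    where
    square : ∀ n → n ≤ n ℕ.* n
    square zero    = z≤n
    square (suc n) = ℕ.m≤m*n (suc n) (suc n)

  e₁ e₂ : ℕ → ℕ → ℕ → ℕ
  e₁ m n j = 2 ℕ.* n ℕ.* (m ℕ.* k ℕ.+ j)
  e₂ m n i = 2 ℕ.* n ℕ.* (suc m ℕ.* k) ℕ.+ 2 ℕ.* (n ℕ.+ suc m) ℕ.* i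

  -- The argument j stands for k - i. The second monomial is the term of index -n-m-1 of the
  -- bilateral series with summand (-1)ⁿ q^(hn² + 2n(mk+j)) · w: under n ↦ -n-m-1 the factor w, read
  -- as a quotient of Pochhammer symbols, reproduces itself up to (-1)ᵐ q^((m+1)(2n+m+1)). For -m ≤
  -- n ≤ -1 it contains the factor 1 - q⁰, so the pairs with n ≥ 0 exhaust the series.
  E : ℕ → ℕ → ℕ → ℕ → Carrier
  E m n i j = q ^ e₁ m n j - q ^ e₂ m n i

  H : ℕ → ℕ → Carrier
  H m i = Σ N (λ n → θ n * w m n * E m n i (k ∸ i))

  H-cong : ∀ m i j → i ℕ.+ j ≡ k → H m i ≈ Σ N (λ n → θ n * w m n * E m n i j)
  H-cong m i j i+j≡k = Σ-cong N (λ n _ → *-congˡ (reflexive (≡.cong (E m n i) (≡.trans (≡.cong (_∸ i) (≡.sym i+j≡k)) (ℕ.m+n∸m≡n i j)))))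

  H-zero : ∀ m → H m 0 ≈ 0#
  H-zero m = Σ-0 N (λ n _ → trans (*-congˡ (vanish n)) (zeroʳ _))
    where
    vanish : ∀ n → E m n 0 k ≈ 0#
    vanish n = begin
      q ^ e₁ m n k - q ^ e₂ m n 0 ≈⟨ +-congˡ (-‿cong (pow-≡
        (solveℕ 3 (λ m n k → nat 2 ⊗ n ⊗ ((nat 1 ⊕ m) ⊗ k) ⊕ nat 2 ⊗ (n ⊕ (nat 1 ⊕ m)) ⊗ nat 0 ⊜ nat 2 ⊗ n ⊗ (m ⊗ k ⊕ k)) ≡.refl m n k))) ⟩
      q ^ e₁ m n k - q ^ e₁ m n k ≈⟨ -‿inverseʳ _ ⟩
      0#                          ∎

  module Difference (m d j : ℕ) (d+1+j≡k : d ℕ.+ suc j ≡ k) where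
    t s : ℕ → Carrier
    t n = θ n * w m n * q ^ e₁ m n j * V (2 ℕ.* n)
    s n = θ n * w m n * q ^ e₂ m n d * V (2 ℕ.* (n ℕ.+ suc m))

    -- The exponent brought in by `t (suc n)`: the ratio of consecutive `θ` gives the first summand,
    -- the monomial of `t` the second.
    φ : ℕ → ℕ
    φ n = h ℕ.* (2 ℕ.* n ℕ.+ 1) ℕ.+ e₁ m (suc n) j

    τ : ℕ → Carrier
    τ n = q ^ e₂ m n d * (U (2 ℕ.* (n ℕ.+ suc m)) * U (2 ℕ.* (n ℕ.+ suc m) ℕ.+ 1))
        - q ^ φ n * (U (2 ℕ.* n ℕ.+ 1) * U (2 ℕ.* suc n))

    E-diff : ∀ n → E m n (suc d) j ≈ E m n d (suc j) + (q ^ e₁ m n j * V (2 ℕ.* n) + q ^ e₂ m n d * V (2 ℕ.* (n ℕ.+ suc m)))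
    E-diff n = begin
      q ^ e₁ m n j - q ^ e₂ m n (suc d)
        ≈⟨ +-congˡ (-‿cong (pow-+ (e₂ m n d) (2 ℕ.* (n ℕ.+ suc m))
             (solveℕ 4 (λ m n k d → nat 2 ⊗ n ⊗ ((nat 1 ⊕ m) ⊗ k) ⊕ nat 2 ⊗ (n ⊕ (nat 1 ⊕ m)) ⊗ (nat 1 ⊕ d)
               ⊜ nat 2 ⊗ n ⊗ ((nat 1 ⊕ m) ⊗ k) ⊕ nat 2 ⊗ (n ⊕ (nat 1 ⊕ m)) ⊗ d ⊕ nat 2 ⊗ (n ⊕ (nat 1 ⊕ m))) ≡.refl m n k d))) ⟩
      a - b * y
        ≈⟨ solve 4 (λ a b x y → a :- b :* y := (a :* x :- b) :+ (a :* (con (+ 1) :- x) :+ b :* (con (+ 1) :- y))) refl a b x y ⟩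
      (a * x - b) + (a * V (2 ℕ.* n) + b * V (2 ℕ.* (n ℕ.+ suc m)))
        ≈⟨ +-congʳ (+-congʳ (pow-+ (e₁ m n j) (2 ℕ.* n)
             (solveℕ 4 (λ m n k j → nat 2 ⊗ n ⊗ (m ⊗ k ⊕ (nat 1 ⊕ j)) ⊜ nat 2 ⊗ n ⊗ (m ⊗ k ⊕ j) ⊕ nat 2 ⊗ n) ≡.refl m n k j))) ⟨
      E m n d (suc j) + (a * V (2 ℕ.* n) + b * V (2 ℕ.* (n ℕ.+ suc m))) ∎
      where
      a b x y : Carrier
      a = q ^ e₁ m n j
      b = q ^ e₂ m n d
      x = q ^ (2 ℕ.* n)
      y = q ^ (2 ℕ.* (n ℕ.+ suc m))

    H-diff : H m (suc d) ≈ H m d + (Σ N t + Σ N s)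
    H-diff = begin
      H m (suc d)
        ≈⟨ H-cong m (suc d) j (≡.trans (≡.sym (ℕ.+-suc d j)) d+1+j≡k) ⟩
      Σ N (λ n → θ n * w m n * E m n (suc d) j)
        ≈⟨ Σ-cong N (λ n _ → trans (*-congˡ (E-diff n))
             (solve 7 (λ θ w e a x b y → θ :* w :* (e :+ (a :* x :+ b :* y)) := θ :* w :* e :+ (θ :* w :* a :* x :+ θ :* w :* b :* y))
               refl (θ n) (w m n) (E m n d (suc j)) _ _ _ _)) ⟩
      Σ N (λ n → θ n * w m n * E m n d (suc j) + (t n + s n))
        ≈⟨ Σ-+ N _ _ ⟩
      Σ N (λ n → θ n * w m n * E m n d (suc j)) + Σ N (λ n → t n + s n)
        ≈⟨ +-cong (sym (H-cong m d (suc j) d+1+j≡k)) (Σ-+ N t s) ⟩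
      H m d + (Σ N t + Σ N s) ∎

    -- The factor `V (2n)` kills the term n = 0, and `θ` kills the new last term.
    Σ-t-shift : Σ N t ≈ Σ N (t ∘ suc)
    Σ-t-shift = begin
      Σ N t                 ≈⟨ +-identityʳ _ ⟨
      Σ N t + 0#            ≈⟨ +-congˡ t-last ⟨
      Σ (suc N) t           ≈⟨ Σ-head N t ⟩
      t 0 + Σ N (t ∘ suc)   ≈⟨ +-congʳ (trans (*-congˡ (-‿inverseʳ 1#)) (zeroʳ _)) ⟩
      0# + Σ N (t ∘ suc)    ≈⟨ +-identityˡ _ ⟩
      Σ N (t ∘ suc)         ∎
      where
      t-last : t N ≈ 0#
      t-last = trans (*-congʳ (*-congʳ (*-congʳ (θ≈0 ℕ.≤-refl))))
        (solve 3 (λ a b c → con (+ 0) :* a :* b :* c := con (+ 0)) refl _ _ _)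

    -- Multiplying by `V (2m+3)` makes `w-shift` applicable to the shifted piece and `w-suc` to the
    -- other, so `w (suc m) n` can be taken out of both. The minus sign inside `τ` is that of
    -- `θ-suc`.
    combine : ∀ n → V (2 ℕ.* suc m ℕ.+ 1) * (t (suc n) + s n) ≈ θ n * w (suc m) n * τ n
    combine n = begin
      v * (θ (suc n) * w m (suc n) * x * V (2 ℕ.* suc n) + s n)
        ≈⟨ *-congˡ (+-congʳ (*-congʳ (*-congʳ (*-congʳ (θ-suc n))))) ⟩
      v * (- (θ n * y) * w m (suc n) * x * v₂ + θ n * w m n * z * v₃)
        ≈⟨ solve 9 (λ v θ y w′ x v₂ w z v₃ → v :* (:- (θ :* y) :* w′ :* x :* v₂ :+ θ :* w :* z :* v₃)
             := θ :* (z :* (v :* v₃ :* w) :- y :* x :* (v :* v₂ :* w′))) refl v (θ n) y (w m (suc n)) x v₂ (w m n) z v₃ ⟩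
      θ n * (z * (v * v₃ * w m n) - y * x * (v * v₂ * w m (suc n)))
        ≈⟨ *-congˡ (+-cong (*-congˡ (sym (w-suc m n)))
             (-‿cong (*-cong (sym (^-homo-* q (h ℕ.* (2 ℕ.* n ℕ.+ 1)) (e₁ m (suc n) j))) (w-shift m n)))) ⟩
      θ n * (z * (a * b * w (suc m) n) - q ^ φ n * (c′ * d′ * w (suc m) n))
        ≈⟨ solve 8 (λ θ z a b f c d w → θ :* (z :* (a :* b :* w) :- f :* (c :* d :* w)) := θ :* w :* (z :* (a :* b) :- f :* (c :* d)))
             refl (θ n) z a b (q ^ φ n) c′ d′ (w (suc m) n) ⟩
      θ n * w (suc m) n * τ n ∎
      where
      v v₂ v₃ x y z a b c′ d′ : Carrier
      v  = V (2 ℕ.* suc m ℕ.+ 1)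
      v₂ = V (2 ℕ.* suc n)
      v₃ = V (2 ℕ.* (n ℕ.+ suc m))
      x  = q ^ e₁ m (suc n) j
      y  = q ^ (h ℕ.* (2 ℕ.* n ℕ.+ 1))
      z  = q ^ e₂ m n d
      a  = U (2 ℕ.* (n ℕ.+ suc m))
      b  = U (2 ℕ.* (n ℕ.+ suc m) ℕ.+ 1)
      c′ = U (2 ℕ.* n ℕ.+ 1)
      d′ = U (2 ℕ.* suc n)

    H-step : V (2 ℕ.* suc m ℕ.+ 1) * H m (suc d)
           ≈ V (2 ℕ.* suc m ℕ.+ 1) * H m d + Σ N (λ n → θ n * w (suc m) n * τ n)
    H-step = begin
      v * H m (suc d)                           ≈⟨ *-congˡ (trans H-diff (+-congˡ (+-congʳ Σ-t-shift))) ⟩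
      v * (H m d + (Σ N (t ∘ suc) + Σ N s))     ≈⟨ *-congˡ (+-congˡ (Σ-+ N (t ∘ suc) s)) ⟨
      v * (H m d + Σ N (λ n → t (suc n) + s n)) ≈⟨ distribˡ _ _ _ ⟩
      v * H m d + v * Σ N (λ n → t (suc n) + s n) ≈⟨ +-congˡ (trans (Σ-distribˡ N v _) (Σ-cong N (λ n _ → combine n))) ⟩
      _ ∎
      where
      v : Carrier
      v = V (2 ℕ.* suc m ℕ.+ 1)

    -- Expanding the two products of `U` in `τ` gives four monomials each. Those of the first
    -- product are the first halves of the three `E`, since a factor q^(2n) raises the last argument
    -- of `e₁` by one; those of the second product are the second halves, a factor q^(2(n+m+2))
    -- raising that of `e₂`. The two middle monomials share one `E`, hence its coefficient is a sum.
    τ-interior : ∀ j′ → j ≡ suc j′ → ∀ n →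
      τ n ≈ q ^ (2 ℕ.* suc m ℕ.* d) *
        (E (suc m) n (suc (suc j′)) d
         + (q ^ (2 ℕ.* suc m) + q ^ (2 ℕ.* suc m ℕ.+ 1)) * E (suc m) n (suc j′) (suc d)
         + q ^ (2 ℕ.* suc m) * q ^ (2 ℕ.* suc m ℕ.+ 1) * E (suc m) n j′ (suc (suc d)))
    τ-interior j′ ≡.refl n = begin
      τ n
        ≈⟨ +-cong (*-cong e₂-eq (*-cong (+-congˡ ax-eq) (+-congˡ axQ-eq)))
                  (-‿cong (*-cong φ-eq (*-cong (+-congˡ (^-homo-* q (2 ℕ.* n) 1)) (+-congˡ aQQ-eq)))) ⟩
      X * P * ((1# + a * x) * (1# + a * x * Q)) - X * S * (x * x * Q) * ((1# + a * Q) * (1# + a * (Q * Q)))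
        ≈⟨ solve 6 (λ X P a x S Q →
             X :* P :* ((con (+ 1) :+ a :* x) :* (con (+ 1) :+ a :* x :* Q))
               :- X :* S :* (x :* x :* Q) :* ((con (+ 1) :+ a :* Q) :* (con (+ 1) :+ a :* (Q :* Q)))
             := X :* ((P :- S :* (a :* x :* (Q :* Q)) :* (a :* x :* (Q :* Q)))
                 :+ (x :+ x :* Q) :* (P :* a :- S :* (a :* x :* (Q :* Q)))
                 :+ x :* (x :* Q) :* (P :* a :* a :- S))) refl X P a x S Q ⟩
      X * ((P - S * (a * x * (Q * Q)) * (a * x * (Q * Q)))
           + (x + x * Q) * (P * a - S * (a * x * (Q * Q)))
           + x * (x * Q) * (P * a * a - S))
        ≈⟨ *-congˡ (+-cong (+-cong (+-congˡ (-‿cong (trans (*-congʳ (S-suc j′)) (S-suc (suc j′)))))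
             (*-cong (+-congˡ (sym (^-homo-* q (2 ℕ.* suc m) 1))) (+-cong (P-suc d) (-‿cong (S-suc j′)))))
             (*-cong (*-congˡ (sym (^-homo-* q (2 ℕ.* suc m) 1))) (+-congʳ (trans (*-congʳ (P-suc d)) (P-suc (suc d)))))) ⟩
      _ ∎
      where
      X P a x S Q : Carrier
      X = q ^ (2 ℕ.* suc m ℕ.* d)
      P = q ^ e₁ (suc m) n d
      a = q ^ (2 ℕ.* n)
      x = q ^ (2 ℕ.* suc m)
      S = q ^ e₂ (suc m) n j′
      Q = q ^ 1

      ax-eq : q ^ (2 ℕ.* (n ℕ.+ suc m)) ≈ a * x
      ax-eq = pow-+ (2 ℕ.* n) (2 ℕ.* suc m) (ℕ.*-distribˡ-+ 2 n (suc m))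

      axQ-eq : q ^ (2 ℕ.* (n ℕ.+ suc m) ℕ.+ 1) ≈ a * x * Q
      axQ-eq = trans (^-homo-* q (2 ℕ.* (n ℕ.+ suc m)) 1) (*-congʳ ax-eq)

      aQQ-eq : q ^ (2 ℕ.* suc n) ≈ a * (Q * Q)
      aQQ-eq = trans (pow-+ (2 ℕ.* n) 2 (solveℕ 1 (λ n → nat 2 ⊗ (nat 1 ⊕ n) ⊜ nat 2 ⊗ n ⊕ nat 2) ≡.refl n))
                     (*-congˡ (^-homo-* q 1 1))

      e₂-eq : q ^ e₂ m n d ≈ X * P
      e₂-eq = pow-+ (2 ℕ.* suc m ℕ.* d) (e₁ (suc m) n d)
        (solveℕ 4 (λ n m k d → nat 2 ⊗ n ⊗ ((nat 1 ⊕ m) ⊗ k) ⊕ nat 2 ⊗ (n ⊕ (nat 1 ⊕ m)) ⊗ d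
          ⊜ nat 2 ⊗ (nat 1 ⊕ m) ⊗ d ⊕ nat 2 ⊗ n ⊗ ((nat 1 ⊕ m) ⊗ k ⊕ d)) ≡.refl n m k d)

      φ-exponent : ∀ κ → κ ≡ d ℕ.+ suc j′ →
        suc (2 ℕ.* κ) ℕ.* (2 ℕ.* n ℕ.+ 1) ℕ.+ 2 ℕ.* suc n ℕ.* (m ℕ.* suc κ ℕ.+ suc j′)
        ≡ 2 ℕ.* suc m ℕ.* d ℕ.+ (2 ℕ.* n ℕ.* (suc (suc m) ℕ.* suc κ) ℕ.+ 2 ℕ.* (n ℕ.+ suc (suc m)) ℕ.* j′)
          ℕ.+ (2 ℕ.* suc m ℕ.+ 2 ℕ.* suc m ℕ.+ 1)
      φ-exponent _ ≡.refl = solveℕ 4 (λ d j n m →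
        let κ = d ⊕ (nat 1 ⊕ j) in
        (nat 1 ⊕ nat 2 ⊗ κ) ⊗ (nat 2 ⊗ n ⊕ nat 1) ⊕ nat 2 ⊗ (nat 1 ⊕ n) ⊗ (m ⊗ (nat 1 ⊕ κ) ⊕ (nat 1 ⊕ j))
        ⊜ nat 2 ⊗ (nat 1 ⊕ m) ⊗ d ⊕ (nat 2 ⊗ n ⊗ ((nat 2 ⊕ m) ⊗ (nat 1 ⊕ κ)) ⊕ nat 2 ⊗ (n ⊕ (nat 2 ⊕ m)) ⊗ j)
          ⊕ (nat 2 ⊗ (nat 1 ⊕ m) ⊕ nat 2 ⊗ (nat 1 ⊕ m) ⊕ nat 1)) ≡.refl d j′ n m

      φ-eq : q ^ φ n ≈ X * S * (x * x * Q)
      φ-eq = begin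
        q ^ φ n
          ≈⟨ pow-+ (2 ℕ.* suc m ℕ.* d ℕ.+ e₂ (suc m) n j′) (2 ℕ.* suc m ℕ.+ 2 ℕ.* suc m ℕ.+ 1)
               (φ-exponent k′ (ℕ.suc-injective (≡.trans (≡.sym d+1+j≡k) (ℕ.+-suc d (suc j′))))) ⟩
        q ^ (2 ℕ.* suc m ℕ.* d ℕ.+ e₂ (suc m) n j′) * q ^ (2 ℕ.* suc m ℕ.+ 2 ℕ.* suc m ℕ.+ 1)
          ≈⟨ *-cong (^-homo-* q (2 ℕ.* suc m ℕ.* d) (e₂ (suc m) n j′))
                    (trans (^-homo-* q (2 ℕ.* suc m ℕ.+ 2 ℕ.* suc m) 1) (*-congʳ (^-homo-* q (2 ℕ.* suc m) (2 ℕ.* suc m)))) ⟩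
        X * S * (x * x * Q) ∎

      P-suc : ∀ d → q ^ e₁ (suc m) n d * a ≈ q ^ e₁ (suc m) n (suc d)
      P-suc d = sym (pow-+ (e₁ (suc m) n d) (2 ℕ.* n)
        (solveℕ 4 (λ n m k d → nat 2 ⊗ n ⊗ ((nat 1 ⊕ m) ⊗ k ⊕ (nat 1 ⊕ d)) ⊜ nat 2 ⊗ n ⊗ ((nat 1 ⊕ m) ⊗ k ⊕ d) ⊕ nat 2 ⊗ n) ≡.refl n m k d))

      S-suc : ∀ j → q ^ e₂ (suc m) n j * (a * x * (Q * Q)) ≈ q ^ e₂ (suc m) n (suc j)
      S-suc j = sym (begin
        q ^ e₂ (suc m) n (suc j)
          ≈⟨ pow-+ (e₂ (suc m) n j) (2 ℕ.* (n ℕ.+ suc m) ℕ.+ 2)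
               (solveℕ 4 (λ n m k j → nat 2 ⊗ n ⊗ ((nat 2 ⊕ m) ⊗ k) ⊕ nat 2 ⊗ (n ⊕ (nat 2 ⊕ m)) ⊗ (nat 1 ⊕ j)
                 ⊜ nat 2 ⊗ n ⊗ ((nat 2 ⊕ m) ⊗ k) ⊕ nat 2 ⊗ (n ⊕ (nat 2 ⊕ m)) ⊗ j ⊕ (nat 2 ⊗ (n ⊕ (nat 1 ⊕ m)) ⊕ nat 2)) ≡.refl n m k j) ⟩
        q ^ e₂ (suc m) n j * q ^ (2 ℕ.* (n ℕ.+ suc m) ℕ.+ 2)
          ≈⟨ *-congˡ (trans (^-homo-* q (2 ℕ.* (n ℕ.+ suc m)) 2) (*-cong ax-eq (^-homo-* q 1 1))) ⟩
        q ^ e₂ (suc m) n j * (a * x * (Q * Q)) ∎)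

    -- Here the terms linear in q^(2n) cancel, and (1 - g)(1 - g a²Q³) is left, with g = q^(2m+1), a
    -- = q^(2n), Q = q. The factor 1 - g is the one that condition (3) puts into `K m 1`.
    τ-boundary : j ≡ 0 → ∀ n →
      τ n ≈ q ^ (2 ℕ.* suc m ℕ.* d) * (V (2 ℕ.* m ℕ.+ 1) * E (suc m) n 1 d)
    τ-boundary ≡.refl n = begin
      τ n
        ≈⟨ +-cong (*-cong e₂-eq (*-cong (+-congˡ agQ-eq) (+-congˡ (trans (^-homo-* q (2 ℕ.* (n ℕ.+ suc m)) 1) (*-congʳ agQ-eq)))))
                  (-‿cong (*-cong φ-eq (*-cong (+-congˡ (^-homo-* q (2 ℕ.* n) 1)) (+-congˡ aQQ-eq)))) ⟩
      X * P * ((1# + a * (g * Q)) * (1# + a * (g * Q) * Q)) - X * P * g * ((1# + a * Q) * (1# + a * (Q * Q)))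
        ≈⟨ solve 5 (λ X P a g Q →
             X :* P :* ((con (+ 1) :+ a :* (g :* Q)) :* (con (+ 1) :+ a :* (g :* Q) :* Q))
               :- X :* P :* g :* ((con (+ 1) :+ a :* Q) :* (con (+ 1) :+ a :* (Q :* Q)))
             := X :* ((con (+ 1) :- g) :* (P :- P :* (a :* a :* (g :* Q :* (Q :* Q)))))) refl X P a g Q ⟩
      X * ((1# - g) * (P - P * (a * a * (g * Q * (Q * Q)))))
        ≈⟨ *-congˡ (*-congˡ (+-congˡ (-‿cong (sym S-eq)))) ⟩
      _ ∎
      where
      X P a g Q : Carrier
      X = q ^ (2 ℕ.* suc m ℕ.* d)
      P = q ^ e₁ (suc m) n d
      a = q ^ (2 ℕ.* n)
      g = q ^ (2 ℕ.* m ℕ.+ 1)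
      Q = q ^ 1

      k′≡d : k′ ≡ d
      k′≡d = ℕ.suc-injective (≡.trans (≡.sym d+1+j≡k) (ℕ.+-comm d 1))

      agQ-eq : q ^ (2 ℕ.* (n ℕ.+ suc m)) ≈ a * (g * Q)
      agQ-eq = trans (pow-+ (2 ℕ.* n) (2 ℕ.* m ℕ.+ 1 ℕ.+ 1)
          (solveℕ 2 (λ n m → nat 2 ⊗ (n ⊕ (nat 1 ⊕ m)) ⊜ nat 2 ⊗ n ⊕ (nat 2 ⊗ m ⊕ nat 1 ⊕ nat 1)) ≡.refl n m))
        (*-congˡ (^-homo-* q (2 ℕ.* m ℕ.+ 1) 1))

      aQQ-eq : q ^ (2 ℕ.* suc n) ≈ a * (Q * Q)
      aQQ-eq = trans (pow-+ (2 ℕ.* n) 2 (solveℕ 1 (λ n → nat 2 ⊗ (nat 1 ⊕ n) ⊜ nat 2 ⊗ n ⊕ nat 2) ≡.refl n))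
                     (*-congˡ (^-homo-* q 1 1))

      e₂-eq : q ^ e₂ m n d ≈ X * P
      e₂-eq = pow-+ (2 ℕ.* suc m ℕ.* d) (e₁ (suc m) n d)
        (solveℕ 4 (λ n m k d → nat 2 ⊗ n ⊗ ((nat 1 ⊕ m) ⊗ k) ⊕ nat 2 ⊗ (n ⊕ (nat 1 ⊕ m)) ⊗ d
          ⊜ nat 2 ⊗ (nat 1 ⊕ m) ⊗ d ⊕ nat 2 ⊗ n ⊗ ((nat 1 ⊕ m) ⊗ k ⊕ d)) ≡.refl n m k d)

      φ-exponent : ∀ κ → κ ≡ d →
        suc (2 ℕ.* κ) ℕ.* (2 ℕ.* n ℕ.+ 1) ℕ.+ 2 ℕ.* suc n ℕ.* (m ℕ.* suc κ ℕ.+ 0)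
        ≡ 2 ℕ.* suc m ℕ.* d ℕ.+ 2 ℕ.* n ℕ.* (suc m ℕ.* suc κ ℕ.+ d) ℕ.+ (2 ℕ.* m ℕ.+ 1)
      φ-exponent _ ≡.refl = solveℕ 3 (λ d n m →
        (nat 1 ⊕ nat 2 ⊗ d) ⊗ (nat 2 ⊗ n ⊕ nat 1) ⊕ nat 2 ⊗ (nat 1 ⊕ n) ⊗ (m ⊗ (nat 1 ⊕ d) ⊕ nat 0)
        ⊜ nat 2 ⊗ (nat 1 ⊕ m) ⊗ d ⊕ nat 2 ⊗ n ⊗ ((nat 1 ⊕ m) ⊗ (nat 1 ⊕ d) ⊕ d) ⊕ (nat 2 ⊗ m ⊕ nat 1)) ≡.refl d n m

      φ-eq : q ^ φ n ≈ X * P * g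
      φ-eq = trans (pow-+ (2 ℕ.* suc m ℕ.* d ℕ.+ e₁ (suc m) n d) (2 ℕ.* m ℕ.+ 1) (φ-exponent k′ k′≡d))
                   (*-congʳ (^-homo-* q (2 ℕ.* suc m ℕ.* d) (e₁ (suc m) n d)))

      S-exponent : ∀ κ → κ ≡ d →
        2 ℕ.* n ℕ.* (suc (suc m) ℕ.* suc κ) ℕ.+ 2 ℕ.* (n ℕ.+ suc (suc m)) ℕ.* 1
        ≡ 2 ℕ.* n ℕ.* (suc m ℕ.* suc κ ℕ.+ d) ℕ.+ (2 ℕ.* n ℕ.+ 2 ℕ.* n ℕ.+ (2 ℕ.* m ℕ.+ 1 ℕ.+ 1 ℕ.+ 2))
      S-exponent _ ≡.refl = solveℕ 3 (λ d n m →
        nat 2 ⊗ n ⊗ ((nat 2 ⊕ m) ⊗ (nat 1 ⊕ d)) ⊕ nat 2 ⊗ (n ⊕ (nat 2 ⊕ m)) ⊗ nat 1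
        ⊜ nat 2 ⊗ n ⊗ ((nat 1 ⊕ m) ⊗ (nat 1 ⊕ d) ⊕ d) ⊕ (nat 2 ⊗ n ⊕ nat 2 ⊗ n ⊕ (nat 2 ⊗ m ⊕ nat 1 ⊕ nat 1 ⊕ nat 2))) ≡.refl d n m

      S-eq : q ^ e₂ (suc m) n 1 ≈ P * (a * a * (g * Q * (Q * Q)))
      S-eq = trans (pow-+ (e₁ (suc m) n d) (2 ℕ.* n ℕ.+ 2 ℕ.* n ℕ.+ (2 ℕ.* m ℕ.+ 1 ℕ.+ 1 ℕ.+ 2)) (S-exponent k′ k′≡d))
        (*-congˡ (trans (^-homo-* q (2 ℕ.* n ℕ.+ 2 ℕ.* n) (2 ℕ.* m ℕ.+ 1 ℕ.+ 1 ℕ.+ 2))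
          (*-cong (^-homo-* q (2 ℕ.* n) (2 ℕ.* n))
            (trans (^-homo-* q (2 ℕ.* m ℕ.+ 1 ℕ.+ 1) 2) (*-cong (^-homo-* q (2 ℕ.* m ℕ.+ 1) 1) (^-homo-* q 1 1))))))

    τ-sum-interior : ∀ j′ → j ≡ suc j′ →
      Σ N (λ n → θ n * w (suc m) n * τ n) ≈ q ^ (2 ℕ.* suc m ℕ.* d) *
        (H (suc m) (suc (suc j′))
         + (q ^ (2 ℕ.* suc m) + q ^ (2 ℕ.* suc m ℕ.+ 1)) * H (suc m) (suc j′)
         + q ^ (2 ℕ.* suc m) * q ^ (2 ℕ.* suc m ℕ.+ 1) * H (suc m) j′)
    τ-sum-interior j′ ≡.refl = begin
      Σ N (λ n → θ n * w (suc m) n * τ n)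
        ≈⟨ Σ-cong N (λ n _ → trans (*-congˡ (τ-interior j′ ≡.refl n))
             (solve 7 (λ t X A b B f F → t :* (X :* (A :+ b :* B :+ f :* F)) := X :* (t :* A :+ b :* (t :* B) :+ f :* (t :* F)))
               refl (θ n * w (suc m) n) X _ β _ γ _)) ⟩
      Σ N (λ n → X * (A n + β * B n + γ * F n))
        ≈⟨ Σ-distribˡ N X _ ⟨
      X * Σ N (λ n → A n + β * B n + γ * F n)
        ≈⟨ *-congˡ (trans (Σ-+ N _ _) (+-cong (trans (Σ-+ N _ _) (+-congˡ (sym (Σ-distribˡ N β B)))) (sym (Σ-distribˡ N γ F)))) ⟩
      X * (Σ N A + β * Σ N B + γ * Σ N F)
        ≈⟨ *-congˡ (+-cong (+-cong (H-cong (suc m) (suc (suc j′)) d (≡.trans (ℕ.+-comm (suc (suc j′)) d) d+1+j≡k))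
             (*-congˡ (H-cong (suc m) (suc j′) (suc d) (≡.trans (swap (suc j′) d) d+1+j≡k))))
             (*-congˡ (H-cong (suc m) j′ (suc (suc d)) (≡.trans (≡.trans (swap j′ (suc d)) (≡.sym (ℕ.+-suc d (suc j′)))) d+1+j≡k)))) ⟨
      _ ∎
      where
      X β γ : Carrier
      X = q ^ (2 ℕ.* suc m ℕ.* d)
      β = q ^ (2 ℕ.* suc m) + q ^ (2 ℕ.* suc m ℕ.+ 1)
      γ = q ^ (2 ℕ.* suc m) * q ^ (2 ℕ.* suc m ℕ.+ 1)
      A B F : ℕ → Carrier
      A n = θ n * w (suc m) n * E (suc m) n (suc (suc j′)) d
      B n = θ n * w (suc m) n * E (suc m) n (suc j′) (suc d)
      F n = θ n * w (suc m) n * E (suc m) n j′ (suc (suc d))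
      swap : ∀ a b → a ℕ.+ suc b ≡ b ℕ.+ suc a
      swap a b = ≡.trans (ℕ.+-suc a b) (≡.trans (≡.cong suc (ℕ.+-comm a b)) (≡.sym (ℕ.+-suc b a)))

    τ-sum-boundary : j ≡ 0 →
      Σ N (λ n → θ n * w (suc m) n * τ n) ≈ q ^ (2 ℕ.* suc m ℕ.* d) * (V (2 ℕ.* m ℕ.+ 1) * H (suc m) 1)
    τ-sum-boundary ≡.refl = begin
      Σ N (λ n → θ n * w (suc m) n * τ n)
        ≈⟨ Σ-cong N (λ n _ → trans (*-congˡ (τ-boundary ≡.refl n))
             (solve 4 (λ t X v A → t :* (X :* (v :* A)) := X :* v :* (t :* A)) refl (θ n * w (suc m) n) X v _)) ⟩
      Σ N (λ n → X * v * (θ n * w (suc m) n * E (suc m) n 1 d))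
        ≈⟨ Σ-distribˡ N (X * v) _ ⟨
      X * v * Σ N (λ n → θ n * w (suc m) n * E (suc m) n 1 d)
        ≈⟨ *-congˡ (H-cong (suc m) 1 d (≡.trans (ℕ.+-comm 1 d) d+1+j≡k)) ⟨
      X * v * H (suc m) 1
        ≈⟨ *-assoc _ _ _ ⟩
      X * (v * H (suc m) 1) ∎
      where
      X v : Carrier
      X = q ^ (2 ℕ.* suc m ℕ.* d)
      v = V (2 ℕ.* m ℕ.+ 1)

  overpartitionProduct⁻¹ : ℕ → Carrier
  overpartitionProduct⁻¹ n = Π n (λ s → V (suc s) * U⁻¹ (suc s))

  -- At n = 0 the symbols (q;q²) and (q²;q²) in the numerator interleave to (q;q).
  w-at-0 : ∀ m → w m 0 ≈ overpartitionProduct⁻¹ (suc (2 ℕ.* m))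
  w-at-0 zero    = sym (*-identityˡ _)
  w-at-0 (suc m) = begin
    V (2 ℕ.* suc m ℕ.+ 1) * V (2 ℕ.* suc m) * w m 0 * (U⁻¹ (2 ℕ.* suc m) * U⁻¹ (2 ℕ.* suc m ℕ.+ 1))
      ≈⟨ *-congʳ (*-congˡ (w-at-0 m)) ⟩
    V (2 ℕ.* suc m ℕ.+ 1) * V (2 ℕ.* suc m) * C * (U⁻¹ (2 ℕ.* suc m) * U⁻¹ (2 ℕ.* suc m ℕ.+ 1))
      ≡⟨ ≡.cong₂ (λ a b → V a * V b * C * (U⁻¹ b * U⁻¹ a)) (≡.trans (ℕ.+-comm _ 1) (≡.cong suc 2[1+m])) 2[1+m] ⟩
    V (3 ℕ.+ 2 ℕ.* m) * V (2 ℕ.+ 2 ℕ.* m) * C * (U⁻¹ (2 ℕ.+ 2 ℕ.* m) * U⁻¹ (3 ℕ.+ 2 ℕ.* m))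
      ≈⟨ solve 5 (λ a b c u v → a :* b :* c :* (u :* v) := c :* (b :* u) :* (a :* v)) refl _ _ _ _ _ ⟩
    overpartitionProduct⁻¹ (3 ℕ.+ 2 ℕ.* m)
      ≡⟨ ≡.cong (overpartitionProduct⁻¹ ∘ suc) 2[1+m] ⟨
    overpartitionProduct⁻¹ (suc (2 ℕ.* suc m)) ∎
    where
    C : Carrier
    C = overpartitionProduct⁻¹ (suc (2 ℕ.* m))
    2[1+m] : 2 ℕ.* suc m ≡ 2 ℕ.+ 2 ℕ.* m
    2[1+m] = ℕ.*-suc 2 m

  -- For n ≥ 1 both exponents in `E` are at least L k, so only the first monomial of n = 0 survives.
  -- The factor of size 2L+1 by which `w L 0` exceeds the product is already 1.
  H-limit : ∀ L i → N ≤ L → 1 ≤ N → 1 ≤ i → H L i ≈ overpartitionProduct⁻¹ (2 ℕ.* L)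
  H-limit L i N≤L 1≤N 1≤i = begin
    H L i
      ≈⟨ Σ-single N 0 1≤N (λ n _ n≢0 → higher n (ℕ.n≢0⇒n>0 n≢0)) ⟩
    θ 0 * w L 0 * E L 0 i (k ∸ i)
      ≈⟨ *-cong (*-cong (trans (*-identityˡ _) (pow-≡ (ℕ.*-zeroʳ h))) (w-at-0 L)) (+-congˡ (-‿cong (pow≈0 N≤e₂))) ⟩
    1# * (overpartitionProduct⁻¹ (2 ℕ.* L) * (V (suc (2 ℕ.* L)) * U⁻¹ (suc (2 ℕ.* L)))) * (1# - 0#)
      ≈⟨ solve 2 (λ c u → con (+ 1) :* (c :* u) :* (con (+ 1) :- con (+ 0)) := c :* u) refl _ _ ⟩
    overpartitionProduct⁻¹ (2 ℕ.* L) * (V (suc (2 ℕ.* L)) * U⁻¹ (suc (2 ℕ.* L)))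
      ≈⟨ *-congˡ (trans (*-congʳ (trans (V≈1 N≤2L+1) (sym (U≈1 N≤2L+1)))) (U-inverse (suc (2 ℕ.* L)) (s≤s z≤n))) ⟩
    overpartitionProduct⁻¹ (2 ℕ.* L) * 1#
      ≈⟨ *-identityʳ _ ⟩
    overpartitionProduct⁻¹ (2 ℕ.* L) ∎
    where
    N≤2L+1 : N ≤ suc (2 ℕ.* L)
    N≤2L+1 = ℕ.≤-trans N≤L (ℕ.≤-trans (ℕ.m≤n*m L 2) (ℕ.n≤1+n _))

    N≤Lk : N ≤ L ℕ.* k
    N≤Lk = ℕ.≤-trans N≤L (ℕ.m≤m*n L k)

    N≤e₂ : N ≤ e₂ L 0 i
    N≤e₂ = ℕ.≤-trans N≤L (ℕ.≤-trans (ℕ.n≤1+n L) (ℕ.≤-trans (ℕ.m≤n*m (suc L) 2) (ℕ.m≤m*n (2 ℕ.* suc L) i ⦃ ℕ.>-nonZero 1≤i ⦄)))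

    higher : ∀ n → 1 ≤ n → θ n * w L n * E L n i (k ∸ i) ≈ 0#
    higher n@(suc n-1) _ = begin
      θ n * w L n * E L n i (k ∸ i)
        ≈⟨ *-congˡ (+-cong (pow≈0 (ℕ.≤-trans N≤Lk (ℕ.≤-trans (ℕ.m≤m+n (L ℕ.* k) (k ∸ i)) (ℕ.m≤n*m (L ℕ.* k ℕ.+ (k ∸ i)) (2 ℕ.* n)))))
             (-‿cong (pow≈0 (ℕ.≤-trans N≤Lk (ℕ.≤-trans (ℕ.m≤n+m (L ℕ.* k) k) (ℕ.≤-trans (ℕ.m≤n*m (suc L ℕ.* k) (2 ℕ.* n)) (ℕ.m≤m+n _ _))))))) ⟩
      θ n * w L n * (0# - 0#)
        ≈⟨ solve 1 (λ a → a :* (con (+ 0) :- con (+ 0)) := con (+ 0)) refl _ ⟩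
      0# ∎

  -- G m i stands for the generating function over the sizes above 2 m,
  -- with the initial condition f̄₂ₘ₊₁ + f₂ₘ₊₂ ≤ i − 1.
  module _ (G : ℕ → ℕ → Carrier) where

    -- `K m (k ∸ d)` collects the two ways to add a size 2m+2 with d non-overlined copies, without
    -- or with an overlined one. Argument 1 means d = k - 1, where an overlined copy would leave the
    -- bound 0 for the rest, and where (3) bars non-overlined parts 2m+1.
    K : ℕ → ℕ → Carrier
    K m 0 = 0#
    K m 1 = V (2 ℕ.* m ℕ.+ 1) * G (suc m) 1
    K m (suc (suc j)) = G (suc m) (suc (suc j)) + q ^ (2 ℕ.* suc m) * G (suc m) (suc j)

    Ĥ : ℕ → ℕ → Carrier
    Ĥ m i = Σ i (λ d → q ^ (2 ℕ.* suc m ℕ.* d) * K m (k ∸ d))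

  module Uniqueness (L : ℕ) (N≤L : N ≤ L) (1≤N : 1 ≤ N) (G : ℕ → ℕ → Carrier)
    (G-limit : ∀ i → 1 ≤ i → i ≤ k → G L i ≈ 1#)
    (G-rec : ∀ m i → m < L → suc i ≤ k →
      V (2 ℕ.* m ℕ.+ 1) * G m (suc i) ≈ Ĥ G m (suc i) + q ^ (2 ℕ.* m ℕ.+ 1) * Ĥ G m i) where

    C : Carrier
    C = overpartitionProduct⁻¹ (2 ℕ.* L)

    -- Both sides are cleared of denominators. The normalisation `C` is the limit of `H`, so that it
    -- matches a `G` tending to 1.
    Solved : ℕ → Set ℓ
    Solved m = ∀ i → suc i ≤ k → V (2 ℕ.* m ℕ.+ 1) * (C * G m (suc i)) ≈ H m (suc i) + q ^ (2 ℕ.* m ℕ.+ 1) * H m i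

    solved-limit : Solved L
    solved-limit i i<k = begin
      V (2 ℕ.* L ℕ.+ 1) * (C * G L (suc i))
        ≈⟨ *-cong (V≈1 N≤2L+1) (*-congˡ (G-limit (suc i) (s≤s z≤n) i<k)) ⟩
      1# * (C * 1#)
        ≈⟨ solve 2 (λ c h → con (+ 1) :* (c :* con (+ 1)) := c :+ con (+ 0) :* h) refl C (H L i) ⟩
      C + 0# * H L i
        ≈⟨ +-cong (H-limit L (suc i) N≤L 1≤N (s≤s z≤n)) (*-congʳ (pow≈0 N≤2L+1)) ⟨
      H L (suc i) + q ^ (2 ℕ.* L ℕ.+ 1) * H L i ∎
      where
      N≤2L+1 : N ≤ 2 ℕ.* L ℕ.+ 1
      N≤2L+1 = ℕ.≤-trans N≤L (ℕ.≤-trans (ℕ.m≤n*m L 2) (ℕ.m≤m+n _ 1))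

    -- With x = q^(2m+2) and y = q^(2m+3), the hypothesis at m+1 turns `V (2m+3) * C * K` into
    -- H(j+1) + (x+y) H(j) + x y H(j-1) for j ≥ 1: the x comes from the definition of `K`, the y
    -- from `Solved`. This is the combination found in `τ-sum-interior`.
    CK-step : ∀ m → Solved (suc m) → ∀ d j → d ℕ.+ suc j ≡ k →
      H m (suc d) ≈ H m d + C * (q ^ (2 ℕ.* suc m ℕ.* d) * K G m (suc j))
    CK-step m ih d j d+1+j≡k = unit-cancel (V-inverse (2 ℕ.* suc m ℕ.+ 1) (pos₂ (2 ℕ.* suc m))) (begin
      v * H m (suc d)
        ≈⟨ Difference.H-step m d j d+1+j≡k ⟩
      v * H m d + Σ N (λ n → θ n * w (suc m) n * Difference.τ m d j d+1+j≡k n)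
        ≈⟨ +-congˡ (tail j d+1+j≡k) ⟩
      v * H m d + v * (C * (X * K G m (suc j)))
        ≈⟨ distribˡ _ _ _ ⟨
      v * (H m d + C * (X * K G m (suc j))) ∎)
      where
      v X : Carrier
      v = V (2 ℕ.* suc m ℕ.+ 1)
      X = q ^ (2 ℕ.* suc m ℕ.* d)

      tail : ∀ j (eq : d ℕ.+ suc j ≡ k) →
        Σ N (λ n → θ n * w (suc m) n * Difference.τ m d j eq n) ≈ v * (C * (X * K G m (suc j)))
      tail zero eq = begin
        _
          ≈⟨ Difference.τ-sum-boundary m d 0 eq ≡.refl ⟩
        X * (g * H (suc m) 1)
          ≈⟨ *-congˡ (*-congˡ (solve 2 (λ a b → a := a :+ b :* con (+ 0)) refl _ _)) ⟩
        X * (g * (H (suc m) 1 + q ^ (2 ℕ.* suc m ℕ.+ 1) * 0#))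
          ≈⟨ *-congˡ (*-congˡ (+-congˡ (*-congˡ (H-zero (suc m))))) ⟨
        X * (g * (H (suc m) 1 + q ^ (2 ℕ.* suc m ℕ.+ 1) * H (suc m) 0))
          ≈⟨ *-congˡ (*-congˡ (ih 0 (s≤s z≤n))) ⟨
        X * (g * (v * (C * G (suc m) 1)))
          ≈⟨ solve 5 (λ x g v c G → x :* (g :* (v :* (c :* G))) := v :* (c :* (x :* (g :* G)))) refl X g v C _ ⟩
        v * (C * (X * (g * G (suc m) 1))) ∎
        where
        g : Carrier
        g = V (2 ℕ.* m ℕ.+ 1)
      tail (suc j) eq = begin
        _
          ≈⟨ Difference.τ-sum-interior m d (suc j) eq j ≡.refl ⟩
        X * (H (suc m) (suc (suc j)) + (x + y) * H (suc m) (suc j) + x * y * H (suc m) j)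
          ≈⟨ *-congˡ (solve 5 (λ a b c x y → a :+ (x :+ y) :* b :+ x :* y :* c := (a :+ y :* b) :+ x :* (b :+ y :* c)) refl _ _ _ x y) ⟩
        X * ((H (suc m) (suc (suc j)) + y * H (suc m) (suc j)) + x * (H (suc m) (suc j) + y * H (suc m) j))
          ≈⟨ *-congˡ (+-cong (ih (suc j) 2+j≤k) (*-congˡ (ih j (ℕ.≤-trans (ℕ.n≤1+n _) 2+j≤k)))) ⟨
        X * (v * (C * G (suc m) (suc (suc j))) + x * (v * (C * G (suc m) (suc j))))
          ≈⟨ solve 6 (λ X v c a x b → X :* (v :* (c :* a) :+ x :* (v :* (c :* b))) := v :* (c :* (X :* (a :+ x :* b)))) refl X v C _ x _ ⟩
        v * (C * (X * (G (suc m) (suc (suc j)) + x * G (suc m) (suc j)))) ∎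
        where
        x y : Carrier
        x = q ^ (2 ℕ.* suc m)
        y = q ^ (2 ℕ.* suc m ℕ.+ 1)
        2+j≤k : suc (suc j) ≤ k
        2+j≤k = ≡.subst (suc (suc j) ≤_) eq (ℕ.m≤n+m (suc (suc j)) d)

    C*Ĥ≈H : ∀ m → Solved (suc m) → ∀ i → i ≤ k → C * Ĥ G m i ≈ H m i
    C*Ĥ≈H m ih zero    _   = trans (zeroʳ C) (sym (H-zero m))
    C*Ĥ≈H m ih (suc d) d<k = begin
      C * (Ĥ G m d + X * K G m (k ∸ d))      ≈⟨ distribˡ _ _ _ ⟩
      C * Ĥ G m d + C * (X * K G m (k ∸ d))  ≈⟨ +-congʳ (C*Ĥ≈H m ih d (ℕ.<⇒≤ d<k)) ⟩
      H m d + C * (X * K G m (k ∸ d))        ≡⟨ ≡.cong (λ t → H m d + C * (X * K G m t)) (ℕ.+-∸-assoc 1 (s≤s⁻¹ d<k)) ⟩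
      H m d + C * (X * K G m (suc (k′ ∸ d))) ≈⟨ CK-step m ih d (k′ ∸ d) (≡.trans (ℕ.+-suc d _) (≡.cong suc (ℕ.m+[n∸m]≡n (s≤s⁻¹ d<k)))) ⟨
      H m (suc d)                            ∎
      where
      X : Carrier
      X = q ^ (2 ℕ.* suc m ℕ.* d)

    solved-step : ∀ m → m < L → Solved (suc m) → Solved m
    solved-step m m<L ih i i<k = begin
      v * (C * G m (suc i))               ≈⟨ solve 3 (λ v c G → v :* (c :* G) := c :* (v :* G)) refl v C _ ⟩
      C * (v * G m (suc i))               ≈⟨ *-congˡ (G-rec m i m<L i<k) ⟩
      C * (Ĥ G m (suc i) + y * Ĥ G m i)   ≈⟨ solve 4 (λ c a y b → c :* (a :+ y :* b) := c :* a :+ y :* (c :* b)) refl C _ y _ ⟩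
      C * Ĥ G m (suc i) + y * (C * Ĥ G m i) ≈⟨ +-cong (C*Ĥ≈H m ih (suc i) i<k) (*-congˡ (C*Ĥ≈H m ih i (ℕ.<⇒≤ i<k))) ⟩
      H m (suc i) + y * H m i             ∎
      where
      v y : Carrier
      v = V (2 ℕ.* m ℕ.+ 1)
      y = q ^ (2 ℕ.* m ℕ.+ 1)

    -- Descending induction on m, because the known value sits at m = L.
    solved : ∀ r m → m ℕ.+ r ≡ L → Solved m
    solved zero    m eq rewrite ≡.trans (≡.sym (ℕ.+-identityʳ m)) eq = solved-limit
    solved (suc r) m eq = solved-step m (≡.subst (suc m ≤_) 1+m+r≡L (ℕ.m≤m+n (suc m) r)) (solved r (suc m) 1+m+r≡L)
      where
      1+m+r≡L : suc m ℕ.+ r ≡ L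
      1+m+r≡L = ≡.trans (≡.sym (ℕ.+-suc m r)) eq

    -- At m = 0 the four monomials of `H 0 (suc i) + q * H 0 i` factor through 1 + q^(2n+1), which
    -- cancels the only denominator of `w 0 n`; the common factor `V 1` cancels against the left
    -- side, and a bare theta series remains.
    solution : ∀ i j → suc i ℕ.+ j ≡ k →
      C * G 0 (suc i) ≈ Σ N (λ n → θ n * (q ^ (2 ℕ.* n ℕ.* j) - q ^ (2 ℕ.* n ℕ.* k ℕ.+ 2 ℕ.* suc n ℕ.* i ℕ.+ 1)))
    solution i j 1+i+j≡k = unit-cancel (V-inverse 1 (s≤s z≤n)) (begin
      V 1 * (C * G 0 (suc i))
        ≈⟨ solved L 0 ≡.refl i (≡.subst (suc i ≤_) 1+i+j≡k (ℕ.m≤m+n (suc i) j)) ⟩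
      H 0 (suc i) + q ^ 1 * H 0 i
        ≈⟨ +-cong (H-cong 0 (suc i) j 1+i+j≡k) (*-congˡ (H-cong 0 i (suc j) (≡.trans (ℕ.+-suc i j) 1+i+j≡k))) ⟩
      Σ N A + q ^ 1 * Σ N B
        ≈⟨ +-congˡ (Σ-distribˡ N (q ^ 1) B) ⟩
      Σ N A + Σ N (λ n → q ^ 1 * B n)
        ≈⟨ Σ-+ N A _ ⟨
      Σ N (λ n → A n + q ^ 1 * B n)
        ≈⟨ Σ-cong N (λ n _ → term n) ⟩
      Σ N (λ n → V 1 * (θ n * (q ^ (2 ℕ.* n ℕ.* j) - q ^ (2 ℕ.* n ℕ.* k ℕ.+ 2 ℕ.* suc n ℕ.* i ℕ.+ 1))))
        ≈⟨ Σ-distribˡ N (V 1) _ ⟨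
      V 1 * _ ∎)
      where
      A B : ℕ → Carrier
      A n = θ n * w 0 n * E 0 n (suc i) j
      B n = θ n * w 0 n * E 0 n i (suc j)
      term : ∀ n → A n + q ^ 1 * B n ≈ V 1 * (θ n * (q ^ (2 ℕ.* n ℕ.* j) - q ^ (2 ℕ.* n ℕ.* k ℕ.+ 2 ℕ.* suc n ℕ.* i ℕ.+ 1)))
      term n = begin
        A n + Q * B n
          ≈⟨ +-cong (*-congˡ (+-congˡ (-‿cong (pow-+ (f ℕ.+ 1) (2 ℕ.* n ℕ.+ 1)
               (solveℕ 3 (λ n k i → nat 2 ⊗ n ⊗ (nat 1 ⊗ k) ⊕ nat 2 ⊗ (n ⊕ nat 1) ⊗ (nat 1 ⊕ i)
                 ⊜ nat 2 ⊗ n ⊗ k ⊕ nat 2 ⊗ (nat 1 ⊕ n) ⊗ i ⊕ nat 1 ⊕ (nat 2 ⊗ n ⊕ nat 1)) ≡.refl n k i)))))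
             (*-congˡ (*-congˡ (+-cong (pow-+ (2 ℕ.* n ℕ.* j) (2 ℕ.* n)
               (solveℕ 2 (λ n j → nat 2 ⊗ n ⊗ (nat 0 ⊕ (nat 1 ⊕ j)) ⊜ nat 2 ⊗ n ⊗ j ⊕ nat 2 ⊗ n) ≡.refl n j))
               (-‿cong (pow-≡ (solveℕ 3 (λ n k i → nat 2 ⊗ n ⊗ (nat 1 ⊗ k) ⊕ nat 2 ⊗ (n ⊕ nat 1) ⊗ i
                 ⊜ nat 2 ⊗ n ⊗ k ⊕ nat 2 ⊗ (nat 1 ⊕ n) ⊗ i) ≡.refl n k i)))))) ⟩
        θ n * (V 1 * ū) * (a - q ^ (f ℕ.+ 1) * q ^ (2 ℕ.* n ℕ.+ 1)) + Q * (θ n * (V 1 * ū) * (a * x - F))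
          ≈⟨ +-congʳ (*-congˡ (+-congˡ (-‿cong (*-cong (^-homo-* q f 1) (^-homo-* q (2 ℕ.* n) 1))))) ⟩
        θ n * (V 1 * ū) * (a - F * Q * (x * Q)) + Q * (θ n * (V 1 * ū) * (a * x - F))
          ≈⟨ solve 7 (λ t v u a F Q x → t :* (v :* u) :* (a :- F :* Q :* (x :* Q)) :+ Q :* (t :* (v :* u) :* (a :* x :- F))
               := ((con (+ 1) :+ x :* Q) :* u) :* (v :* (t :* (a :- F :* Q)))) refl (θ n) (V 1) ū a F Q x ⟩
        ((1# + x * Q) * ū) * (V 1 * (θ n * (a - F * Q)))
          ≈⟨ *-cong (trans (*-congʳ (+-congˡ (sym (^-homo-* q (2 ℕ.* n) 1)))) (U-inverse (2 ℕ.* n ℕ.+ 1) (pos₂ (2 ℕ.* n))))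
               (*-congˡ (*-congˡ (+-congˡ (-‿cong (sym (^-homo-* q f 1)))))) ⟩
        1# * (V 1 * (θ n * (a - q ^ (f ℕ.+ 1))))
          ≈⟨ *-identityˡ _ ⟩
        _ ∎
        where
        f : ℕ
        f = 2 ℕ.* n ℕ.* k ℕ.+ 2 ℕ.* suc n ℕ.* i
        Q a x F ū : Carrier
        Q = q ^ 1
        a = q ^ (2 ℕ.* n ℕ.* j)
        x = q ^ (2 ℕ.* n)
        F = q ^ f
        ū = U⁻¹ (2 ℕ.* n ℕ.+ 1)

-- The Jacobi triple product

module Antidiagonal {c ℓ} (R : CommutativeRing c ℓ) where
  open CommutativeRing R hiding (zero)
  open SetoidReasoning setoid
  open RingLemmas R

  -- The sum runs over j + r = n. Keeping both indices lets Gaussian binomials be treated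
  -- symmetrically and without subtraction.
  Σ₊ : ℕ → (ℕ → ℕ → Carrier) → Carrier
  Σ₊ zero    g = g 0 0
  Σ₊ (suc n) g = g 0 (suc n) + Σ₊ n (λ j r → g (suc j) r)

  Σ₊-cong : ∀ n {f g} → (∀ j r → j ℕ.+ r ≡ n → f j r ≈ g j r) → Σ₊ n f ≈ Σ₊ n g
  Σ₊-cong zero    eq = eq 0 0 ≡.refl
  Σ₊-cong (suc n) eq = +-cong (eq 0 (suc n) ≡.refl) (Σ₊-cong n (λ j r j+r≡n → eq (suc j) r (≡.cong suc j+r≡n)))

  Σ₊-+ : ∀ n f g → Σ₊ n (λ j r → f j r + g j r) ≈ Σ₊ n f + Σ₊ n g
  Σ₊-+ zero    f g = refl
  Σ₊-+ (suc n) f g = trans (+-congˡ (Σ₊-+ n _ _))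
    (solve 4 (λ a b c d → (a :+ b) :+ (c :+ d) := (a :+ c) :+ (b :+ d)) refl _ _ _ _)

  Σ₊-distribˡ : ∀ n a f → a * Σ₊ n f ≈ Σ₊ n (λ j r → a * f j r)
  Σ₊-distribˡ zero    a f = refl
  Σ₊-distribˡ (suc n) a f = trans (distribˡ _ _ _) (+-congˡ (Σ₊-distribˡ n a _))

  Σ₊-last : ∀ n g → Σ₊ (suc n) g ≈ Σ₊ n (λ j r → g j (suc r)) + g (suc n) 0
  Σ₊-last zero    g = refl
  Σ₊-last (suc n) g = trans (+-congˡ (Σ₊-last n (λ j r → g (suc j) r))) (sym (+-assoc _ _ _))

  Σ₊-split : ∀ n m g → Σ₊ (n ℕ.+ m) g ≈ Σ n (λ j → g j (n ℕ.+ m ∸ j)) + Σ₊ m (λ j r → g (n ℕ.+ j) r)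
  Σ₊-split zero    m g = sym (+-identityˡ _)
  Σ₊-split (suc n) m g = begin
    g 0 (suc n ℕ.+ m) + Σ₊ (n ℕ.+ m) (λ j r → g (suc j) r)
      ≈⟨ +-congˡ (Σ₊-split n m _) ⟩
    g 0 (suc n ℕ.+ m) + (Σ n (λ j → g (suc j) (n ℕ.+ m ∸ j)) + Σ₊ m (λ j r → g (suc n ℕ.+ j) r))
      ≈⟨ +-assoc _ _ _ ⟨
    g 0 (suc n ℕ.+ m) + Σ n (λ j → g (suc j) (n ℕ.+ m ∸ j)) + Σ₊ m (λ j r → g (suc n ℕ.+ j) r)
      ≈⟨ +-congʳ (Σ-head n _) ⟨
    Σ (suc n) (λ j → g j (suc n ℕ.+ m ∸ j)) + Σ₊ m (λ j r → g (suc n ℕ.+ j) r) ∎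

  Σ₊-ignore : ∀ n f → Σ₊ n (λ j _ → f j) ≈ Σ (suc n) f
  Σ₊-ignore zero    f = sym (+-identityˡ _)
  Σ₊-ignore (suc n) f = trans (+-congˡ (Σ₊-ignore n (f ∘ suc))) (sym (Σ-head (suc n) f))

  shiftˡ shiftʳ : (ℕ → ℕ → Carrier) → ℕ → ℕ → Carrier
  shiftˡ f zero    r = 0#
  shiftˡ f (suc j) r = f j r
  shiftʳ f j zero    = 0#
  shiftʳ f j (suc r) = f j r

  -- Entries on the rim of Pascal's triangle have one predecessor only; the shifts supply 0 for the
  -- missing one.
  Σ₊-pascal : ∀ n f g h → (∀ j r → j ℕ.+ r ≡ suc n → f j r ≈ shiftˡ g j r + shiftʳ h j r) →
    Σ₊ (suc n) f ≈ Σ₊ n g + Σ₊ n h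
  Σ₊-pascal n f g h eq = begin
    Σ₊ (suc n) f                                      ≈⟨ Σ₊-cong (suc n) eq ⟩
    Σ₊ (suc n) (λ j r → shiftˡ g j r + shiftʳ h j r)  ≈⟨ Σ₊-+ (suc n) (shiftˡ g) (shiftʳ h) ⟩
    Σ₊ (suc n) (shiftˡ g) + Σ₊ (suc n) (shiftʳ h)     ≈⟨ +-cong (+-identityˡ _) (trans (Σ₊-last n (shiftʳ h)) (+-identityʳ _)) ⟩
    Σ₊ n g + Σ₊ n h                                   ∎

module JacobiTripleProduct {c ℓ} (R : CommutativeRing c ℓ) (p : CommutativeRing.Carrier R) (N : ℕ)
  (p^N≈0 : Nilpotent R p N)
  (A B : CommutativeRing.Carrier R) (AB≈p : CommutativeRing._≈_ R (CommutativeRing._*_ R A B) p) where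
  open CommutativeRing R hiding (zero)
  open SetoidReasoning setoid
  open RingLemmas R
  open NilpotentPowers R p N p^N≈0
  open Antidiagonal R

  poch poch⁻¹ : ℕ → Carrier
  poch   n = Π n (V ∘ suc)
  poch⁻¹ n = Π n (V⁻¹ ∘ suc)

  poch-inverse : ∀ n → poch n * poch⁻¹ n ≈ 1#
  poch-inverse n = Π-unit n _ _ (λ i _ → V-inverse (suc i) (s≤s z≤n))

  -- qbinom j r is the Gaussian binomial coefficient of j + r over j.
  qbinom : ℕ → ℕ → Carrier
  qbinom j r = poch (j ℕ.+ r) * (poch⁻¹ j * poch⁻¹ r)

  qbinom-0ˡ : ∀ r → qbinom 0 r ≈ 1#
  qbinom-0ˡ r = trans (*-congˡ (*-identityˡ _)) (poch-inverse r)

  qbinom-0ʳ : ∀ j → qbinom j 0 ≈ 1#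
  qbinom-0ʳ j = trans (*-cong (reflexive (≡.cong poch (ℕ.+-identityʳ j))) (*-identityʳ _)) (poch-inverse j)

  private
    module Suc (j r : ℕ) where
      x y a b s i i′ : Carrier
      x = p ^ suc j
      y = p ^ suc r
      a = V⁻¹ (suc j)
      b = V⁻¹ (suc r)
      s = poch (j ℕ.+ suc r)
      i = poch⁻¹ j
      i′ = poch⁻¹ r

      V-sum : V (suc j ℕ.+ suc r) ≈ 1# - x * y
      V-sum = +-congˡ (-‿cong (^-homo-* p (suc j) (suc r)))

      xa yb : Carrier
      xa = (1# - x) * a
      yb = (1# - y) * b

      xa≈1 : xa ≈ 1#
      xa≈1 = V-inverse (suc j) (s≤s z≤n)

      yb≈1 : yb ≈ 1#
      yb≈1 = V-inverse (suc r) (s≤s z≤n)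

      lower : qbinom (suc j) r ≈ s * (i * a * i′) * yb
      lower = begin
        poch (suc j ℕ.+ r) * (i * a * i′) ≡⟨ ≡.cong (λ t → poch t * (i * a * i′)) (≡.sym (ℕ.+-suc j r)) ⟩
        s * (i * a * i′)                  ≈⟨ *-identityʳ _ ⟨
        s * (i * a * i′) * 1#             ≈⟨ *-congˡ yb≈1 ⟨
        s * (i * a * i′) * yb             ∎

      upper : qbinom j (suc r) ≈ s * (i * (i′ * b)) * xa
      upper = trans (sym (*-identityʳ _)) (*-congˡ (sym xa≈1))

  -- The two q-Pascal rules are the two splittings 1 - xy = y(1 - x) + (1 - y) = (1 - x) + x(1 - y).
  pascal₁ : ∀ j r → qbinom (suc j) (suc r) ≈ p ^ suc r * qbinom j (suc r) + qbinom (suc j) r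
  pascal₁ j r = begin
    s * V (suc j ℕ.+ suc r) * (i * a * (i′ * b))
      ≈⟨ *-congʳ (*-congˡ V-sum) ⟩
    s * (1# - x * y) * (i * a * (i′ * b))
      ≈⟨ solve 7 (λ s x y i a i′ b → s :* (con (+ 1) :- x :* y) :* (i :* a :* (i′ :* b))
           := y :* (s :* (i :* (i′ :* b)) :* ((con (+ 1) :- x) :* a)) :+ s :* (i :* a :* i′) :* ((con (+ 1) :- y) :* b))
           refl s x y i a i′ b ⟩
    y * (s * (i * (i′ * b)) * xa) + s * (i * a * i′) * yb
      ≈⟨ +-cong (*-congˡ upper) lower ⟨
    _ ∎
    where open Suc j r

  pascal₂ : ∀ j r → qbinom (suc j) (suc r) ≈ qbinom j (suc r) + p ^ suc j * qbinom (suc j) r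
  pascal₂ j r = begin
    s * V (suc j ℕ.+ suc r) * (i * a * (i′ * b))
      ≈⟨ *-congʳ (*-congˡ V-sum) ⟩
    s * (1# - x * y) * (i * a * (i′ * b))
      ≈⟨ solve 7 (λ s x y i a i′ b → s :* (con (+ 1) :- x :* y) :* (i :* a :* (i′ :* b))
           := s :* (i :* (i′ :* b)) :* ((con (+ 1) :- x) :* a) :+ x :* (s :* (i :* a :* i′) :* ((con (+ 1) :- y) :* b)))
           refl s x y i a i′ b ⟩
    s * (i * (i′ * b)) * xa + x * (s * (i * a * i′) * yb)
      ≈⟨ +-cong upper (*-congˡ lower) ⟨
    _ ∎
    where open Suc j r

  -- e j l is the theta term of index n = j − l, that is (-1)ⁿ Aⁿ p^(n(n-1)/2),
  -- where A⁻¹ p = B.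
  e : ℕ → ℕ → Carrier
  e zero    zero    = 1#
  e zero    (suc l) = - (B * p ^ l * e zero l)
  e (suc j) zero    = - (A * p ^ j * e j zero)
  e (suc j) (suc l) = e j l

  -- Consecutive theta terms have ratio -A p^(j-l), and j + r = m + l says that m = r + (j - l). For
  -- j < l the power is negative, and AB = p takes its place.
  e-A : ∀ m l j r → j ℕ.+ r ≡ m ℕ.+ l → A * p ^ m * e j l ≈ - (p ^ r * e (suc j) l)
  e-A m zero j r j+r≡m = begin
    A * p ^ m * e j 0               ≈⟨ *-congʳ (*-congˡ (^-congʳ p (≡.trans (≡.sym (ℕ.+-identityʳ m)) (≡.sym j+r≡m)))) ⟩
    A * p ^ (j ℕ.+ r) * e j 0       ≈⟨ *-congʳ (*-congˡ (^-homo-* p j r)) ⟩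
    A * (p ^ j * p ^ r) * e j 0     ≈⟨ solve 4 (λ A x y e → A :* (x :* y) :* e := :- (y :* (:- (A :* x :* e)))) refl A _ _ _ ⟩
    - (p ^ r * - (A * p ^ j * e j 0)) ∎
  e-A m (suc l) zero r r≡m+1+l = begin
    A * p ^ m * - (B * p ^ l * e 0 l)  ≈⟨ solve 5 (λ A x B y e → A :* x :* :- (B :* y :* e) := :- (A :* B :* (x :* y) :* e)) refl A _ B _ _ ⟩
    - (A * B * (p ^ m * p ^ l) * e 0 l) ≈⟨ -‿cong (*-congʳ (*-cong AB≈p (sym (^-homo-* p m l)))) ⟩
    - (p ^ suc (m ℕ.+ l) * e 0 l)       ≈⟨ -‿cong (*-congʳ (^-congʳ p (≡.sym (≡.trans r≡m+1+l (ℕ.+-suc m l))))) ⟩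
    - (p ^ r * e 0 l)                   ∎
  e-A m (suc l) (suc j) r eq = e-A m l j r (ℕ.suc-injective (≡.trans eq (ℕ.+-suc m l)))

  e-B : ∀ j l → B * p ^ l * e j l ≈ - (p ^ j * e j (suc l))
  e-B zero l = solve 1 (λ x → x := :- (con (+ 1) :* (:- x))) refl _
  e-B (suc j) zero = begin
    B * 1# * - (A * p ^ j * e j 0) ≈⟨ solve 4 (λ A B x e → B :* con (+ 1) :* :- (A :* x :* e) := :- (A :* B :* x :* e)) refl A B _ _ ⟩
    - (A * B * p ^ j * e j 0)      ≈⟨ -‿cong (*-congʳ (*-congʳ AB≈p)) ⟩
    - (p ^ suc j * e j 0)          ∎
  e-B (suc j) (suc l) = begin
    B * (p * p ^ l) * e j l        ≈⟨ solve 4 (λ B p x e → B :* (p :* x) :* e := p :* (B :* x :* e)) refl B p _ _ ⟩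
    p * (B * p ^ l * e j l)        ≈⟨ *-congˡ (e-B j l) ⟩
    p * - (p ^ j * e j (suc l))    ≈⟨ solve 3 (λ p x e → p :* :- (x :* e) := :- (p :* x :* e)) refl p _ _ ⟩
    - (p ^ suc j * e j (suc l))    ∎

  -- The finite form of Jacobi's identity, a symmetric version of the q-binomial theorem. Induction
  -- adds one factor at a time: `pascal₁` with `e-A` for a factor with A, `pascal₂` with `e-B` for
  -- one with B.
  finite-triple-product : ∀ m l →
    Σ₊ (m ℕ.+ l) (λ j r → e j l * qbinom j r) ≈ Π m (λ j → 1# - A * p ^ j) * Π l (λ j → 1# - B * p ^ j)
  finite-triple-product zero zero = trans (*-identityˡ _) (trans (qbinom-0ˡ 0) (sym (*-identityˡ 1#)))
  finite-triple-product zero (suc l) = begin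
    Σ₊ (suc l) (λ j r → e j (suc l) * qbinom j r)
      ≈⟨ Σ₊-pascal l _ (λ j r → e j l * qbinom j r) (λ j r → - (B * p ^ l) * (e j l * qbinom j r)) split ⟩
    Σ₊ l (λ j r → e j l * qbinom j r) + Σ₊ l (λ j r → - (B * p ^ l) * (e j l * qbinom j r))
      ≈⟨ +-congˡ (Σ₊-distribˡ l _ _) ⟨
    S + - (B * p ^ l) * S
      ≈⟨ solve 2 (λ S b → S :+ (:- b) :* S := S :* (con (+ 1) :- b)) refl S _ ⟩
    S * (1# - B * p ^ l)
      ≈⟨ *-congʳ (finite-triple-product zero l) ⟩
    1# * Π l (λ j → 1# - B * p ^ j) * (1# - B * p ^ l)
      ≈⟨ *-assoc _ _ _ ⟩
    _ ∎
    where
    S : Carrier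
    S = Σ₊ l (λ j r → e j l * qbinom j r)
    flip : ∀ j t → e j (suc l) * (p ^ j * t) ≈ - (B * p ^ l) * (e j l * t)
    flip j t = begin
      e j (suc l) * (p ^ j * t)       ≈⟨ solve 3 (λ e x t → e :* (x :* t) := :- (:- (x :* e)) :* t) refl _ _ t ⟩
      - - (p ^ j * e j (suc l)) * t   ≈⟨ *-congʳ (-‿cong (e-B j l)) ⟨
      - (B * p ^ l * e j l) * t       ≈⟨ solve 3 (λ b e t → :- (b :* e) :* t := (:- b) :* (e :* t)) refl _ _ t ⟩
      - (B * p ^ l) * (e j l * t)     ∎
    split : ∀ j r → j ℕ.+ r ≡ suc l → e j (suc l) * qbinom j r
      ≈ shiftˡ (λ j r → e j l * qbinom j r) j r + shiftʳ (λ j r → - (B * p ^ l) * (e j l * qbinom j r)) j r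
    split zero (suc r) _ = begin
      e 0 (suc l) * qbinom 0 (suc r)       ≈⟨ *-congˡ (trans (qbinom-0ˡ (suc r)) (trans (sym (qbinom-0ˡ r)) (sym (*-identityˡ _)))) ⟩
      e 0 (suc l) * (1# * qbinom 0 r)      ≈⟨ flip 0 _ ⟩
      - (B * p ^ l) * (e 0 l * qbinom 0 r) ≈⟨ +-identityˡ _ ⟨
      _                                    ∎
    split (suc j) zero _ = trans (*-congˡ (trans (qbinom-0ʳ (suc j)) (sym (qbinom-0ʳ j)))) (sym (+-identityʳ _))
    split (suc j) (suc r) _ = begin
      e j l * qbinom (suc j) (suc r)       ≈⟨ *-congˡ (pascal₂ j r) ⟩
      e j l * (qbinom j (suc r) + p ^ suc j * qbinom (suc j) r)  ≈⟨ distribˡ _ _ _ ⟩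
      e j l * qbinom j (suc r) + e (suc j) (suc l) * (p ^ suc j * qbinom (suc j) r) ≈⟨ +-congˡ (flip (suc j) _) ⟩
      _ ∎
  finite-triple-product (suc m) l = begin
    Σ₊ (suc (m ℕ.+ l)) (λ j r → e j l * qbinom j r)
      ≈⟨ Σ₊-pascal (m ℕ.+ l) _ (λ j r → - (A * p ^ m) * (e j l * qbinom j r)) (λ j r → e j l * qbinom j r) split ⟩
    Σ₊ (m ℕ.+ l) (λ j r → - (A * p ^ m) * (e j l * qbinom j r)) + S
      ≈⟨ +-congʳ (Σ₊-distribˡ (m ℕ.+ l) _ _) ⟨
    - (A * p ^ m) * S + S
      ≈⟨ solve 2 (λ S a → (:- a) :* S :+ S := S :* (con (+ 1) :- a)) refl S _ ⟩
    S * (1# - A * p ^ m)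
      ≈⟨ *-congʳ (finite-triple-product m l) ⟩
    Π m (λ j → 1# - A * p ^ j) * Π l (λ j → 1# - B * p ^ j) * (1# - A * p ^ m)
      ≈⟨ solve 3 (λ a b c → a :* b :* c := a :* c :* b) refl _ _ _ ⟩
    _ ∎
    where
    S : Carrier
    S = Σ₊ (m ℕ.+ l) (λ j r → e j l * qbinom j r)
    flip : ∀ j r t → j ℕ.+ r ≡ m ℕ.+ l → e (suc j) l * (p ^ r * t) ≈ - (A * p ^ m) * (e j l * t)
    flip j r t eq = begin
      e (suc j) l * (p ^ r * t)       ≈⟨ solve 3 (λ e x t → e :* (x :* t) := :- (:- (x :* e)) :* t) refl _ _ t ⟩
      - - (p ^ r * e (suc j) l) * t   ≈⟨ *-congʳ (-‿cong (e-A m l j r eq)) ⟨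
      - (A * p ^ m * e j l) * t       ≈⟨ solve 3 (λ a e t → :- (a :* e) :* t := (:- a) :* (e :* t)) refl _ _ t ⟩
      - (A * p ^ m) * (e j l * t)     ∎
    split : ∀ j r → j ℕ.+ r ≡ suc (m ℕ.+ l) → e j l * qbinom j r
      ≈ shiftˡ (λ j r → - (A * p ^ m) * (e j l * qbinom j r)) j r + shiftʳ (λ j r → e j l * qbinom j r) j r
    split zero (suc r) _ = trans (*-congˡ (trans (qbinom-0ˡ (suc r)) (sym (qbinom-0ˡ r)))) (sym (+-identityˡ _))
    split (suc j) zero eq = begin
      e (suc j) l * qbinom (suc j) 0       ≈⟨ *-congˡ (trans (qbinom-0ʳ (suc j)) (trans (sym (qbinom-0ʳ j)) (sym (*-identityˡ _)))) ⟩
      e (suc j) l * (1# * qbinom j 0)      ≈⟨ flip j 0 _ (ℕ.suc-injective eq) ⟩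
      - (A * p ^ m) * (e j l * qbinom j 0) ≈⟨ +-identityʳ _ ⟨
      _                                    ∎
    split (suc j) (suc r) eq = begin
      e (suc j) l * qbinom (suc j) (suc r)  ≈⟨ *-congˡ (pascal₁ j r) ⟩
      e (suc j) l * (p ^ suc r * qbinom j (suc r) + qbinom (suc j) r)  ≈⟨ distribˡ _ _ _ ⟩
      e (suc j) l * (p ^ suc r * qbinom j (suc r)) + e (suc j) l * qbinom (suc j) r
        ≈⟨ +-congʳ (flip j (suc r) _ (ℕ.suc-injective eq)) ⟩
      _ ∎

  e-vanishˡ : ∀ j l → N ℕ.+ suc j ≤ l → e j l ≈ 0#
  e-vanishˡ zero    zero    N+1≤0   rewrite ℕ.+-comm N 1 with () ← N+1≤0
  e-vanishˡ zero    (suc l) N+1≤1+l = begin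
    - (B * p ^ l * e 0 l) ≈⟨ -‿cong (*-congʳ (*-congˡ (pow≈0 (s≤s⁻¹ (≡.subst (_≤ suc l) (ℕ.+-comm N 1) N+1≤1+l))))) ⟩
    - (B * 0# * e 0 l)    ≈⟨ solve 2 (λ b e → :- (b :* con (+ 0) :* e) := con (+ 0)) refl B _ ⟩
    0#                    ∎
  e-vanishˡ (suc j) zero    N+1≤0   rewrite ℕ.+-suc N (suc j) with () ← N+1≤0
  e-vanishˡ (suc j) (suc l) le      = e-vanishˡ j l (s≤s⁻¹ (≡.subst (_≤ suc l) (ℕ.+-suc N (suc j)) le))

  e-vanishʳ : ∀ j l → N ℕ.+ suc l ≤ j → e j l ≈ 0#
  e-vanishʳ zero    l       N+1≤0   rewrite ℕ.+-suc N l with () ← N+1≤0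
  e-vanishʳ (suc j) zero    N+1≤1+j = begin
    - (A * p ^ j * e j 0) ≈⟨ -‿cong (*-congʳ (*-congˡ (pow≈0 (s≤s⁻¹ (≡.subst (_≤ suc j) (ℕ.+-comm N 1) N+1≤1+j))))) ⟩
    - (A * 0# * e j 0)    ≈⟨ solve 2 (λ b e → :- (b :* con (+ 0) :* e) := con (+ 0)) refl A _ ⟩
    0#                    ∎
  e-vanishʳ (suc j) (suc l) le      = e-vanishʳ j l (s≤s⁻¹ (≡.subst (_≤ suc j) (ℕ.+-suc N (suc l)) le))

  poch-limit : ∀ {n} → N ≤ n → poch n ≈ poch N
  poch-limit {n} N≤n = begin
    poch n                                       ≡⟨ ≡.cong poch (ℕ.m+[n∸m]≡n N≤n) ⟨
    poch (N ℕ.+ (n ∸ N))                         ≈⟨ Π-split N (n ∸ N) _ ⟩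
    poch N * Π (n ∸ N) (λ i → V (suc (N ℕ.+ i))) ≈⟨ *-congˡ (Π-1 (n ∸ N) (λ i _ → V≈1 (ℕ.≤-trans (ℕ.m≤m+n N i) (ℕ.n≤1+n _)))) ⟩
    poch N * 1#                                  ≈⟨ *-identityʳ _ ⟩
    poch N                                       ∎

  qbinom-limit : ∀ {j r T} → N ≤ j → N ≤ r → N ≤ T → qbinom j r * poch T ≈ 1#
  qbinom-limit {j} {r} {T} N≤j N≤r N≤T = begin
    poch (j ℕ.+ r) * (poch⁻¹ j * poch⁻¹ r) * poch T
      ≈⟨ *-cong (*-congʳ (trans (poch-limit (ℕ.≤-trans N≤j (ℕ.m≤m+n j r))) (sym (poch-limit N≤j))))
                (trans (poch-limit N≤T) (sym (poch-limit N≤r))) ⟩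
    poch j * (poch⁻¹ j * poch⁻¹ r) * poch r
      ≈⟨ solve 4 (λ a b c d → a :* (b :* c) :* d := (a :* b) :* (d :* c)) refl _ _ _ _ ⟩
    (poch j * poch⁻¹ j) * (poch r * poch⁻¹ r)
      ≈⟨ *-cong (poch-inverse j) (poch-inverse r) ⟩
    1# * 1#
      ≈⟨ *-identityˡ 1# ⟩
    1# ∎

  e-negative-sum : ∀ T → Σ T (λ j → e j T) ≈ Σ T (λ l → e 0 (suc l))
  e-negative-sum zero    = refl
  e-negative-sum (suc T) = begin
    Σ (suc T) (λ j → e j (suc T))       ≈⟨ Σ-head T _ ⟩
    e 0 (suc T) + Σ T (λ j → e j T)     ≈⟨ +-comm _ _ ⟩
    Σ T (λ j → e j T) + e 0 (suc T)     ≈⟨ +-congʳ (e-negative-sum T) ⟩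
    Σ (suc T) (λ l → e 0 (suc l))       ∎

  e-diagonal : ∀ T i → e (T ℕ.+ i) T ≡ e i 0
  e-diagonal zero    i = ≡.refl
  e-diagonal (suc T) i = e-diagonal T i

  -- With T ≥ 2N each summand is in one of two regimes. Either both arguments of the Gaussian
  -- binomial are at least N, and it is the inverse of `poch T`; or one is below N, so the theta
  -- index j - T exceeds N in absolute value and the theta term is 0.
  triple-product : ∀ T → N ℕ.+ N ≤ T → 1 ≤ T →
    Π T (λ j → (1# - A * p ^ j) * (1# - B * p ^ j) * V (suc j)) ≈ Σ T (λ n → e n 0 + e 0 (suc n))
  triple-product T 2N≤T 1≤T = begin
    Π T (λ j → (1# - A * p ^ j) * (1# - B * p ^ j) * V (suc j))
      ≈⟨ trans (Π-* T _ _) (*-congʳ (Π-* T _ _)) ⟩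
    Π T (λ j → 1# - A * p ^ j) * Π T (λ j → 1# - B * p ^ j) * poch T
      ≈⟨ *-congʳ (finite-triple-product T T) ⟨
    Σ₊ (T ℕ.+ T) (λ j r → e j T * qbinom j r) * poch T
      ≈⟨ trans (*-comm _ _) (Σ₊-distribˡ (T ℕ.+ T) _ _) ⟩
    Σ₊ (T ℕ.+ T) (λ j r → poch T * (e j T * qbinom j r))
      ≈⟨ Σ₊-cong (T ℕ.+ T) limit ⟩
    Σ₊ (T ℕ.+ T) (λ j _ → e j T)
      -- The cut at j = T is the theta index 0.
      ≈⟨ Σ₊-split T T _ ⟩
    Σ T (λ j → e j T) + Σ₊ T (λ j _ → e (T ℕ.+ j) T)
      ≈⟨ +-cong (e-negative-sum T) (trans (Σ₊-cong T (λ j _ _ → reflexive (e-diagonal T j))) (Σ₊-ignore T (λ j → e j 0))) ⟩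
    Σ T (λ l → e 0 (suc l)) + (Σ T (λ n → e n 0) + e T 0)
      ≈⟨ +-congˡ (+-congˡ (e-vanishʳ T 0 N+1≤T)) ⟩
    Σ T (λ l → e 0 (suc l)) + (Σ T (λ n → e n 0) + 0#)
      ≈⟨ solve 2 (λ a b → a :+ (b :+ con (+ 0)) := b :+ a) refl _ _ ⟩
    Σ T (λ n → e n 0) + Σ T (λ l → e 0 (suc l))
      ≈⟨ Σ-+ T _ _ ⟨
    Σ T (λ n → e n 0 + e 0 (suc n)) ∎
    where
    N+1≤T : N ℕ.+ 1 ≤ T
    N+1≤T with N ℕ.≟ 0
    ... | yes ≡.refl = 1≤T
    ... | no  N≢0    = ℕ.≤-trans (ℕ.+-monoʳ-≤ N (ℕ.n≢0⇒n>0 N≢0)) 2N≤T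

    small : ∀ {a b} → a < N → a ℕ.+ b ≡ T ℕ.+ T → N ℕ.+ suc T ≤ b
    small {a} {b} a<N a+b≡2T = ℕ.+-cancelˡ-≤ a _ _
      (≡.subst₂ _≤_ (+-*-Solver.solve 3 (λ a n t → (nat 1 ⊕ a) ⊕ n ⊕ t ⊜ a ⊕ (n ⊕ (nat 1 ⊕ t))) ≡.refl a N T) (≡.sym a+b≡2T)
        (ℕ.+-monoˡ-≤ T (ℕ.≤-trans (ℕ.+-monoˡ-≤ N a<N) 2N≤T)))
      where open +-*-Solver using () renaming (_:+_ to _⊕_; _:=_ to _⊜_; con to nat)

    vanish : ∀ {x y z} → y ≈ 0# → x * (y * z) ≈ y
    vanish y≈0 = trans (trans (*-congˡ (*-congʳ y≈0)) (solve 2 (λ a b → a :* (con (+ 0) :* b) := con (+ 0)) refl _ _)) (sym y≈0)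

    limit : ∀ j r → j ℕ.+ r ≡ T ℕ.+ T → poch T * (e j T * qbinom j r) ≈ e j T
    limit j r j+r≡2T with N ℕ.≤? j | N ℕ.≤? r
    ... | yes N≤j | yes N≤r = begin
      poch T * (e j T * qbinom j r) ≈⟨ solve 3 (λ a b c → a :* (b :* c) := b :* (c :* a)) refl _ _ _ ⟩
      e j T * (qbinom j r * poch T) ≈⟨ *-congˡ (qbinom-limit N≤j N≤r (ℕ.≤-trans (ℕ.m≤m+n N N) 2N≤T)) ⟩
      e j T * 1#                    ≈⟨ *-identityʳ _ ⟩
      e j T                         ∎
    ... | no N≰j | _     = vanish (e-vanishˡ j T (ℕ.≤-trans (ℕ.+-monoʳ-≤ N (ℕ.≰⇒> N≰j)) 2N≤T))
    ... | yes _ | no N≰r = vanish (e-vanishʳ j T (small (ℕ.≰⇒> N≰r) (≡.trans (ℕ.+-comm r j) j+r≡2T)))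

-- The theta series of the solution as products.

module ThetaProducts {c ℓ} (R : CommutativeRing c ℓ) (q : CommutativeRing.Carrier R) (N : ℕ)
  (q^N≈0 : Nilpotent R q N)
  (k′ : ℕ) where
  open CommutativeRing R hiding (zero)
  open SetoidReasoning setoid
  open RingLemmas R
  open NilpotentPowers R q N q^N≈0
  open ExplicitSolution R q N q^N≈0 k′ using (θ; θ-suc; θ≈0; k; h)
  open +-*-Solver using () renaming (solve to solveℕ; _:+_ to _⊕_; _:*_ to _⊗_; _:=_ to _⊜_; con to nat)

  pow-nilpotent : ∀ a → 1 ≤ a → (q ^ a) ^ N ≈ 0#
  pow-nilpotent a@(suc _) _ = trans (^-assocʳ q a N) (pow≈0 (ℕ.m≤n*m N a))

  -- Together with the exponent h n² of `θ n`, and for j = k - i - 1, this makes h(n+1)² - 2j(n+1).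
  -- So `thetaSum` pairs the indices n and -n-1 of one bilateral series.
  ψ : ℕ → ℕ → ℕ
  ψ i n = 2 ℕ.* n ℕ.* k ℕ.+ 2 ℕ.* suc n ℕ.* i ℕ.+ 1

  thetaSum : ℕ → ℕ → Carrier
  thetaSum i j = Σ N (λ n → θ n * (q ^ (2 ℕ.* n ℕ.* j) - q ^ ψ i n))

  module _ (i j : ℕ) (1+i+j≡k : suc i ℕ.+ j ≡ k) where

    -- The exponents h + 2j and 2i + 1 are those of the theta terms of index 1 and -1. Their sum is
    -- the second difference of the quadratic exponent, which dictates the base q^(2h).
    A+B≡2h : h ℕ.+ 2 ℕ.* j ℕ.+ (2 ℕ.* i ℕ.+ 1) ≡ 2 ℕ.* h
    A+B≡2h = lemma k′ (ℕ.suc-injective 1+i+j≡k)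
      where
      lemma : ∀ κ → i ℕ.+ j ≡ κ → suc (2 ℕ.* κ) ℕ.+ 2 ℕ.* j ℕ.+ (2 ℕ.* i ℕ.+ 1) ≡ 2 ℕ.* suc (2 ℕ.* κ)
      lemma _ ≡.refl = solveℕ 2 (λ i j → (nat 1 ⊕ nat 2 ⊗ (i ⊕ j)) ⊕ nat 2 ⊗ j ⊕ (nat 2 ⊗ i ⊕ nat 1) ⊜ nat 2 ⊗ (nat 1 ⊕ nat 2 ⊗ (i ⊕ j))) ≡.refl i j

    open JacobiTripleProduct R (q ^ (2 ℕ.* h)) N (pow-nilpotent (2 ℕ.* h) (s≤s z≤n))
      (q ^ (h ℕ.+ 2 ℕ.* j)) (q ^ (2 ℕ.* i ℕ.+ 1)) (sym (pow-+ (h ℕ.+ 2 ℕ.* j) (2 ℕ.* i ℕ.+ 1) (≡.sym A+B≡2h)))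
      using (e; triple-product)

    e-positive : ∀ n → e n 0 ≈ θ n * q ^ (2 ℕ.* n ℕ.* j)
    e-positive zero = sym (trans (*-identityʳ _) (trans (*-identityˡ _) (pow-≡ (ℕ.*-zeroʳ h))))
    e-positive (suc n) = begin
      - (a * (q ^ (2 ℕ.* h)) ^ n * e n 0)
        ≈⟨ -‿cong (*-cong (*-congˡ (^-assocʳ q (2 ℕ.* h) n)) (e-positive n)) ⟩
      - (a * q ^ (2 ℕ.* h ℕ.* n) * (θ n * q ^ (2 ℕ.* n ℕ.* j)))
        ≈⟨ solve 4 (λ a x t y → :- (a :* x :* (t :* y)) := :- (t :* (a :* x :* y))) refl _ _ _ _ ⟩
      - (θ n * (a * q ^ (2 ℕ.* h ℕ.* n) * q ^ (2 ℕ.* n ℕ.* j)))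
        ≈⟨ -‿cong (*-congˡ (trans (*-congʳ (sym (^-homo-* q (h ℕ.+ 2 ℕ.* j) (2 ℕ.* h ℕ.* n)))) (sym (^-homo-* q (h ℕ.+ 2 ℕ.* j ℕ.+ 2 ℕ.* h ℕ.* n) (2 ℕ.* n ℕ.* j))))) ⟩
      - (θ n * q ^ (h ℕ.+ 2 ℕ.* j ℕ.+ 2 ℕ.* h ℕ.* n ℕ.+ 2 ℕ.* n ℕ.* j))
        ≈⟨ -‿cong (*-congˡ (pow-+ (h ℕ.* (2 ℕ.* n ℕ.+ 1)) (2 ℕ.* suc n ℕ.* j)
             (solveℕ 3 (λ h j n → h ⊕ nat 2 ⊗ j ⊕ nat 2 ⊗ h ⊗ n ⊕ nat 2 ⊗ n ⊗ j ⊜ h ⊗ (nat 2 ⊗ n ⊕ nat 1) ⊕ nat 2 ⊗ (nat 1 ⊕ n) ⊗ j) ≡.refl h j n))) ⟩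
      - (θ n * (q ^ (h ℕ.* (2 ℕ.* n ℕ.+ 1)) * q ^ (2 ℕ.* suc n ℕ.* j)))
        ≈⟨ solve 3 (λ t x y → :- (t :* (x :* y)) := :- (t :* x) :* y) refl _ _ _ ⟩
      - (θ n * q ^ (h ℕ.* (2 ℕ.* n ℕ.+ 1))) * q ^ (2 ℕ.* suc n ℕ.* j)
        ≈⟨ *-congʳ (θ-suc n) ⟨
      θ (suc n) * q ^ (2 ℕ.* suc n ℕ.* j) ∎
      where
      a : Carrier
      a = q ^ (h ℕ.+ 2 ℕ.* j)

    e-negative : ∀ n → e 0 (suc n) ≈ - (θ n * q ^ ψ i n)
    e-negative zero = -‿cong (begin
      q ^ (2 ℕ.* i ℕ.+ 1) * 1# * 1#    ≈⟨ trans (*-identityʳ _) (*-identityʳ _) ⟩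
      q ^ (2 ℕ.* i ℕ.+ 1)              ≈⟨ *-identityˡ _ ⟨
      1# * q ^ (2 ℕ.* i ℕ.+ 1)         ≈⟨ *-congʳ (trans (*-identityˡ _) (pow-≡ (ℕ.*-zeroʳ h))) ⟨
      θ 0 * q ^ (2 ℕ.* i ℕ.+ 1)        ∎)
    e-negative (suc n) = -‿cong (begin
      b * (q ^ (2 ℕ.* h)) ^ suc n * e 0 (suc n)
        ≈⟨ *-cong (*-congˡ (^-assocʳ q (2 ℕ.* h) (suc n))) (e-negative n) ⟩
      b * q ^ (2 ℕ.* h ℕ.* suc n) * - (θ n * q ^ ψ i n)
        ≈⟨ solve 4 (λ b x t y → b :* x :* :- (t :* y) := :- (t :* (b :* x :* y))) refl _ _ _ _ ⟩
      - (θ n * (b * q ^ (2 ℕ.* h ℕ.* suc n) * q ^ ψ i n))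
        ≈⟨ -‿cong (*-congˡ (trans (*-congʳ (sym (^-homo-* q (2 ℕ.* i ℕ.+ 1) (2 ℕ.* h ℕ.* suc n)))) (sym (^-homo-* q (2 ℕ.* i ℕ.+ 1 ℕ.+ 2 ℕ.* h ℕ.* suc n) (ψ i n))))) ⟩
      - (θ n * q ^ (2 ℕ.* i ℕ.+ 1 ℕ.+ 2 ℕ.* h ℕ.* suc n ℕ.+ ψ i n))
        ≈⟨ -‿cong (*-congˡ (pow-+ (h ℕ.* (2 ℕ.* n ℕ.+ 1)) (ψ i (suc n))
             (solveℕ 3 (λ i κ n → nat 2 ⊗ i ⊕ nat 1 ⊕ nat 2 ⊗ (nat 1 ⊕ nat 2 ⊗ κ) ⊗ (nat 1 ⊕ n)
                   ⊕ (nat 2 ⊗ n ⊗ (nat 1 ⊕ κ) ⊕ nat 2 ⊗ (nat 1 ⊕ n) ⊗ i ⊕ nat 1)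
               ⊜ (nat 1 ⊕ nat 2 ⊗ κ) ⊗ (nat 2 ⊗ n ⊕ nat 1)
                   ⊕ (nat 2 ⊗ (nat 1 ⊕ n) ⊗ (nat 1 ⊕ κ) ⊕ nat 2 ⊗ (nat 2 ⊕ n) ⊗ i ⊕ nat 1)) ≡.refl i k′ n))) ⟩
      - (θ n * (q ^ (h ℕ.* (2 ℕ.* n ℕ.+ 1)) * q ^ ψ i (suc n)))
        ≈⟨ solve 3 (λ t x y → :- (t :* (x :* y)) := :- (t :* x) :* y) refl _ _ _ ⟩
      - (θ n * q ^ (h ℕ.* (2 ℕ.* n ℕ.+ 1))) * q ^ ψ i (suc n)
        ≈⟨ *-congʳ (θ-suc n) ⟨
      θ (suc n) * q ^ ψ i (suc n) ∎)
      where
      b : Carrier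
      b = q ^ (2 ℕ.* i ℕ.+ 1)

    thetaSum-product : ∀ T → N ℕ.+ N ≤ T → 1 ≤ T →
      Π T (λ t → V (t ℕ.* (2 ℕ.* h) ℕ.+ (h ℕ.+ 2 ℕ.* j)) * V (t ℕ.* (2 ℕ.* h) ℕ.+ (2 ℕ.* i ℕ.+ 1)) * V (t ℕ.* (2 ℕ.* h) ℕ.+ 2 ℕ.* h))
      ≈ thetaSum i j
    thetaSum-product T 2N≤T 1≤T = begin
      _
        ≈⟨ Π-cong T (λ t _ → *-cong (*-cong (factor t (h ℕ.+ 2 ℕ.* j)) (factor t (2 ℕ.* i ℕ.+ 1)))
             (+-congˡ (-‿cong (trans (pow-≡ (≡.trans (ℕ.+-comm (t ℕ.* (2 ℕ.* h)) (2 ℕ.* h)) (ℕ.*-comm (suc t) (2 ℕ.* h)))) (sym (^-assocʳ q (2 ℕ.* h) (suc t))))))) ⟩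
      _
        ≈⟨ triple-product T 2N≤T 1≤T ⟩
      Σ T (λ n → e n 0 + e 0 (suc n))
        ≈⟨ Σ-cong T (λ n _ → trans (+-cong (e-positive n) (e-negative n))
             (solve 3 (λ t x y → t :* x :+ :- (t :* y) := t :* (x :- y)) refl (θ n) _ _)) ⟩
      Σ T f
        ≡⟨ ≡.cong (λ t → Σ t f) (ℕ.m+[n∸m]≡n N≤T) ⟨
      Σ (N ℕ.+ (T ∸ N)) f
        ≈⟨ Σ-split N (T ∸ N) f ⟩
      Σ N f + Σ (T ∸ N) (λ n → f (N ℕ.+ n))
        ≈⟨ +-congˡ (Σ-0 (T ∸ N) (λ n _ → trans (*-congʳ (θ≈0 (ℕ.m≤m+n N n))) (zeroˡ _))) ⟩
      Σ N f + 0#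
        ≈⟨ +-identityʳ _ ⟩
      Σ N f ∎
      where
      f : ℕ → Carrier
      f n = θ n * (q ^ (2 ℕ.* n ℕ.* j) - q ^ ψ i n)
      N≤T : N ≤ T
      N≤T = ℕ.≤-trans (ℕ.m≤m+n N N) 2N≤T
      factor : ∀ t a → V (t ℕ.* (2 ℕ.* h) ℕ.+ a) ≈ 1# - q ^ a * (q ^ (2 ℕ.* h)) ^ t
      factor t a = +-congˡ (-‿cong (trans (^-homo-* q (t ℕ.* (2 ℕ.* h)) a)
        (trans (*-comm _ _) (*-congˡ (trans (pow-≡ (ℕ.*-comm t (2 ℕ.* h))) (sym (^-assocʳ q (2 ℕ.* h) t)))))))

-- The case k = 1 of the recursion, where the constant 1 is a solution.
gauss : ∀ {c ℓ} (R : CommutativeRing c ℓ) (q : CommutativeRing.Carrier R) (N : ℕ)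
  (q^N≈0 : Nilpotent R q N) →
  ∀ L → N ≤ L → 1 ≤ N →
  CommutativeRing._≈_ R (ExplicitSolution.overpartitionProduct⁻¹ R q N q^N≈0 0 (2 ℕ.* L)) (ThetaProducts.thetaSum R q N q^N≈0 0 0 0)
gauss R q N q^N≈0 L N≤L 1≤N = trans (sym (*-identityʳ _)) (Uniqueness.solution L N≤L 1≤N (λ _ _ → 1#) (λ _ _ _ → refl) rec 0 0 ≡.refl)
  where
  open CommutativeRing R hiding (zero)
  open RingLemmas R
  open NilpotentPowers R q N q^N≈0
  open ExplicitSolution R q N q^N≈0 0
  open SetoidReasoning setoid
  -- For k = 1 conditions (2) and (3) leave only the empty overpartition, which is why 1 solves the
  -- recursion.
  rec : ∀ m i → m < L → suc i ≤ 1 →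
    V (2 ℕ.* m ℕ.+ 1) * 1# ≈ Ĥ (λ _ _ → 1#) m (suc i) + q ^ (2 ℕ.* m ℕ.+ 1) * Ĥ (λ _ _ → 1#) m i
  rec m zero _ _ = sym (begin
    0# + q ^ (2 ℕ.* suc m ℕ.* 0) * (v * 1#) + y * 0# ≈⟨ +-congʳ (+-congˡ (*-congʳ (pow-≡ (ℕ.*-zeroʳ (2 ℕ.* suc m))))) ⟩
    0# + 1# * (v * 1#) + y * 0#                       ≈⟨ solve 2 (λ v y → con (+ 0) :+ con (+ 1) :* (v :* con (+ 1)) :+ y :* con (+ 0) := v :* con (+ 1)) refl v y ⟩
    v * 1#                                            ∎)
    where
    v y : Carrier
    v = V (2 ℕ.* m ℕ.+ 1)
    y = q ^ (2 ℕ.* m ℕ.+ 1)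
  rec m (suc i) _ (s≤s ())

module GaussRescaled {c ℓ} (R : CommutativeRing c ℓ) (q : CommutativeRing.Carrier R) (N : ℕ)
  (q^N≈0 : Nilpotent R q N)
  (k′ : ℕ) where
  open CommutativeRing R hiding (zero)
  open RingLemmas R
  open NilpotentPowers R q N q^N≈0
  open ExplicitSolution R q N q^N≈0 k′ using (h)
  open ThetaProducts R q N q^N≈0 k′ using (thetaSum; pow-nilpotent; ψ)
  open SetoidReasoning setoid
  open +-*-Solver using () renaming (solve to solveℕ; _:+_ to _⊕_; _:*_ to _⊗_; _:=_ to _⊜_; con to nat)

  q^h-nilpotent : (q ^ h) ^ N ≈ 0#
  q^h-nilpotent = pow-nilpotent h (s≤s z≤n)

  -- For j = 0 the two exponents of the n-th pair become h n² and h(n+1)², so the series is Gauss's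
  -- series in q^h.
  gauss-rescaled : ∀ L → N ≤ L → 1 ≤ N →
    ExplicitSolution.overpartitionProduct⁻¹ R (q ^ h) N q^h-nilpotent 0 (2 ℕ.* L) ≈ thetaSum k′ 0
  gauss-rescaled L N≤L 1≤N = trans (gauss R (q ^ h) N q^h-nilpotent L N≤L 1≤N)
    (Σ-cong N (λ n _ → *-cong (*-congˡ (trans (^-assocʳ q h (1 ℕ.* (n ℕ.* n))) (pow-≡ (≡.cong (h ℕ.*_) (ℕ.*-identityˡ (n ℕ.* n))))))
      (+-cong (trans (^-congʳ (q ^ h) (ℕ.*-zeroʳ (2 ℕ.* n))) (sym (pow-≡ (ℕ.*-zeroʳ (2 ℕ.* n)))))
              (-‿cong (trans (^-assocʳ q h (2 ℕ.* n ℕ.* 1 ℕ.+ 2 ℕ.* suc n ℕ.* 0 ℕ.+ 1)) (pow-≡ (exponent n)))))))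
    where
    exponent : ∀ n → h ℕ.* (2 ℕ.* n ℕ.* 1 ℕ.+ 2 ℕ.* suc n ℕ.* 0 ℕ.+ 1) ≡ ψ k′ n
    exponent n = solveℕ 2 (λ κ n → (nat 1 ⊕ nat 2 ⊗ κ) ⊗ (nat 2 ⊗ n ⊗ nat 1 ⊕ nat 2 ⊗ (nat 1 ⊕ n) ⊗ nat 0 ⊕ nat 1)
      ⊜ nat 2 ⊗ n ⊗ (nat 1 ⊕ κ) ⊕ nat 2 ⊗ (nat 1 ⊕ n) ⊗ κ ⊕ nat 1) ≡.refl k′ n

-- Generating functions of multiplicity vectors

-- (b , d) records that a size has d non-overlined copies, and an overlined
-- one when b is true.
Cell : Set
Cell = Bool × ℕ

bit : Bool → ℕ
bit false = 0
bit true  = 1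

weight : ℕ → List Cell → ℕ
weight s []            = 0
weight s ((b , d) ∷ v) = (bit b ℕ.+ d) ℕ.* s ℕ.+ weight (suc s) v

cells : ℕ → List Cell
cells D = cartesianProduct (false ∷ true ∷ []) (upTo D)

vectors : ℕ → ℕ → List (List Cell)
vectors D zero    = [] ∷ []
vectors D (suc M) = cartesianProductWith _∷_ (cells D) (vectors D M)

-- Sizes are read in pairs, odd then even, and i is the allowance that (2) passes on to the next
-- pair. If the allowance is overrun, `k ∸ _` becomes 0, which every clause rejects; this is why
-- even the empty vector tests `0 < i`.
admissible : ℕ → ℕ → List Cell → Bool
admissible k i []       = 0 <ᵇ i
admissible k i (_ ∷ []) = false
admissible k i ((b₁ , d₁) ∷ (b₂ , d₂) ∷ v) =
  (bit b₁ ℕ.+ d₂ <ᵇ i) ∧ ((d₁ ≡ᵇ 0) ∨ (suc d₂ <ᵇ k)) ∧ admissible k (k ∸ (bit b₂ ℕ.+ d₂)) v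

cellwise : (ℕ → Bool → ℕ → Bool) → ℕ → List Cell → Bool
cellwise ok s []            = true
cellwise ok s ((b , d) ∷ v) = ok s b d ∧ cellwise ok (suc s) v

okNonOverlined okAll : (ℕ → Bool) → ℕ → Bool → ℕ → Bool
okNonOverlined good s b d = (d ≡ᵇ 0) ∨ good s
okAll          good s b d = (bit b ℕ.+ d ≡ᵇ 0) ∨ good s

admissible-0 : ∀ k v → admissible k 0 v ≡ false
admissible-0 k []          = ≡.refl
admissible-0 k (_ ∷ [])    = ≡.refl
admissible-0 k (_ ∷ _ ∷ v) = ≡.refl

module GeneratingFunctions {c ℓ} (R : CommutativeRing c ℓ) (q : CommutativeRing.Carrier R) (N : ℕ)
  (q^N≈0 : Nilpotent R q N)
  (D : ℕ) (N≤D : N ≤ D) where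
  open CommutativeRing R hiding (zero)
  open SetoidReasoning setoid
  open RingLemmas R
  open NilpotentPowers R q N q^N≈0

  sumL : ∀ {a} {A : Set a} → (A → Carrier) → List A → Carrier
  sumL g []       = 0#
  sumL g (x ∷ xs) = g x + sumL g xs

  sumL-cong : ∀ {a} {A : Set a} {f g : A → Carrier} → (∀ x → f x ≈ g x) → ∀ xs → sumL f xs ≈ sumL g xs
  sumL-cong eq []       = refl
  sumL-cong eq (x ∷ xs) = +-cong (eq x) (sumL-cong eq xs)

  sumL-++ : ∀ {a} {A : Set a} (g : A → Carrier) xs ys → sumL g (xs ++ ys) ≈ sumL g xs + sumL g ys
  sumL-++ g []       ys = sym (+-identityˡ _)
  sumL-++ g (x ∷ xs) ys = trans (+-congˡ (sumL-++ g xs ys)) (sym (+-assoc _ _ _))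

  sumL-map : ∀ {a b} {A : Set a} {B : Set b} (g : B → Carrier) (f : A → B) xs → sumL g (map f xs) ≈ sumL (g ∘ f) xs
  sumL-map g f []       = refl
  sumL-map g f (x ∷ xs) = +-congˡ (sumL-map g f xs)

  sumL-product : ∀ {a b c} {A : Set a} {B : Set b} {C : Set c} (g : C → Carrier) (f : A → B → C) xs ys →
    sumL g (cartesianProductWith f xs ys) ≈ sumL (λ x → sumL (g ∘ f x) ys) xs
  sumL-product g f []       ys = refl
  sumL-product g f (x ∷ xs) ys = trans (sumL-++ g (map (f x) ys) _) (+-cong (sumL-map g (f x) ys) (sumL-product g f xs ys))

  sumL-applyUpTo : ∀ {a} {A : Set a} (g : A → Carrier) (f : ℕ → A) n → sumL g (applyUpTo f n) ≈ Σ n (g ∘ f)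
  sumL-applyUpTo g f zero    = refl
  sumL-applyUpTo g f (suc n) = trans (+-congˡ (sumL-applyUpTo g (f ∘ suc) n)) (sym (Σ-head n (g ∘ f)))

  sumL-distribˡ : ∀ {a} {A : Set a} x (g : A → Carrier) xs → x * sumL g xs ≈ sumL (λ y → x * g y) xs
  sumL-distribˡ x g []       = zeroʳ x
  sumL-distribˡ x g (y ∷ ys) = trans (distribˡ _ _ _) (+-congˡ (sumL-distribˡ x g ys))

  Σᵇ : (Bool → Carrier) → Carrier
  Σᵇ g = g false + g true

  ΣCell : (Cell → Carrier) → Carrier
  ΣCell g = Σᵇ (λ b → Σ D (λ d → g (b , d)))

  ΣCell-cong : ∀ f g → (∀ c → f c ≈ g c) → ΣCell f ≈ ΣCell g
  ΣCell-cong f g eq = +-cong (Σ-cong D (λ d _ → eq (false , d))) (Σ-cong D (λ d _ → eq (true , d)))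

  ΣCell-distribˡ : ∀ x g → x * ΣCell g ≈ ΣCell (λ c → x * g c)
  ΣCell-distribˡ x g = trans (distribˡ _ _ _) (+-cong (Σ-distribˡ D x _) (Σ-distribˡ D x _))

  sumL-cells : ∀ g → sumL g (cells D) ≈ ΣCell g
  sumL-cells g = begin
    sumL g (cells D)
      ≈⟨ sumL-product g _,_ (false ∷ true ∷ []) (upTo D) ⟩
    sumL (g ∘ (false ,_)) (upTo D) + (sumL (g ∘ (true ,_)) (upTo D) + 0#)
      ≈⟨ +-cong (sumL-applyUpTo _ id D) (trans (+-identityʳ _) (sumL-applyUpTo _ id D)) ⟩
    ΣCell g ∎

  sumL-vectors : ∀ g M → sumL g (vectors D (suc M)) ≈ ΣCell (λ c → sumL (λ v → g (c ∷ v)) (vectors D M))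
  sumL-vectors g M = trans (sumL-product g _∷_ (cells D) (vectors D M)) (sumL-cells _)

  Σ-swap : ∀ m n (f : ℕ → ℕ → Carrier) → Σ m (λ i → Σ n (f i)) ≈ Σ n (λ j → Σ m (λ i → f i j))
  Σ-swap zero    n f = sym (Σ-0 n (λ _ _ → refl))
  Σ-swap (suc m) n f = trans (+-congʳ (Σ-swap m n f)) (sym (Σ-+ n _ _))

  𝟙 : Bool → Carrier
  𝟙 b = if b then 1# else 0#

  𝟙-∧ : ∀ a b → 𝟙 (a ∧ b) ≈ 𝟙 a * 𝟙 b
  𝟙-∧ true  b = sym (*-identityˡ _)
  𝟙-∧ false b = sym (zeroˡ _)

  gf : (List Cell → Bool) → ℕ → ℕ → Carrier
  gf χ s M = sumL (λ v → 𝟙 (χ v) * q ^ weight s v) (vectors D M)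

  Σ-indicator-< : ∀ i n f → i ≤ n → Σ n (λ d → 𝟙 (d <ᵇ i) * f d) ≈ Σ i f
  Σ-indicator-< zero    n       f _         = Σ-0 n (λ d _ → zeroˡ _)
  Σ-indicator-< (suc i) (suc n) f (s≤s i≤n) = begin
    Σ (suc n) (λ d → 𝟙 (d <ᵇ suc i) * f d)         ≈⟨ Σ-head n _ ⟩
    1# * f 0 + Σ n (λ d → 𝟙 (d <ᵇ i) * f (suc d))  ≈⟨ +-cong (*-identityˡ _) (Σ-indicator-< i n (f ∘ suc) i≤n) ⟩
    f 0 + Σ i (f ∘ suc)                            ≈⟨ Σ-head i f ⟨
    Σ (suc i) f                                    ∎

  Σ-indicator-0 : ∀ n (f : ℕ → Carrier) → 1 ≤ n → Σ n (λ d → 𝟙 (d ≡ᵇ 0) * f d) ≈ f 0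
  Σ-indicator-0 (suc n) f _ = begin
    Σ (suc n) (λ d → 𝟙 (d ≡ᵇ 0) * f d) ≈⟨ Σ-head n _ ⟩
    1# * f 0 + Σ n (λ d → 0# * f (suc d)) ≈⟨ +-cong (*-identityˡ _) (Σ-0 n (λ d _ → zeroˡ _)) ⟩
    f 0 + 0#                           ≈⟨ +-identityʳ _ ⟩
    f 0                                ∎

  V*geometric : ∀ s b → 1 ≤ s → 1 ≤ D →
    V s * Σ D (λ d → 𝟙 ((d ≡ᵇ 0) ∨ b) * (q ^ s) ^ d) ≈ (if b then 1# else V s)
  V*geometric s true 1≤s _ = trans
    (*-congˡ (Σ-cong D (λ d _ → trans (*-congʳ (reflexive (≡.cong 𝟙 (Bool.∨-zeroʳ (d ≡ᵇ 0))))) (*-identityˡ _))))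
    (geometric-inverse D s N≤D 1≤s)
  V*geometric s false 1≤s 1≤D = trans (*-congˡ (trans
    (Σ-cong D (λ d _ → *-congʳ (reflexive (≡.cong 𝟙 (Bool.∨-identityʳ (d ≡ᵇ 0))))))
    (Σ-indicator-0 D ((q ^ s) ^_) 1≤D))) (*-identityʳ _)

  gf-cellwise : ∀ ok M s → gf (cellwise ok s) s M
    ≈ Π M (λ t → ΣCell (λ (b , d) → 𝟙 (ok (t ℕ.+ s) b d) * q ^ ((bit b ℕ.+ d) ℕ.* (t ℕ.+ s))))
  gf-cellwise ok zero s = trans (+-identityʳ _) (*-identityˡ _)
  gf-cellwise ok (suc M) s = begin
    gf (cellwise ok s) s (suc M)
      ≈⟨ sumL-vectors _ M ⟩
    ΣCell (λ c → sumL (λ v → 𝟙 (cellwise ok s (c ∷ v)) * q ^ weight s (c ∷ v)) (vectors D M))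
      ≈⟨ ΣCell-cong _ (λ c → single c * rest) (λ (b , d) → trans (sumL-cong (λ v → trans
           (*-cong (𝟙-∧ (ok s b d) (cellwise ok (suc s) v)) (^-homo-* q ((bit b ℕ.+ d) ℕ.* s) (weight (suc s) v)))
           (solve 4 (λ a b c d → (a :* b) :* (c :* d) := a :* c :* (b :* d)) refl _ _ _ _)) (vectors D M))
           (sym (sumL-distribˡ _ _ (vectors D M)))) ⟩
    ΣCell (λ c → single c * rest)
      ≈⟨ trans (ΣCell-cong (λ c → single c * rest) (λ c → rest * single c) (λ c → *-comm (single c) rest))
           (trans (sym (ΣCell-distribˡ rest single)) (*-comm _ _)) ⟩
    ΣCell single * rest
      ≈⟨ *-congˡ (trans (gf-cellwise ok M (suc s)) (Π-cong M (λ t _ →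
           reflexive (≡.cong (λ u → ΣCell (λ (b , d) → 𝟙 (ok u b d) * q ^ ((bit b ℕ.+ d) ℕ.* u))) (ℕ.+-suc t s))))) ⟩
    _
      ≈⟨ Π-head M _ ⟨
    _ ∎
    where
    single : Cell → Carrier
    single (b , d) = 𝟙 (ok s b d) * q ^ ((bit b ℕ.+ d) ℕ.* s)
    rest : Carrier
    rest = gf (cellwise ok (suc s)) (suc s) M

  pow-bit : ∀ b d s → q ^ ((bit b ℕ.+ d) ℕ.* s) ≈ q ^ (bit b ℕ.* s) * (q ^ s) ^ d
  pow-bit b d s = trans (pow-+ (bit b ℕ.* s) (d ℕ.* s) (ℕ.*-distribʳ-+ s (bit b) d))
    (*-congˡ (trans (pow-≡ (ℕ.*-comm d s)) (sym (^-assocʳ q s d))))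

  pow-1* : ∀ s → q ^ (1 ℕ.* s) ≈ q ^ s
  pow-1* s = pow-≡ (ℕ.*-identityˡ s)

  -- `V s * U⁻¹ s` is the factor of size s in `overpartitionProduct⁻¹`, so the right side is what
  -- size s contributes to the theta product.
  okNonOverlined-factor : ∀ good s → 1 ≤ s → 1 ≤ D →
    V s * U⁻¹ s * ΣCell (λ (b , d) → 𝟙 (okNonOverlined good s b d) * q ^ ((bit b ℕ.+ d) ℕ.* s))
    ≈ (if good s then 1# else V s)
  okNonOverlined-factor good s 1≤s 1≤D = begin
    V s * U⁻¹ s * ΣCell (λ (b , d) → 𝟙 (okNonOverlined good s b d) * q ^ ((bit b ℕ.+ d) ℕ.* s))
      ≈⟨ *-congˡ (+-cong (factor false) (factor true)) ⟩
    V s * U⁻¹ s * (1# * S + q ^ (1 ℕ.* s) * S)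
      ≈⟨ *-congˡ (+-congˡ (*-congʳ (pow-1* s))) ⟩
    V s * U⁻¹ s * (1# * S + q ^ s * S)
      ≈⟨ solve 4 (λ v u S x → v :* u :* (con (+ 1) :* S :+ x :* S) := ((con (+ 1) :+ x) :* u) :* (v :* S)) refl _ _ _ _ ⟩
    (U s * U⁻¹ s) * (V s * S)
      ≈⟨ *-cong (U-inverse s 1≤s) (V*geometric s (good s) 1≤s 1≤D) ⟩
    1# * (if good s then 1# else V s)
      ≈⟨ *-identityˡ _ ⟩
    (if good s then 1# else V s) ∎
    where
    S : Carrier
    S = Σ D (λ d → 𝟙 ((d ≡ᵇ 0) ∨ good s) * (q ^ s) ^ d)
    factor : ∀ b → Σ D (λ d → 𝟙 ((d ≡ᵇ 0) ∨ good s) * q ^ ((bit b ℕ.+ d) ℕ.* s)) ≈ q ^ (bit b ℕ.* s) * S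
    factor b = trans (Σ-cong D (λ d _ → trans (*-congˡ (pow-bit b d s))
      (solve 3 (λ a b c → a :* (b :* c) := b :* (a :* c)) refl _ _ _))) (sym (Σ-distribˡ D _ _))

  okAll-factor : ∀ good s → 1 ≤ s → 1 ≤ D →
    V s * U⁻¹ s * ΣCell (λ (b , d) → 𝟙 (okAll good s b d) * q ^ ((bit b ℕ.+ d) ℕ.* s))
    ≈ (if good s then 1# else V s * U⁻¹ s)
  okAll-factor good s 1≤s 1≤D with good s
  ... | true  = trans (*-congˡ (ΣCell-cong _ (λ (b , d) → 𝟙 ((d ≡ᵇ 0) ∨ true) * q ^ ((bit b ℕ.+ d) ℕ.* s))
                        λ (b , d) → *-congʳ {q ^ ((bit b ℕ.+ d) ℕ.* s)} (reflexive (≡.cong 𝟙 (≡.trans (Bool.∨-zeroʳ (bit b ℕ.+ d ≡ᵇ 0)) (≡.sym (Bool.∨-zeroʳ (d ≡ᵇ 0))))))))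
                      (okNonOverlined-factor (λ _ → true) s 1≤s 1≤D)
  ... | false = trans (*-congˡ (trans (+-cong
      (trans (Σ-cong D (λ d _ → *-congʳ (reflexive (≡.cong 𝟙 (Bool.∨-identityʳ (d ≡ᵇ 0)))))) (Σ-indicator-0 D (λ d → q ^ (d ℕ.* s)) 1≤D))
      (Σ-0 D (λ d _ → zeroˡ _))) (+-identityʳ _))) (*-identityʳ _)

  module Transfer (k : ℕ) (1≤D : 1 ≤ D) where

    G : ℕ → ℕ → ℕ → Carrier
    G r s i = gf (admissible k i) s (r ℕ.* 2)

    G-0 : ∀ r s → G r s 0 ≈ 0#
    G-0 r s = vanish (vectors D (r ℕ.* 2))
      where
      vanish : ∀ xs → sumL (λ v → 𝟙 (admissible k 0 v) * q ^ weight s v) xs ≈ 0#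
      vanish []       = refl
      vanish (v ∷ xs) = trans (+-cong (trans (*-congʳ (reflexive (≡.cong 𝟙 (admissible-0 k v)))) (zeroˡ _)) (vanish xs)) (+-identityˡ _)

    module _ (r s i : ℕ) where

      G′ : ℕ → Carrier
      G′ = G r (suc (suc s))

      Z : Bool → ℕ → Carrier
      Z b d = q ^ ((bit b ℕ.+ d) ℕ.* suc s) * G′ (k ∸ (bit b ℕ.+ d))

      G-expand : G (suc r) s i ≈
        Σᵇ (λ b₁ → Σ D (λ d₁ → Σᵇ (λ b₂ → Σ D (λ d₂ →
          𝟙 (bit b₁ ℕ.+ d₂ <ᵇ i) * 𝟙 ((d₁ ≡ᵇ 0) ∨ (suc d₂ <ᵇ k)) * q ^ ((bit b₁ ℕ.+ d₁) ℕ.* s) * Z b₂ d₂))))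
      G-expand = trans (sumL-vectors first (suc (r ℕ.* 2))) (ΣCell-cong
        (λ c₁ → sumL (λ v → first (c₁ ∷ v)) (vectors D (suc (r ℕ.* 2)))) (λ c₁ → ΣCell (second c₁)) (λ c₁@(b₁ , d₁) →
        trans (sumL-vectors (λ v → first (c₁ ∷ v)) (r ℕ.* 2)) (ΣCell-cong
          (λ c₂ → sumL (λ v → first (c₁ ∷ c₂ ∷ v)) (vectors D (r ℕ.* 2))) (second c₁) (λ (b₂ , d₂) →
          trans (sumL-cong (λ v → trans
              (*-cong (trans (𝟙-∧ (bit b₁ ℕ.+ d₂ <ᵇ i) _)
                  (*-congˡ (𝟙-∧ ((d₁ ≡ᵇ 0) ∨ (suc d₂ <ᵇ k)) (admissible k (k ∸ (bit b₂ ℕ.+ d₂)) v))))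
                (trans (^-homo-* q ((bit b₁ ℕ.+ d₁) ℕ.* s) ((bit b₂ ℕ.+ d₂) ℕ.* suc s ℕ.+ weight (suc (suc s)) v))
                  (*-congˡ (^-homo-* q ((bit b₂ ℕ.+ d₂) ℕ.* suc s) (weight (suc (suc s)) v)))))
              (solve 6 (λ a b c x y z → (a :* (b :* c)) :* (x :* (y :* z)) := (a :* b :* x :* y) :* (c :* z)) refl _ _ _ _ _ _)) (vectors D (r ℕ.* 2)))
            (trans (sym (sumL-distribˡ _ _ (vectors D (r ℕ.* 2)))) (*-assoc _ _ _))))))
        where
        first : List Cell → Carrier
        first v = 𝟙 (admissible k i v) * q ^ weight s v
        second : Cell → Cell → Carrier
        second (b₁ , d₁) (b₂ , d₂) =
          𝟙 (bit b₁ ℕ.+ d₂ <ᵇ i) * 𝟙 ((d₁ ≡ᵇ 0) ∨ (suc d₂ <ᵇ k)) * q ^ ((bit b₁ ℕ.+ d₁) ℕ.* s) * Z b₂ d₂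

      κ : ℕ → Carrier
      κ d = if suc d <ᵇ k then 1# else V s

      W : ℕ → Carrier
      W d = κ d * Σᵇ (λ b → Z b d)

      -- The copies of the odd size s form a geometric series, or only its first term where (3)
      -- applies; `V s` turns these into the two values of `κ`. An overlined s costs q^s and lowers
      -- the bound on d by one.
      G-summed : 1 ≤ s →
        V s * G (suc r) s i ≈ Σ D (λ d → 𝟙 (d <ᵇ i) * W d) + q ^ s * Σ D (λ d → 𝟙 (suc d <ᵇ i) * W d)
      G-summed 1≤s = begin
        V s * G (suc r) s i
          ≈⟨ trans (*-congˡ G-expand) (distribˡ _ _ _) ⟩
        _
          ≈⟨ +-cong (collect false) (collect true) ⟩
        1# * Σ D (λ d → 𝟙 (d <ᵇ i) * W d) + q ^ (1 ℕ.* s) * Σ D (λ d → 𝟙 (suc d <ᵇ i) * W d)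
          ≈⟨ +-cong (*-identityˡ _) (*-congʳ (pow-1* s)) ⟩
        _ ∎
        where
        collect : ∀ b₁ → V s * Σ D (λ d₁ → Σᵇ (λ b₂ → Σ D (λ d₂ →
            𝟙 (bit b₁ ℕ.+ d₂ <ᵇ i) * 𝟙 ((d₁ ≡ᵇ 0) ∨ (suc d₂ <ᵇ k)) * q ^ ((bit b₁ ℕ.+ d₁) ℕ.* s) * Z b₂ d₂)))
          ≈ q ^ (bit b₁ ℕ.* s) * Σ D (λ d → 𝟙 (bit b₁ ℕ.+ d <ᵇ i) * W d)
        collect b₁ = begin
          V s * Σ D (λ d₁ → Σᵇ (λ b₂ → Σ D (λ d₂ →
            𝟙 (bit b₁ ℕ.+ d₂ <ᵇ i) * 𝟙 ((d₁ ≡ᵇ 0) ∨ (suc d₂ <ᵇ k)) * q ^ ((bit b₁ ℕ.+ d₁) ℕ.* s) * Z b₂ d₂)))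
            ≈⟨ *-congˡ (Σ-cong D (λ d₁ _ → trans (sym (Σ-+ D _ _)) (Σ-cong D (λ d₂ _ → trans
                 (+-cong (*-congʳ (*-congˡ (pow-bit b₁ d₁ s))) (*-congʳ (*-congˡ (pow-bit b₁ d₁ s))))
                 (solve 6 (λ a b x y z z′ → a :* b :* (x :* y) :* z :+ a :* b :* (x :* y) :* z′ := (x :* (a :* (z :+ z′))) :* (b :* y))
                   refl _ _ _ _ _ _))))) ⟩
          V s * Σ D (λ d₁ → Σ D (λ d₂ → c₁ d₂ * (𝟙 ((d₁ ≡ᵇ 0) ∨ (suc d₂ <ᵇ k)) * (q ^ s) ^ d₁)))
            ≈⟨ *-congˡ (trans (Σ-swap D D _) (Σ-cong D (λ d₂ _ → sym (Σ-distribˡ D (c₁ d₂) _)))) ⟩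
          V s * Σ D (λ d₂ → c₁ d₂ * Σ D (λ d₁ → 𝟙 ((d₁ ≡ᵇ 0) ∨ (suc d₂ <ᵇ k)) * (q ^ s) ^ d₁))
            ≈⟨ Σ-distribˡ D (V s) _ ⟩
          Σ D (λ d₂ → V s * (c₁ d₂ * Σ D (λ d₁ → 𝟙 ((d₁ ≡ᵇ 0) ∨ (suc d₂ <ᵇ k)) * (q ^ s) ^ d₁)))
            ≈⟨ Σ-cong D (λ d₂ _ → trans
                 (solve 3 (λ a b c → a :* (b :* c) := b :* (a :* c)) refl _ _ _)
                 (trans (*-congˡ (V*geometric s (suc d₂ <ᵇ k) 1≤s 1≤D))
                 (solve 4 (λ x a z k → (x :* (a :* z)) :* k := x :* (a :* (k :* z))) refl _ _ _ _))) ⟩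
          Σ D (λ d → q ^ (bit b₁ ℕ.* s) * (𝟙 (bit b₁ ℕ.+ d <ᵇ i) * W d))
            ≈⟨ Σ-distribˡ D _ _ ⟨
          q ^ (bit b₁ ℕ.* s) * Σ D (λ d → 𝟙 (bit b₁ ℕ.+ d <ᵇ i) * W d) ∎
          where
          c₁ : ℕ → Carrier
          c₁ d = q ^ (bit b₁ ℕ.* s) * (𝟙 (bit b₁ ℕ.+ d <ᵇ i) * Σᵇ (λ b → Z b d))

-- Both counting functions equal the same theta series up to a common unit.

module GeneratingFunctionIdentities {c ℓ} (R : CommutativeRing c ℓ) (q : CommutativeRing.Carrier R) (N : ℕ)
  (q^N≈0 : Nilpotent R q N)
  (1≤N : 1 ≤ N) (k′ : ℕ) where
  open CommutativeRing R hiding (zero)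
  open SetoidReasoning setoid
  open RingLemmas R
  open NilpotentPowers R q N q^N≈0
  open ExplicitSolution R q N q^N≈0 k′ using (k; h; K; Ĥ; overpartitionProduct⁻¹; module Uniqueness)
  open ThetaProducts R q N q^N≈0 k′ using (thetaSum; thetaSum-product; pow-nilpotent)
  open +-*-Solver using () renaming (solve to solveℕ; _:+_ to _⊕_; _:*_ to _⊗_; _:=_ to _⊜_; con to nat)

  -- `D` needs N for the geometric series and k so that no multiplicity permitted by the bounds is
  -- cut off. `B` is the number of factors demanded by `triple-product`. `L` makes the 2L sizes fall
  -- into B blocks of length 2h, and likewise into 2B blocks of length h.
  D B L : ℕ
  D = N ℕ.+ k
  B = N ℕ.+ N
  L = B ℕ.* h

  1≤D : 1 ≤ D
  1≤D = ℕ.≤-trans 1≤N (ℕ.m≤m+n N k)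

  1≤B : 1 ≤ B
  1≤B = ℕ.≤-trans 1≤N (ℕ.m≤m+n N N)

  N≤L : N ≤ L
  N≤L = ℕ.≤-trans (ℕ.m≤m+n N N) (ℕ.m≤m*n B h)

  open GeneratingFunctions R q N q^N≈0 D (ℕ.m≤m+n N k)
  open Transfer k 1≤D

  -- The sizes 2m+1 up to 2L form L - m pairs; at m = L only the empty vector is left.
  Gₘ : ℕ → ℕ → Carrier
  Gₘ m i = G (L ∸ m) (2 ℕ.* m ℕ.+ 1) i

  Gₘ-limit : ∀ i → 1 ≤ i → i ≤ k → Gₘ L i ≈ 1#
  Gₘ-limit (suc i) _ _ = begin
    G (L ∸ L) (2 ℕ.* L ℕ.+ 1) (suc i) ≡⟨ ≡.cong (λ r → G r (2 ℕ.* L ℕ.+ 1) (suc i)) (ℕ.n∸n≡0 L) ⟩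
    1# * 1# + 0#                      ≈⟨ trans (+-identityʳ _) (*-identityˡ 1#) ⟩
    1#                                ∎

  -- The term of index d = k − 1 is where condition (3) bites: no non-overlined
  -- part of size s may accompany it, which replaces 1 by the factor V s.
  W≈K : ∀ m d → d < k → W (L ∸ suc m) (2 ℕ.* m ℕ.+ 1) 0 d ≈ q ^ (2 ℕ.* suc m ℕ.* d) * K Gₘ m (k ∸ d)
  W≈K m d d<k = begin
    κ₀ * (q ^ (d ℕ.* suc s) * g (k ∸ d) + q ^ (suc d ℕ.* suc s) * g (k ∸ suc d))
      ≈⟨ *-congˡ (+-cong (*-congʳ pow-d) (*-congʳ pow-1+d)) ⟩
    κ₀ * (x * g (k ∸ d) + z * x * g (k ∸ suc d))
      ≈⟨ solve 5 (λ κ x a z b → κ :* (x :* a :+ z :* x :* b) := x :* (κ :* (a :+ z :* b))) refl κ₀ x _ z _ ⟩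
    x * (κ₀ * (g (k ∸ d) + z * g (k ∸ suc d)))
      ≈⟨ *-congˡ (cases (k′ ∸ d) ≡.refl) ⟩
    x * K Gₘ m (k ∸ d) ∎
    where
    s : ℕ
    s = 2 ℕ.* m ℕ.+ 1
    g : ℕ → Carrier
    g = G (L ∸ suc m) (suc (suc s))
    κ₀ x z : Carrier
    κ₀ = κ (L ∸ suc m) s 0 d
    x = q ^ (2 ℕ.* suc m ℕ.* d)
    z = q ^ (2 ℕ.* suc m)

    1+s≡ : suc s ≡ 2 ℕ.* suc m
    1+s≡ = solveℕ 1 (λ m → nat 1 ⊕ (nat 2 ⊗ m ⊕ nat 1) ⊜ nat 2 ⊗ (nat 1 ⊕ m)) ≡.refl m

    pow-d : q ^ (d ℕ.* suc s) ≈ x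
    pow-d = pow-≡ (≡.trans (ℕ.*-comm d (suc s)) (≡.cong (ℕ._* d) 1+s≡))

    pow-1+d : q ^ (suc d ℕ.* suc s) ≈ z * x
    pow-1+d = trans (^-homo-* q (suc s) (d ℕ.* suc s)) (*-cong (pow-≡ 1+s≡) pow-d)

    g≈Gₘ : ∀ i → g i ≈ Gₘ (suc m) i
    g≈Gₘ i = reflexive (≡.cong (λ t → G (L ∸ suc m) t i)
      (solveℕ 1 (λ m → nat 2 ⊕ (nat 2 ⊗ m ⊕ nat 1) ⊜ nat 2 ⊗ (nat 1 ⊕ m) ⊕ nat 1) ≡.refl m))

    k∸d : k ∸ d ≡ suc (k′ ∸ d)
    k∸d = ℕ.+-∸-assoc 1 (s≤s⁻¹ d<k)

    cases : ∀ j → k′ ∸ d ≡ j → κ₀ * (g (k ∸ d) + z * g (k ∸ suc d)) ≈ K Gₘ m (k ∸ d)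
    cases zero j≡ rewrite k∸d | j≡ = begin
      κ₀ * (g 1 + z * g 0)
        ≈⟨ *-cong (reflexive (≡.cong (λ b → if b then 1# else V s) (dec-false (suc d ℕ.<? k) ¬1+d<k))) (+-cong (g≈Gₘ 1) (*-congˡ (G-0 (L ∸ suc m) (suc (suc s))))) ⟩
      V s * (Gₘ (suc m) 1 + z * 0#)
        ≈⟨ *-congˡ (trans (+-congˡ (zeroʳ z)) (+-identityʳ _)) ⟩
      V s * Gₘ (suc m) 1 ∎
      where
      ¬1+d<k : ¬ (suc d < k)
      ¬1+d<k 1+d<k = ℕ.<⇒≱ (s≤s⁻¹ 1+d<k) (ℕ.m∸n≡0⇒m≤n j≡)
    cases (suc j) j≡ rewrite k∸d | j≡ = begin
      κ₀ * (g (suc (suc j)) + z * g (suc j))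
        ≈⟨ *-cong (reflexive (≡.cong (λ b → if b then 1# else V s) (dec-true (suc d ℕ.<? k) 1+d<k))) (+-cong (g≈Gₘ (suc (suc j))) (*-congˡ (g≈Gₘ (suc j)))) ⟩
      1# * K Gₘ m (suc (suc j))
        ≈⟨ *-identityˡ _ ⟩
      K Gₘ m (suc (suc j)) ∎
      where
      1+d<k : suc d < k
      1+d<k = s≤s (ℕ.m∸n≢0⇒n<m (λ eq → contradiction (≡.trans (≡.sym j≡) eq) (λ ())))

  Gₘ-rec : ∀ m i → m < L → suc i ≤ k →
    V (2 ℕ.* m ℕ.+ 1) * Gₘ m (suc i) ≈ Ĥ Gₘ m (suc i) + q ^ (2 ℕ.* m ℕ.+ 1) * Ĥ Gₘ m i
  Gₘ-rec m i m<L i<k = begin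
    V s * G (L ∸ m) s (suc i)
      ≡⟨ ≡.cong (λ r → V s * G r s (suc i)) (ℕ.+-∸-assoc 1 m<L) ⟩
    V s * G (suc (L ∸ suc m)) s (suc i)
      ≈⟨ G-summed (L ∸ suc m) s (suc i) (ℕ.m≤n+m 1 (2 ℕ.* m)) ⟩
    Σ D (λ d → 𝟙 (d <ᵇ suc i) * w d) + q ^ s * Σ D (λ d → 𝟙 (d <ᵇ i) * w d)
      ≈⟨ +-cong (Σ-indicator-< (suc i) D w (ℕ.≤-trans i<k (ℕ.m≤n+m k N)))
                (*-congˡ (Σ-indicator-< i D w (ℕ.≤-trans (ℕ.<⇒≤ i<k) (ℕ.m≤n+m k N)))) ⟩
    Σ (suc i) w + q ^ s * Σ i w
      ≈⟨ +-cong (Σ-cong (suc i) (λ d d<1+i → W≈K m d (ℕ.<-≤-trans d<1+i i<k)))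
                (*-congˡ (Σ-cong i (λ d d<i → W≈K m d (ℕ.<-trans d<i i<k)))) ⟩
    Ĥ Gₘ m (suc i) + q ^ s * Ĥ Gₘ m i ∎
    where
    s : ℕ
    s = 2 ℕ.* m ℕ.+ 1
    w : ℕ → Carrier
    w = W (L ∸ suc m) s 0

  C : Carrier
  C = overpartitionProduct⁻¹ (2 ℕ.* L)

  C-cancel : ∀ {a b} → C * a ≈ C * b → a ≈ b
  C-cancel = unit-cancel (Π-unit (2 ℕ.* L) _ (λ s → V⁻¹ (suc s) * U (suc s)) (λ s _ → begin
    V (suc s) * U⁻¹ (suc s) * (V⁻¹ (suc s) * U (suc s))
      ≈⟨ solve 4 (λ v u v′ u′ → v :* u′ :* (v′ :* u) := (v :* v′) :* (u :* u′)) refl _ _ _ _ ⟩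
    (V (suc s) * V⁻¹ (suc s)) * (U (suc s) * U⁻¹ (suc s))
      ≈⟨ *-cong (V-inverse (suc s) (s≤s z≤n)) (U-inverse (suc s) (s≤s z≤n)) ⟩
    1# * 1#
      ≈⟨ *-identityˡ 1# ⟩
    1# ∎))

  C*gf-admissible : ∀ i j → suc i ℕ.+ j ≡ k → C * gf (admissible k (suc i)) 1 (L ℕ.* 2) ≈ thetaSum i j
  C*gf-admissible = Uniqueness.solution L N≤L 1≤N Gₘ Gₘ-limit Gₘ-rec

  C*gf-cellwise : ∀ ok F → (∀ s → V (suc s) * U⁻¹ (suc s)
      * ΣCell (λ (b , d) → 𝟙 (ok (suc s) b d) * q ^ ((bit b ℕ.+ d) ℕ.* suc s)) ≈ F s) →
    C * gf (cellwise ok 1) 1 (L ℕ.* 2) ≈ Π (2 ℕ.* L) F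
  C*gf-cellwise ok F eq = begin
    C * gf (cellwise ok 1) 1 (L ℕ.* 2)
      ≈⟨ *-congˡ (trans (reflexive (≡.cong (gf (cellwise ok 1) 1) (ℕ.*-comm L 2))) (gf-cellwise ok (2 ℕ.* L) 1)) ⟩
    C * Π (2 ℕ.* L) cellSum
      ≈⟨ Π-* (2 ℕ.* L) _ cellSum ⟨
    Π (2 ℕ.* L) (λ s → V (suc s) * U⁻¹ (suc s) * cellSum s)
      ≈⟨ Π-cong (2 ℕ.* L) (λ s _ → trans (*-congˡ (reflexive (≡.cong (λ u → ΣCell (λ (b , d) → 𝟙 (ok u b d) * q ^ ((bit b ℕ.+ d) ℕ.* u))) (ℕ.+-comm s 1)))) (eq s)) ⟩
    Π (2 ℕ.* L) F ∎
    where
    cellSum : ℕ → Carrier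
    cellSum s = ΣCell (λ (b , d) → 𝟙 (ok (s ℕ.+ 1) b d) * q ^ ((bit b ℕ.+ d) ℕ.* (s ℕ.+ 1)))

  δ : ℕ → (ℕ → Carrier) → ℕ → Carrier
  δ a F r = if suc r ≡ᵇ a then F r else 1#

  Π-δ : ∀ n a (F : ℕ → Carrier) → a < n → Π n (δ (suc a) F) ≈ F a
  Π-δ n a F a<n = trans (Π-single n a a<n λ r _ r≢a →
      reflexive (≡.cong (λ b → if b then F r else 1#) (dec-false (r ℕ.≟ a) r≢a)))
    (reflexive (≡.cong (λ b → if b then F a else 1#) (dec-true (a ℕ.≟ a) ≡.refl)))

  module _ (i j : ℕ) (1+i+j≡k : suc i ℕ.+ j ≡ k) (1≤j : 1 ≤ j) (good : ℕ → Bool)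
    (good-residues : ∀ t r → r < 2 ℕ.* h → good (suc (t ℕ.* (2 ℕ.* h) ℕ.+ r))
      ≡ not ((suc r ≡ᵇ h ℕ.+ 2 ℕ.* j) ∨ (suc r ≡ᵇ 2 ℕ.* i ℕ.+ 1) ∨ (suc r ≡ᵇ 2 ℕ.* h))) where

    C*gf-okNonOverlined : C * gf (cellwise (okNonOverlined good) 1) 1 (L ℕ.* 2) ≈ thetaSum i j
    C*gf-okNonOverlined = begin
      C * gf (cellwise (okNonOverlined good) 1) 1 (L ℕ.* 2)
        ≈⟨ C*gf-cellwise (okNonOverlined good) F (λ s → okNonOverlined-factor good (suc s) (s≤s z≤n) 1≤D) ⟩
      Π (2 ℕ.* L) F
        ≡⟨ ≡.cong (λ t → Π t F) (solveℕ 2 (λ b h → nat 2 ⊗ (b ⊗ h) ⊜ b ⊗ (nat 2 ⊗ h)) ≡.refl B h) ⟩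
      Π (B ℕ.* (2 ℕ.* h)) F
        ≈⟨ Π-blocks B (2 ℕ.* h) F ⟩
      Π B (λ t → Π (2 ℕ.* h) (λ r → F (t ℕ.* (2 ℕ.* h) ℕ.+ r)))
        ≈⟨ Π-cong B (λ t _ → block t) ⟩
      _
        ≈⟨ thetaSum-product i j 1+i+j≡k B ℕ.≤-refl 1≤B ⟩
      thetaSum i j ∎
      where
      F : ℕ → Carrier
      F s = if good (suc s) then 1# else V (suc s)

      a b c′ : ℕ
      a  = 2 ℕ.* k′ ℕ.+ 2 ℕ.* j
      b  = 2 ℕ.* i
      c′ = k′ ℕ.+ k′ ℕ.+ h

      k′≡i+j : k′ ≡ i ℕ.+ j
      k′≡i+j = ≡.sym (ℕ.suc-injective 1+i+j≡k)

      b<2k′ : b < 2 ℕ.* k′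
      b<2k′ = ℕ.*-monoʳ-< 2 (≡.subst (i <_) (≡.sym k′≡i+j) (ℕ.m<m+n i 1≤j))

      j≤k′ : j ≤ k′
      j≤k′ = ≡.subst (j ≤_) (≡.sym k′≡i+j) (ℕ.m≤n+m j i)

      b<a : b < a
      b<a = ℕ.<-≤-trans b<2k′ (ℕ.m≤m+n _ _)

      2h≡1+c : 2 ℕ.* h ≡ suc c′
      2h≡1+c = solveℕ 1 (λ κ → nat 2 ⊗ (nat 1 ⊕ nat 2 ⊗ κ) ⊜ nat 1 ⊕ (κ ⊕ κ ⊕ (nat 1 ⊕ nat 2 ⊗ κ))) ≡.refl k′

      a<c : a < c′
      a<c = ≡.subst (a <_) (solveℕ 1 (λ κ → nat 1 ⊕ (nat 2 ⊗ κ ⊕ nat 2 ⊗ κ) ⊜ κ ⊕ κ ⊕ (nat 1 ⊕ nat 2 ⊗ κ)) ≡.refl k′)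
        (s≤s (ℕ.+-monoʳ-≤ (2 ℕ.* k′) (ℕ.*-monoʳ-≤ 2 j≤k′)))

      ≡ᵇ-true : ∀ x {y} → (x ≡ᵇ y) ≡ true → x ≡ y
      ≡ᵇ-true x {y} eq = ℕ.≡ᵇ⇒≡ x y (≡.subst T (≡.sym eq) _)

      -- A product of three local factors matches one exclusion test because the positions satisfy b
      -- < a < c′. The inequality b < a comes from 1 ≤ j; at j = 0 the positions a and b would
      -- coincide.
      select : ∀ r X → (if not ((r ≡ᵇ a) ∨ (r ≡ᵇ b) ∨ (r ≡ᵇ c′)) then 1# else X)
        ≈ (if r ≡ᵇ a then X else 1#) * (if r ≡ᵇ b then X else 1#) * (if r ≡ᵇ c′ then X else 1#)
      select r X with r ≡ᵇ a in ra | r ≡ᵇ b in rb | r ≡ᵇ c′ in rc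
      ... | true  | true  | _     = contradiction (≡.trans (≡.sym (≡ᵇ-true r rb)) (≡ᵇ-true r ra)) (ℕ.<⇒≢ b<a)
      ... | true  | false | true  = contradiction (≡.trans (≡.sym (≡ᵇ-true r ra)) (≡ᵇ-true r rc)) (ℕ.<⇒≢ a<c)
      ... | false | true  | true  = contradiction (≡.trans (≡.sym (≡ᵇ-true r rb)) (≡ᵇ-true r rc)) (ℕ.<⇒≢ (ℕ.<-trans b<a a<c))
      ... | true  | false | false = solve 1 (λ x → x := x :* con (+ 1) :* con (+ 1)) refl X
      ... | false | true  | false = solve 1 (λ x → x := con (+ 1) :* x :* con (+ 1)) refl X
      ... | false | false | true  = solve 1 (λ x → x := con (+ 1) :* con (+ 1) :* x) refl X
      ... | false | false | false = solve 0 (con (+ 1) := con (+ 1) :* con (+ 1) :* con (+ 1)) refl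

      block : ∀ t → Π (2 ℕ.* h) (λ r → F (t ℕ.* (2 ℕ.* h) ℕ.+ r))
        ≈ V (t ℕ.* (2 ℕ.* h) ℕ.+ (h ℕ.+ 2 ℕ.* j)) * V (t ℕ.* (2 ℕ.* h) ℕ.+ (2 ℕ.* i ℕ.+ 1)) * V (t ℕ.* (2 ℕ.* h) ℕ.+ 2 ℕ.* h)
      block t = begin
        Π (2 ℕ.* h) (λ r → F (t ℕ.* (2 ℕ.* h) ℕ.+ r))
          ≈⟨ Π-cong (2 ℕ.* h) (λ r r<2h → trans (reflexive (≡.cong (λ b → if b then 1# else X r) (residues r r<2h))) (select r (X r))) ⟩
        Π (2 ℕ.* h) (λ r → δ (suc a) X r * δ (suc b) X r * δ (suc c′) X r)
          ≈⟨ trans (Π-* (2 ℕ.* h) _ _) (*-congʳ (Π-* (2 ℕ.* h) _ _)) ⟩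
        Π (2 ℕ.* h) (δ (suc a) X) * Π (2 ℕ.* h) (δ (suc b) X) * Π (2 ℕ.* h) (δ (suc c′) X)
          ≈⟨ *-cong (*-cong (Π-δ (2 ℕ.* h) a X (<2h a<c)) (Π-δ (2 ℕ.* h) b X (<2h (ℕ.<-trans b<a a<c))))
                    (Π-δ (2 ℕ.* h) c′ X (≡.subst (c′ <_) (≡.sym 2h≡1+c) ℕ.≤-refl)) ⟩
        X a * X b * X c′
          ≡⟨ ≡.cong₂ _*_ (≡.cong₂ _*_ (shape (h ℕ.+ 2 ℕ.* j) ≡.refl) (shape (2 ℕ.* i ℕ.+ 1) (ℕ.+-comm (2 ℕ.* i) 1))) (shape (2 ℕ.* h) 2h≡1+c) ⟩
        _ ∎
        where
        X : ℕ → Carrier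
        X r = V (suc (t ℕ.* (2 ℕ.* h) ℕ.+ r))
        <2h : ∀ {x} → x < c′ → x < 2 ℕ.* h
        <2h {x} x<c = ≡.subst (x <_) (≡.sym 2h≡1+c) (ℕ.m<n⇒m<1+n x<c)
        shape : ∀ {x} y → y ≡ suc x → X x ≡ V (t ℕ.* (2 ℕ.* h) ℕ.+ y)
        shape {x} _ ≡.refl = ≡.cong V (≡.sym (ℕ.+-suc (t ℕ.* (2 ℕ.* h)) x))
        residues : ∀ r → r < 2 ℕ.* h → good (suc (t ℕ.* (2 ℕ.* h) ℕ.+ r)) ≡ not ((r ≡ᵇ a) ∨ (r ≡ᵇ b) ∨ (r ≡ᵇ c′))
        residues r r<2h = ≡.trans (good-residues t r r<2h) (≡.cong not (≡.cong ((r ≡ᵇ a) ∨_)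
          (≡.cong₂ _∨_ (≡.cong (suc r ≡ᵇ_) (ℕ.+-comm (2 ℕ.* i) 1)) (≡.cong (suc r ≡ᵇ_) 2h≡1+c))))

    gf-admissible≈gf-okNonOverlined :
      gf (admissible k (suc i)) 1 (L ℕ.* 2) ≈ gf (cellwise (okNonOverlined good) 1) 1 (L ℕ.* 2)
    gf-admissible≈gf-okNonOverlined = C-cancel (trans (C*gf-admissible i j 1+i+j≡k) (sym C*gf-okNonOverlined))

  module _ (good : ℕ → Bool)
    (good-residues : ∀ t r → r < h → good (suc (t ℕ.* h ℕ.+ r)) ≡ not (suc r ≡ᵇ h)) where

    C*gf-okAll : C * gf (cellwise (okAll good) 1) 1 (L ℕ.* 2) ≈ thetaSum k′ 0
    C*gf-okAll = begin
      C * gf (cellwise (okAll good) 1) 1 (L ℕ.* 2)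
        ≈⟨ C*gf-cellwise (okAll good) F (λ s → okAll-factor good (suc s) (s≤s z≤n) 1≤D) ⟩
      Π (2 ℕ.* L) F
        ≡⟨ ≡.cong (λ t → Π t F) (≡.sym (ℕ.*-assoc 2 B h)) ⟩
      Π (2 ℕ.* B ℕ.* h) F
        ≈⟨ Π-blocks (2 ℕ.* B) h F ⟩
      Π (2 ℕ.* B) (λ t → Π h (λ r → F (t ℕ.* h ℕ.+ r)))
        ≈⟨ Π-cong (2 ℕ.* B) (λ t _ → block t) ⟩
      ExplicitSolution.overpartitionProduct⁻¹ R (q ^ h) N (GaussRescaled.q^h-nilpotent R q N q^N≈0 k′) 0 (2 ℕ.* B)
        ≈⟨ GaussRescaled.gauss-rescaled R q N q^N≈0 k′ B (ℕ.m≤m+n N N) 1≤N ⟩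
      thetaSum k′ 0 ∎
      where
      module Q = NilpotentPowers R (q ^ h) N (pow-nilpotent h (s≤s z≤n))

      X F : ℕ → Carrier
      X s = V (suc s) * U⁻¹ (suc s)
      F s = if good (suc s) then 1# else X s

      if-not : ∀ b {x y : Carrier} → (if not b then x else y) ≡ (if b then y else x)
      if-not true  = ≡.refl
      if-not false = ≡.refl

      V-rescale : ∀ e → V (h ℕ.* e) ≈ Q.V e
      V-rescale e = +-congˡ (-‿cong (sym (^-assocʳ q h e)))

      U⁻¹-rescale : ∀ e → U⁻¹ (h ℕ.* e) ≈ Q.U⁻¹ e
      U⁻¹-rescale e = *-cong (V-rescale e) (Σ-cong N (λ d _ → ^-congˡ d
        (trans (pow-≡ (≡.sym (ℕ.*-distribˡ-+ h e e))) (sym (^-assocʳ q h (e ℕ.+ e))))))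

      block : ∀ t → Π h (λ r → F (t ℕ.* h ℕ.+ r)) ≈ Q.V (suc t) * Q.U⁻¹ (suc t)
      block t = begin
        Π h (λ r → F (t ℕ.* h ℕ.+ r))
          ≈⟨ Π-cong h (λ r r<h → reflexive (≡.trans (≡.cong (λ b → if b then 1# else X (t ℕ.* h ℕ.+ r)) (good-residues t r r<h)) (if-not (suc r ≡ᵇ h)))) ⟩
        Π h (δ h (λ r → X (t ℕ.* h ℕ.+ r)))
          ≈⟨ Π-δ h (2 ℕ.* k′) _ ℕ.≤-refl ⟩
        X (t ℕ.* h ℕ.+ 2 ℕ.* k′)
          ≡⟨ ≡.cong (λ e → V e * U⁻¹ e) (solveℕ 2 (λ t κ → nat 1 ⊕ (t ⊗ (nat 1 ⊕ nat 2 ⊗ κ) ⊕ nat 2 ⊗ κ) ⊜ (nat 1 ⊕ nat 2 ⊗ κ) ⊗ (nat 1 ⊕ t)) ≡.refl t k′) ⟩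
        V (h ℕ.* suc t) * U⁻¹ (h ℕ.* suc t)
          ≈⟨ *-cong (V-rescale (suc t)) (U⁻¹-rescale (suc t)) ⟩
        Q.V (suc t) * Q.U⁻¹ (suc t) ∎

    gf-admissible≈gf-okAll : gf (admissible k k) 1 (L ℕ.* 2) ≈ gf (cellwise (okAll good) 1) 1 (L ℕ.* 2)
    gf-admissible≈gf-okAll = C-cancel (trans (C*gf-admissible k′ 0 (ℕ.+-identityʳ k)) (sym C*gf-okAll))

open import Data.Nat using (_+_; _*_)
open import Defs
open import Relation.Binary.PropositionalEquality using (refl; sym; trans; cong; cong₂; subst; subst₂)

-- Truncated power series

module PowerSeries where
  open Data.Integer.Solver.+-*-Solver using (solve; _:+_; _:*_; _:=_)
  open ≡-Reasoning

  Series : Set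
  Series = ℕ → ℤ

  infixl 6 _⊕_
  infixl 7 _⊛_
  -- The product splits a as a₀ + q · tail, which makes each law an induction on the coefficient
  -- index, without nested sums.
  _⊕_ _⊛_ : Series → Series → Series
  (a ⊕ b) n = a n ℤ.+ b n
  (a ⊛ b) zero    = a 0 ℤ.* b 0
  (a ⊛ b) (suc n) = a 0 ℤ.* b (suc n) ℤ.+ ((a ∘ suc) ⊛ b) n

  ⊖_ : Series → Series
  (⊖ a) n = ℤ.- a n

  zeros ones variable-q : Series
  zeros _ = + 0
  ones zero    = + 1
  ones (suc _) = + 0
  variable-q zero    = + 0
  variable-q (suc n) = ones n

  ⊛-cong-≤ : ∀ {a b c d} n → (∀ i → i ≤ n → a i ≡ b i) → (∀ i → i ≤ n → c i ≡ d i) → (a ⊛ c) n ≡ (b ⊛ d) n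
  ⊛-cong-≤ zero    a≡b c≡d = cong₂ ℤ._*_ (a≡b 0 z≤n) (c≡d 0 z≤n)
  ⊛-cong-≤ (suc n) a≡b c≡d = cong₂ ℤ._+_ (cong₂ ℤ._*_ (a≡b 0 z≤n) (c≡d (suc n) ℕ.≤-refl))
    (⊛-cong-≤ n (λ i i≤n → a≡b (suc i) (s≤s i≤n)) (λ i i≤n → c≡d i (ℕ.m≤n⇒m≤1+n i≤n)))

  ⊛-zeroˡ : ∀ a → zeros ⊛ a ≗ zeros
  ⊛-zeroˡ a zero    = refl
  ⊛-zeroˡ a (suc n) = trans (ℤ.+-identityˡ ((zeros ⊛ a) n)) (⊛-zeroˡ a n)

  ⊛-identityˡ : ∀ a → ones ⊛ a ≗ a
  ⊛-identityˡ a zero    = ℤ.*-identityˡ (a 0)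
  ⊛-identityˡ a (suc n) = trans (cong₂ ℤ._+_ (ℤ.*-identityˡ (a (suc n))) (⊛-zeroˡ a n)) (ℤ.+-identityʳ (a (suc n)))

  ⊛-distribʳ : ∀ c a b → (a ⊕ b) ⊛ c ≗ a ⊛ c ⊕ b ⊛ c
  ⊛-distribʳ c a b zero    = ℤ.*-distribʳ-+ (c 0) (a 0) (b 0)
  ⊛-distribʳ c a b (suc n) = begin
    (a 0 ℤ.+ b 0) ℤ.* c (suc n) ℤ.+ ((a ∘ suc ⊕ b ∘ suc) ⊛ c) n
      ≡⟨ cong (ℤ._+_ ((a 0 ℤ.+ b 0) ℤ.* c (suc n))) (⊛-distribʳ c (a ∘ suc) (b ∘ suc) n) ⟩
    (a 0 ℤ.+ b 0) ℤ.* c (suc n) ℤ.+ (((a ∘ suc) ⊛ c) n ℤ.+ ((b ∘ suc) ⊛ c) n)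
      ≡⟨ solve 5 (λ a b c x y → (a :+ b) :* c :+ (x :+ y) := (a :* c :+ x) :+ (b :* c :+ y)) refl (a 0) (b 0) (c (suc n)) (((a ∘ suc) ⊛ c) n) (((b ∘ suc) ⊛ c) n) ⟩
    _ ∎

  -- The mirror image of the defining recursion; commutativity follows from the two together.
  ⊛-sucʳ : ∀ a b n → (a ⊛ b) (suc n) ≡ b 0 ℤ.* a (suc n) ℤ.+ (a ⊛ (b ∘ suc)) n
  ⊛-sucʳ a b zero = solve 4 (λ a₀ b₁ a₁ b₀ → a₀ :* b₁ :+ a₁ :* b₀ := b₀ :* a₁ :+ a₀ :* b₁) refl (a 0) (b 1) (a 1) (b 0)
  ⊛-sucʳ a b (suc n) = begin
    a 0 ℤ.* b (2 ℕ.+ n) ℤ.+ ((a ∘ suc) ⊛ b) (suc n)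
      ≡⟨ cong (ℤ._+_ (a 0 ℤ.* b (2 ℕ.+ n))) (⊛-sucʳ (a ∘ suc) b n) ⟩
    a 0 ℤ.* b (2 ℕ.+ n) ℤ.+ (b 0 ℤ.* a (2 ℕ.+ n) ℤ.+ ((a ∘ suc) ⊛ (b ∘ suc)) n)
      ≡⟨ solve 3 (λ x y z → x :+ (y :+ z) := y :+ (x :+ z)) refl (a 0 ℤ.* b (2 ℕ.+ n)) (b 0 ℤ.* a (2 ℕ.+ n)) (((a ∘ suc) ⊛ (b ∘ suc)) n) ⟩
    _ ∎

  ⊛-comm : ∀ a b → a ⊛ b ≗ b ⊛ a
  ⊛-comm a b zero    = ℤ.*-comm (a 0) (b 0)
  ⊛-comm a b (suc n) = trans (cong (ℤ._+_ (a 0 ℤ.* b (suc n))) (⊛-comm (a ∘ suc) b n)) (sym (⊛-sucʳ b a n))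

  scale : ℤ → Series → Series
  scale x a n = x ℤ.* a n

  ⊛-scaleˡ : ∀ x a b → scale x a ⊛ b ≗ scale x (a ⊛ b)
  ⊛-scaleˡ x a b zero    = ℤ.*-assoc x (a 0) (b 0)
  ⊛-scaleˡ x a b (suc n) = trans (cong (ℤ._+_ (x ℤ.* a 0 ℤ.* b (suc n))) (⊛-scaleˡ x (a ∘ suc) b n))
    (solve 4 (λ x a b y → x :* a :* b :+ x :* y := x :* (a :* b :+ y)) refl x (a 0) (b (suc n)) (((a ∘ suc) ⊛ b) n))

  ⊛-assoc : ∀ a b c → (a ⊛ b) ⊛ c ≗ a ⊛ (b ⊛ c)
  ⊛-assoc a b c zero    = ℤ.*-assoc (a 0) (b 0) (c 0)
  ⊛-assoc a b c (suc n) = begin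
    a 0 ℤ.* b 0 ℤ.* c (suc n) ℤ.+ ((scale (a 0) (b ∘ suc) ⊕ (a ∘ suc) ⊛ b) ⊛ c) n
      ≡⟨ cong (ℤ._+_ (a 0 ℤ.* b 0 ℤ.* c (suc n))) (⊛-distribʳ c (scale (a 0) (b ∘ suc)) ((a ∘ suc) ⊛ b) n) ⟩
    a 0 ℤ.* b 0 ℤ.* c (suc n) ℤ.+ ((scale (a 0) (b ∘ suc) ⊛ c) n ℤ.+ (((a ∘ suc) ⊛ b) ⊛ c) n)
      ≡⟨ cong (ℤ._+_ (a 0 ℤ.* b 0 ℤ.* c (suc n))) (cong₂ ℤ._+_ (⊛-scaleˡ (a 0) (b ∘ suc) c n) (⊛-assoc (a ∘ suc) b c n)) ⟩
    a 0 ℤ.* b 0 ℤ.* c (suc n) ℤ.+ (a 0 ℤ.* ((b ∘ suc) ⊛ c) n ℤ.+ ((a ∘ suc) ⊛ (b ⊛ c)) n)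
      ≡⟨ solve 5 (λ a b c x y → a :* b :* c :+ (a :* x :+ y) := a :* (b :* c :+ x) :+ y) refl (a 0) (b 0) (c (suc n)) (((b ∘ suc) ⊛ c) n) (((a ∘ suc) ⊛ (b ⊛ c)) n) ⟩
    _ ∎

  -- Only the equality is truncated. It is compatible with `⊛` because coefficient n of a product
  -- involves no coefficient above n.
  truncated : ℕ → CommutativeRing 0ℓ 0ℓ
  truncated N = record
    { Carrier = Series
    ; _≈_ = λ a b → ∀ n → n < N → a n ≡ b n
    ; _+_ = _⊕_ ; _*_ = _⊛_ ; -_ = ⊖_ ; 0# = zeros ; 1# = ones
    ; isCommutativeRing = record
      { isRing = record
        { +-isAbelianGroup = record
          { isGroup = record
            { isMonoid = record
              { isSemigroup = record
                { isMagma = record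
                  { isEquivalence = record
                    { refl  = λ _ _ → refl
                    ; sym   = λ p n n<N → sym (p n n<N)
                    ; trans = λ p r n n<N → trans (p n n<N) (r n n<N) }
                  ; ∙-cong = λ p r n n<N → cong₂ ℤ._+_ (p n n<N) (r n n<N) }
                ; assoc = λ a b c n _ → ℤ.+-assoc (a n) (b n) (c n) }
              ; identity = (λ a n _ → ℤ.+-identityˡ (a n)) , (λ a n _ → ℤ.+-identityʳ (a n)) }
            ; inverse = (λ a n _ → ℤ.+-inverseˡ (a n)) , (λ a n _ → ℤ.+-inverseʳ (a n))
            ; ⁻¹-cong = λ p n n<N → cong ℤ.-_ (p n n<N) }
          ; comm = λ a b n _ → ℤ.+-comm (a n) (b n) }
        ; *-cong = λ p r n n<N → ⊛-cong-≤ n (λ i i≤n → p i (ℕ.≤-<-trans i≤n n<N)) (λ i i≤n → r i (ℕ.≤-<-trans i≤n n<N))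
        ; *-assoc = λ a b c n _ → ⊛-assoc a b c n
        ; *-identity = (λ a n _ → ⊛-identityˡ a n) , (λ a n _ → trans (⊛-comm a ones n) (⊛-identityˡ a n))
        ; distrib = (λ a b c n _ → trans (⊛-comm a (b ⊕ c) n) (trans (⊛-distribʳ a b c n)
                      (cong₂ ℤ._+_ (⊛-comm b a n) (⊛-comm c a n))))
                  , (λ a b c n _ → ⊛-distribʳ a b c n) }
      ; *-comm = λ a b n _ → ⊛-comm a b n } }

  module _ (N : ℕ) where
    open Algebra.Properties.Semiring.Exp (CommutativeRing.semiring (truncated N)) using (_^_)

    coefficient-pow : ∀ e n → (variable-q ^ e) n ≡ (if e ≡ᵇ n then + 1 else + 0)
    coefficient-pow zero    zero    = refl
    coefficient-pow zero    (suc n) = refl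
    coefficient-pow (suc e) zero    = refl
    coefficient-pow (suc e) (suc n) = trans (ℤ.+-identityˡ ((ones ⊛ (variable-q ^ e)) n)) (trans (⊛-identityˡ (variable-q ^ e) n) (coefficient-pow e n))

    variable-q-nilpotent : ∀ n → n < N → (variable-q ^ N) n ≡ + 0
    variable-q-nilpotent n n<N = trans (coefficient-pow N n) (≢-case N n n<N)
      where
      ≢-case : ∀ N n → n < N → (if N ≡ᵇ n then + 1 else + 0) ≡ + 0
      ≢-case (suc N) zero    _         = refl
      ≢-case (suc N) (suc n) (s≤s n<N) = ≢-case N n n<N

-- Overpartitions as multiplicity vectors

block : ℕ → Cell → List Part
block s (false , d) = replicate d (s , false)
block s (true  , d) = (s , true) ∷ replicate d (s , false)

-- Larger sizes go to the front, since `Precedes` orders sizes downwards.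
decode : ℕ → List Cell → List Part
decode s []      = []
decode s (c ∷ v) = decode (suc s) v ++ block s c

f-++ : ∀ t l l′ → f t (l ++ l′) ≡ f t l + f t l′
f-++ t []            l′ = refl
f-++ t ((s , b) ∷ l) l′ = trans (cong (ℕ._+_ (if (s ≡ᵇ t) ∧ not b then 1 else 0)) (f-++ t l l′)) (sym (ℕ.+-assoc _ (f t l) (f t l′)))

fbar-++ : ∀ t l l′ → fbar t (l ++ l′) ≡ fbar t l + fbar t l′
fbar-++ t []            l′ = refl
fbar-++ t ((s , b) ∷ l) l′ = trans (cong (ℕ._+_ (if (s ≡ᵇ t) ∧ b then 1 else 0)) (fbar-++ t l l′)) (sym (ℕ.+-assoc _ (fbar t l) (fbar t l′)))

≡ᵇ-refl : ∀ s → (s ≡ᵇ s) ≡ true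
≡ᵇ-refl s = dec-true (s ℕ.≟ s) refl

f-replicate-≡ : ∀ s d → f s (replicate d (s , false)) ≡ d
f-replicate-≡ s zero    = refl
f-replicate-≡ s (suc d) rewrite ≡ᵇ-refl s = cong suc (f-replicate-≡ s d)

f-replicate-≢ : ∀ {s t} → s ≢ t → ∀ d → f t (replicate d (s , false)) ≡ 0
f-replicate-≢ s≢t zero = refl
f-replicate-≢ {s} {t} s≢t (suc d) rewrite dec-false (s ℕ.≟ t) s≢t = f-replicate-≢ s≢t d

fbar-replicate : ∀ t s d → fbar t (replicate d (s , false)) ≡ 0
fbar-replicate t s zero = refl
fbar-replicate t s (suc d) rewrite Bool.∧-zeroʳ (s ≡ᵇ t) = fbar-replicate t s d

f-block-≡ : ∀ s b d → f s (block s (b , d)) ≡ d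
f-block-≡ s false d = f-replicate-≡ s d
f-block-≡ s true  d rewrite ≡ᵇ-refl s = f-replicate-≡ s d

f-block-≢ : ∀ {s t} → s ≢ t → ∀ b d → f t (block s (b , d)) ≡ 0
f-block-≢ s≢t false d = f-replicate-≢ s≢t d
f-block-≢ {s} {t} s≢t true d rewrite dec-false (s ℕ.≟ t) s≢t = f-replicate-≢ s≢t d

fbar-block-≡ : ∀ s b d → fbar s (block s (b , d)) ≡ bit b
fbar-block-≡ s false d = fbar-replicate s s d
fbar-block-≡ s true  d rewrite ≡ᵇ-refl s = cong suc (fbar-replicate s s d)

fbar-block-≢ : ∀ {s t} → s ≢ t → ∀ b d → fbar t (block s (b , d)) ≡ 0
fbar-block-≢ {s} {t} s≢t false d = fbar-replicate t s d
fbar-block-≢ {s} {t} s≢t true d rewrite dec-false (s ℕ.≟ t) s≢t = fbar-replicate t s d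

f-decode-< : ∀ s v {t} → t < s → f t (decode s v) ≡ 0
f-decode-< s []            t<s = refl
f-decode-< s ((b , d) ∷ v) {t} t<s rewrite f-++ t (decode (suc s) v) (block s (b , d)) =
  cong₂ _+_ (f-decode-< (suc s) v (ℕ.m<n⇒m<1+n t<s)) (f-block-≢ (ℕ.>⇒≢ t<s) b d)

fbar-decode-< : ∀ s v {t} → t < s → fbar t (decode s v) ≡ 0
fbar-decode-< s []            t<s = refl
fbar-decode-< s ((b , d) ∷ v) {t} t<s rewrite fbar-++ t (decode (suc s) v) (block s (b , d)) =
  cong₂ _+_ (fbar-decode-< (suc s) v (ℕ.m<n⇒m<1+n t<s)) (fbar-block-≢ (ℕ.>⇒≢ t<s) b d)

plainAt overAt : List Cell → ℕ → ℕ
plainAt []            j       = 0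
plainAt ((b , d) ∷ v) zero    = d
plainAt (c ∷ v)       (suc j) = plainAt v j
overAt  []            j       = 0
overAt  ((b , d) ∷ v) zero    = bit b
overAt  (c ∷ v)       (suc j) = overAt v j

f-decode : ∀ s v j → f (j + s) (decode s v) ≡ plainAt v j
f-decode s []            j    = refl
f-decode s ((b , d) ∷ v) zero rewrite f-++ s (decode (suc s) v) (block s (b , d)) =
  cong₂ _+_ (f-decode-< (suc s) v ℕ.≤-refl) (f-block-≡ s b d)
f-decode s ((b , d) ∷ v) (suc j) rewrite f-++ (suc j + s) (decode (suc s) v) (block s (b , d)) =
  trans (cong₂ _+_ (trans (cong (λ t → f t (decode (suc s) v)) (sym (ℕ.+-suc j s))) (f-decode (suc s) v j))
                   (f-block-≢ (ℕ.<⇒≢ (s≤s (ℕ.m≤n+m s j))) b d))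
        (ℕ.+-identityʳ _)

fbar-decode : ∀ s v j → fbar (j + s) (decode s v) ≡ overAt v j
fbar-decode s []            j    = refl
fbar-decode s ((b , d) ∷ v) zero rewrite fbar-++ s (decode (suc s) v) (block s (b , d)) =
  cong₂ _+_ (fbar-decode-< (suc s) v ℕ.≤-refl) (fbar-block-≡ s b d)
fbar-decode s ((b , d) ∷ v) (suc j) rewrite fbar-++ (suc j + s) (decode (suc s) v) (block s (b , d)) =
  trans (cong₂ _+_ (trans (cong (λ t → fbar t (decode (suc s) v)) (sym (ℕ.+-suc j s))) (fbar-decode (suc s) v j))
                   (fbar-block-≢ (ℕ.<⇒≢ (s≤s (ℕ.m≤n+m s j))) b d))
        (ℕ.+-identityʳ _)

bit-injective : ∀ {a b} → bit a ≡ bit b → a ≡ b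
bit-injective {false} {false} _ = refl
bit-injective {true}  {true}  _ = refl

-- The list determines all multiplicities. Equal lengths are assumed because trailing empty cells
-- leave no trace in it.
decode-injective : ∀ s v v′ → length v ≡ length v′ → decode s v ≡ decode s v′ → v ≡ v′
decode-injective s v v′ len eq = extensional v v′ len
  (λ j → trans (sym (f-decode s v j)) (trans (cong (f (j + s)) eq) (f-decode s v′ j)))
  (λ j → trans (sym (fbar-decode s v j)) (trans (cong (fbar (j + s)) eq) (fbar-decode s v′ j)))
  where
  extensional : ∀ v v′ → length v ≡ length v′ → (∀ j → plainAt v j ≡ plainAt v′ j) → (∀ j → overAt v j ≡ overAt v′ j) → v ≡ v′
  extensional []      []        _   _  _  = refl
  extensional (_ ∷ v) (_ ∷ v′) len d≡ b≡ =
    cong₂ _∷_ (cong₂ _,_ (bit-injective (b≡ 0)) (d≡ 0)) (extensional v v′ (ℕ.suc-injective len) (d≡ ∘ suc) (b≡ ∘ suc))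

sum-replicate : ∀ s d → sum (map size (replicate d (s , false))) ≡ d * s
sum-replicate s zero    = refl
sum-replicate s (suc d) = cong (ℕ._+_ s) (sum-replicate s d)

sum-block : ∀ s b d → sum (map size (block s (b , d))) ≡ (bit b + d) * s
sum-block s false d = sum-replicate s d
sum-block s true  d = cong (ℕ._+_ s) (sum-replicate s d)

sum-decode : ∀ s v → sum (map size (decode s v)) ≡ weight s v
sum-decode s []            = refl
sum-decode s ((b , d) ∷ v) = begin
  sum (map size (decode (suc s) v ++ block s (b , d)))
    ≡⟨ cong sum (List.map-++ size (decode (suc s) v) (block s (b , d))) ⟩
  sum (map size (decode (suc s) v) ++ map size (block s (b , d)))
    ≡⟨ sum-++ (map size (decode (suc s) v)) (map size (block s (b , d))) ⟩
  sum (map size (decode (suc s) v)) + sum (map size (block s (b , d)))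
    ≡⟨ cong₂ _+_ (sum-decode (suc s) v) (sum-block s b d) ⟩
  weight (suc s) v + (bit b + d) * s
    ≡⟨ ℕ.+-comm (weight (suc s) v) _ ⟩
  (bit b + d) * s + weight (suc s) v ∎
  where open ≡-Reasoning

block-size : ∀ s c → All (λ p → size p ≡ s) (block s c)
block-size s (false , d) = All.replicate⁺ d refl
block-size s (true  , d) = refl ∷ All.replicate⁺ d refl

decode-size : ∀ s v → All (λ p → s ≤ size p) (decode s v)
decode-size s []      = []
decode-size s (c ∷ v) = All.++⁺ (All.map (ℕ.≤-trans (ℕ.n≤1+n s)) (decode-size (suc s) v))
                                (All.map (λ eq → ℕ.≤-reflexive (sym eq)) (block-size s c))

replicate-linked : ∀ s d → Linked Precedes (replicate d (s , false))
replicate-linked s zero          = []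
replicate-linked s (suc zero)    = [-]
replicate-linked s (suc (suc d)) = inj₂ (refl , refl) ∷ replicate-linked s (suc d)

block-linked : ∀ s c → Linked Precedes (block s c)
block-linked s (false , d)     = replicate-linked s d
block-linked s (true  , zero)  = [-]
block-linked s (true  , suc d) = inj₂ (refl , refl) ∷ replicate-linked s (suc d)

++-linked : ∀ {s} l m → Linked Precedes l → All (λ p → s < size p) l → Linked Precedes m → All (λ p → size p ≡ s) m →
  Linked Precedes (l ++ m)
++-linked []          m       _             _             lm _            = lm
++-linked (x ∷ [])    []      _             _             _  _            = [-]
++-linked (x ∷ [])    (y ∷ m) _             (s<x ∷ _)     lm (refl ∷ _)   = inj₁ s<x ∷ lm
++-linked (x ∷ y ∷ l) m       (x≻y ∷ ll)    (_ ∷ s<)      lm sizes        = x≻y ∷ ++-linked (y ∷ l) m ll s< lm sizes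

decode-linked : ∀ s v → Linked Precedes (decode s v)
decode-linked s []      = []
decode-linked s (c ∷ v) = ++-linked (decode (suc s) v) (block s c) (decode-linked (suc s) v) (decode-size (suc s) v) (block-linked s c) (block-size s c)

-- Sizes weakly decrease along a linked list, so once a part of the minimal
-- size s occurs only parts of size s can follow.
split-smallest : ∀ s l → Linked Precedes l → All (λ p → s ≤ size p) l →
  ∃ λ l′ → ∃ λ c → l ≡ l′ ++ block s c × Linked Precedes l′ × All (λ p → s < size p) l′
split-smallest s [] _ _ = [] , (false , 0) , refl , [] , []
split-smallest s ((t , b) ∷ l) linked (s≤t ∷ s≤)
  with split-smallest s l (Linked.tail linked) s≤ | s ℕ.≟ t
... | l′ , c , refl , linked′ , s<′ | no s≢t = (t , b) ∷ l′ , c , refl , cons l′ linked linked′ , ℕ.≤∧≢⇒< s≤t s≢t ∷ s<′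
  where
  cons : ∀ l′ → Linked Precedes ((t , b) ∷ l′ ++ block s c) → Linked Precedes l′ → Linked Precedes ((t , b) ∷ l′)
  cons []      _           _  = [-]
  cons (x ∷ l) (p≻x ∷ _) ll = p≻x ∷ ll
... | x ∷ l′ , c , refl , _ , s<x ∷ _ | yes refl = contradiction (Linked.head linked) not-before
  where
  not-before : ¬ Precedes (s , b) x
  not-before (inj₁ x<s)       = ℕ.<-asym x<s s<x
  not-before (inj₂ (x≡s , _)) = ℕ.<⇒≢ s<x (sym x≡s)
... | [] , (true , d) , refl , _ , _ | yes refl = contradiction (Linked.head linked) not-before
  where
  not-before : ¬ Precedes (s , b) (s , true)
  not-before (inj₁ s<s) = ℕ.<-irrefl refl s<s
  not-before (inj₂ (_ , ()))
... | [] , (false , d) , refl , _ , _ | yes refl = [] , merge b , merged b , [] , []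
  where
  merge : Bool → Cell
  merge true  = true , d
  merge false = false , suc d
  merged : ∀ b → (s , b) ∷ block s (false , d) ≡ block s (merge b)
  merged true  = refl
  merged false = refl

decode-surjective : ∀ M s l → Linked Precedes l → All (λ p → s ≤ size p) l → All (λ p → size p < M + s) l →
  ∃ λ v → length v ≡ M × decode s v ≡ l
decode-surjective zero s [] _ _ _ = [] , refl , refl
decode-surjective zero s (p ∷ l) _ (s≤p ∷ _) (p<s ∷ _) = contradiction s≤p (ℕ.<⇒≱ p<s)
decode-surjective (suc M) s l linked s≤ <s+M with split-smallest s l linked s≤
... | l′ , c , refl , linked′ , s<
  with v , len , eq ← decode-surjective M (suc s) l′ linked′ s< (subst (λ t → All (λ p → size p < t) l′) (sym (ℕ.+-suc M s)) (All.++⁻ˡ l′ <s+M))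
  = c ∷ v , cong suc len , cong (_++ block s c) eq

vectors-complete : ∀ D s v → 1 ≤ s → weight s v < D → v ∈ vectors D (length v)
vectors-complete D s [] _ _ = here refl
vectors-complete D s@(suc _) ((b , d) ∷ v) 1≤s w<D = ∈-cartesianProductWith⁺ _∷_ (∈-cartesianProduct⁺ (b∈ b) (∈-upTo⁺ d<D))
  (vectors-complete D (suc s) v (s≤s z≤n) (ℕ.≤-<-trans (ℕ.m≤n+m (weight (suc s) v) ((bit b + d) * s)) w<D))
  where
  b∈ : ∀ b → b ∈ false ∷ true ∷ []
  b∈ false = here refl
  b∈ true  = there (here refl)
  d<D : d < D
  d<D = ℕ.≤-<-trans (ℕ.≤-trans (ℕ.m≤n+m d (bit b)) (ℕ.≤-trans (ℕ.m≤m*n (bit b + d) s) (ℕ.m≤m+n _ (weight (suc s) v)))) w<D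

vectors-length : ∀ D M {v} → v ∈ vectors D M → length v ≡ M
vectors-length D zero    (here refl) = refl
vectors-length D (suc M) v∈ with _ , v′ , _ , v′∈ , refl ← ∈-cartesianProductWith⁻ _∷_ (cells D) (vectors D M) v∈ = cong suc (vectors-length D M v′∈)

-- Conditions (1)-(3) in terms of multiplicity vectors.

open +-*-Solver using (solve; _:+_; _:*_; _:=_; con)

-- Position j holds the size j + 1. The middle clause at t is condition (2) at t + 1; the instance
-- of (2) at 0 concerns only the sizes 1 and 2 and is recovered from (1) by way of i ≤ k.
LocalOCond : ℕ → ℕ → List Cell → Set
LocalOCond k i v =
  (overAt v 0 + plainAt v 1 + 1 ≤ i)
  × (∀ t → overAt v (t * 2 + 1) + plainAt v (t * 2 + 1) + overAt v (t * 2 + 2) + plainAt v (t * 2 + 3) + 1 ≤ k)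
  × (∀ t → 1 ≤ plainAt v (t * 2) → plainAt v (t * 2 + 1) + 2 ≤ k)

module _ {k : ℕ} (1≤k : 1 ≤ k) where

  private
    +1⁺ : ∀ {m n} → m < n → m + 1 ≤ n
    +1⁺ {m} {n} = subst (_≤ n) (ℕ.+-comm 1 m)

    +1⁻ : ∀ {m n} → m + 1 ≤ n → m < n
    +1⁻ {m} {n} = subst (_≤ n) (ℕ.+-comm m 1)

    regroup : ∀ b d x y → (b + d) + (x + y + 1) ≡ b + d + x + y + 1
    regroup = solve 4 (λ b d x y → (b :+ d) :+ (x :+ y :+ con 1) := b :+ d :+ x :+ y :+ con 1) refl

    ≤∸⁻ : ∀ b d x y → x + y + 1 ≤ k ∸ (b + d) → b + d + x + y + 1 ≤ k
    ≤∸⁻ b d x y le = subst₂ _≤_ (regroup b d x y) (ℕ.m+[n∸m]≡n b+d≤k) (ℕ.+-monoʳ-≤ (b + d) le)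
      where
      -- The `+ 1` on the left forces `k ∸ (b + d)` to be positive, so the subtraction was not
      -- truncated.
      b+d≤k : b + d ≤ k
      b+d≤k = ℕ.<⇒≤ (ℕ.m∸n≢0⇒n<m (ℕ.n>0⇒n≢0 (ℕ.≤-trans (ℕ.m≤n+m 1 (x + y)) le)))

    ≤∸⁺ : ∀ b d x y → b + d + x + y + 1 ≤ k → x + y + 1 ≤ k ∸ (b + d)
    ≤∸⁺ b d x y le = subst (_≤ k ∸ (b + d)) (ℕ.m+n∸m≡n (b + d) (x + y + 1))
      (ℕ.∸-monoˡ-≤ (b + d) (subst (_≤ k) (sym (regroup b d x y)) le))

    +2≤⁺ : ∀ {d} → suc d < k → d + 2 ≤ k
    +2≤⁺ {d} = subst (_≤ k) (ℕ.+-comm 2 d)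

    +2≤⁻ : ∀ {d} → d + 2 ≤ k → suc d < k
    +2≤⁻ {d} = subst (_≤ k) (ℕ.+-comm d 2)

  admissible⇒local : ∀ r i v → length v ≡ r * 2 → T (admissible k i v) → LocalOCond k i v
  admissible⇒local zero i [] _ adm = ℕ.<ᵇ⇒< 0 i adm , (λ _ → 1≤k) , (λ _ ())
  admissible⇒local (suc r) i ((b₁ , d₁) ∷ (b₂ , d₂) ∷ v) len adm
    with ok₁ , adm′ ← Equivalence.to Bool.T-∧ adm
    with ok₂ , ok₃ ← Equivalence.to (Bool.T-∧ {(d₁ ≡ᵇ 0) ∨ (suc d₂ <ᵇ k)}) adm′
    with c₁ , c₂ , c₃ ← admissible⇒local r (k ∸ (bit b₂ + d₂)) v (ℕ.suc-injective (ℕ.suc-injective len)) ok₃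
    = +1⁺ (ℕ.<ᵇ⇒< (bit b₁ + d₂) i ok₁)
    , (λ { zero → ≤∸⁻ (bit b₂) d₂ (overAt v 0) (plainAt v 1) c₁ ; (suc t) → c₂ t })
    , (λ { zero → third d₁ ok₂ ; (suc t) → c₃ t })
    where
    third : ∀ d₁ → T ((d₁ ≡ᵇ 0) ∨ (suc d₂ <ᵇ k)) → 1 ≤ d₁ → d₂ + 2 ≤ k
    third (suc d₁) ok _ = +2≤⁺ (ℕ.<ᵇ⇒< (suc d₂) k ok)

  local⇒admissible : ∀ r i v → length v ≡ r * 2 → LocalOCond k i v → T (admissible k i v)
  local⇒admissible zero i [] _ (c₁ , _) = ℕ.<⇒<ᵇ c₁
  local⇒admissible (suc r) i ((b₁ , d₁) ∷ (b₂ , d₂) ∷ v) len (c₁ , c₂ , c₃) =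
    Equivalence.from Bool.T-∧ (ℕ.<⇒<ᵇ (+1⁻ c₁) , Equivalence.from (Bool.T-∧ {(d₁ ≡ᵇ 0) ∨ (suc d₂ <ᵇ k)}) (third d₁ (c₃ 0) ,
      local⇒admissible r (k ∸ (bit b₂ + d₂)) v (ℕ.suc-injective (ℕ.suc-injective len))
        (≤∸⁺ (bit b₂) d₂ (overAt v 0) (plainAt v 1) (c₂ 0) , c₂ ∘ suc , c₃ ∘ suc)))
    where
    third : ∀ d₁ → (1 ≤ d₁ → d₂ + 2 ≤ k) → T ((d₁ ≡ᵇ 0) ∨ (suc d₂ <ᵇ k))
    third zero     _ = tt
    third (suc d₁) c = ℕ.<⇒<ᵇ (+2≤⁻ (c (s≤s z≤n)))

module _ {k i : ℕ} (i≤k : i ≤ k) (v : List Cell) where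

  private
    f≡ : ∀ {a} j → a ≡ j + 1 → f a (decode 1 v) ≡ plainAt v j
    f≡ j refl = f-decode 1 v j

    fbar≡ : ∀ {a} j → a ≡ j + 1 → fbar a (decode 1 v) ≡ overAt v j
    fbar≡ j refl = fbar-decode 1 v j

    condition₂ : ∀ t → fbar (2 * suc t) (decode 1 v) + f (2 * suc t) (decode 1 v) + fbar (2 * suc t + 1) (decode 1 v) + f (2 * suc t + 2) (decode 1 v) + 1
      ≡ overAt v (t * 2 + 1) + plainAt v (t * 2 + 1) + overAt v (t * 2 + 2) + plainAt v (t * 2 + 3) + 1
    condition₂ t = cong (_+ 1) (cong₂ _+_ (cong₂ _+_ (cong₂ _+_ (fbar≡ (t * 2 + 1) e₀) (f≡ (t * 2 + 1) e₀))
      (fbar≡ (t * 2 + 2) (solve 1 (λ t → con 2 :* (con 1 :+ t) :+ con 1 := t :* con 2 :+ con 2 :+ con 1) refl t)))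
      (f≡ (t * 2 + 3) (solve 1 (λ t → con 2 :* (con 1 :+ t) :+ con 2 := t :* con 2 :+ con 3 :+ con 1) refl t)))
      where
      e₀ : 2 * suc t ≡ t * 2 + 1 + 1
      e₀ = solve 1 (λ t → con 2 :* (con 1 :+ t) := t :* con 2 :+ con 1 :+ con 1) refl t

    condition₁ : fbar 1 (decode 1 v) + f 2 (decode 1 v) + 1 ≡ overAt v 0 + plainAt v 1 + 1
    condition₁ = cong (_+ 1) (cong₂ _+_ (fbar≡ 0 refl) (f≡ 1 refl))

    f-odd : ∀ t → f (2 * t + 1) (decode 1 v) ≡ plainAt v (t * 2)
    f-odd t = f≡ (t * 2) (cong (_+ 1) (ℕ.*-comm 2 t))

    f-even : ∀ t → f (2 * t + 2) (decode 1 v) ≡ plainAt v (t * 2 + 1)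
    f-even t = f≡ (t * 2 + 1) (solve 1 (λ t → con 2 :* t :+ con 2 := t :* con 2 :+ con 1 :+ con 1) refl t)

  local⇒OCond : LocalOCond k i v → OCond k i (decode 1 v)
  local⇒OCond (c₁ , c₂ , c₃) = subst (_≤ i) (sym condition₁) c₁
    -- At t = 0 the counts of size 0 vanish, because `decode 1` starts at size 1, and the remaining
    -- bound is (1).
    , (λ { zero → subst (_≤ k) (sym (trans (cong (λ a → a + fbar 1 (decode 1 v) + f 2 (decode 1 v) + 1)
             (cong₂ _+_ (fbar-decode-< 1 v (s≤s z≤n)) (f-decode-< 1 v (s≤s z≤n)))) condition₁)) (ℕ.≤-trans c₁ i≤k)
         ; (suc t) → subst (_≤ k) (sym (condition₂ t)) (c₂ t) })
    , (λ t 1≤ → subst (λ x → x + 2 ≤ k) (sym (f-even t)) (c₃ t (subst (1 ≤_) (f-odd t) 1≤)))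

  OCond⇒local : OCond k i (decode 1 v) → LocalOCond k i v
  OCond⇒local (c₁ , c₂ , c₃) = subst (_≤ i) condition₁ c₁
    , (λ t → subst (_≤ k) (condition₂ t) (c₂ (suc t)))
    , (λ t 1≤ → subst (λ x → x + 2 ≤ k) (f-even t) (c₃ t (subst (1 ≤_) (sym (f-odd t)) 1≤)))

admissible⇔OCond : ∀ {k i} r v → 1 ≤ k → i ≤ k → length v ≡ r * 2 → T (admissible k i v) ⇔ OCond k i (decode 1 v)
admissible⇔OCond r v 1≤k i≤k len = mk⇔
  (local⇒OCond i≤k v ∘ admissible⇒local 1≤k r _ v len)
  (local⇒admissible 1≤k r _ v len ∘ OCond⇒local i≤k v)

cellwise⇔All : ∀ ok (Q : Part → Set) → (∀ s b d → T (ok s b d) ⇔ All Q (block s (b , d))) →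
  ∀ s v → T (cellwise ok s v) ⇔ All Q (decode s v)
cellwise⇔All ok Q cell s v = mk⇔ (to s v) (from s v)
  where
  to : ∀ s v → T (cellwise ok s v) → All Q (decode s v)
  to s []            _ = []
  to s ((b , d) ∷ v) t with t₁ , t₂ ← Equivalence.to Bool.T-∧ t = All.++⁺ (to (suc s) v t₂) (Equivalence.to (cell s b d) t₁)
  from : ∀ s v → All Q (decode s v) → T (cellwise ok s v)
  from s []            _ = tt
  from s ((b , d) ∷ v) a = Equivalence.from Bool.T-∧ (Equivalence.from (cell s b d) (All.++⁻ʳ (decode (suc s) v) a) , from (suc s) v (All.++⁻ˡ (decode (suc s) v) a))

module _ {Good : ℕ → Set} (good? : ∀ s → Dec (Good s)) where

  good : ℕ → Bool
  good s = does (good? s)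

  private
    good⇒ : ∀ {s} → T (good s) → Good s
    good⇒ {s} t with yes g ← good? s = g

    ⇒good : ∀ {s} → Good s → T (good s)
    ⇒good {s} g = subst T (sym (dec-true (good? s) g)) tt

  okNonOverlined⇔All : ∀ s v → T (cellwise (okNonOverlined good) s v) ⇔ All (λ p → overlined p ≡ false → Good (size p)) (decode s v)
  okNonOverlined⇔All = cellwise⇔All _ _ (λ s b d → mk⇔ (to s b d) (from s b d))
    where
    Q : Part → Set
    Q p = overlined p ≡ false → Good (size p)
    to : ∀ s b d → T (okNonOverlined good s b d) → All Q (block s (b , d))
    to s true  zero    _ = (λ ()) ∷ []
    to s true  (suc d) t = (λ ()) ∷ All.replicate⁺ (suc d) (λ _ → good⇒ t)
    to s false zero    _ = []
    to s false (suc d) t = All.replicate⁺ (suc d) (λ _ → good⇒ t)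
    from : ∀ s b d → All Q (block s (b , d)) → T (okNonOverlined good s b d)
    from s b     zero    _           = tt
    from s true  (suc d) (_ ∷ g ∷ _) = ⇒good (g refl)
    from s false (suc d) (g ∷ _)     = ⇒good (g refl)

  okAll⇔All : ∀ s v → T (cellwise (okAll good) s v) ⇔ All (Good ∘ size) (decode s v)
  okAll⇔All = cellwise⇔All _ _ (λ s b d → mk⇔ (to s b d) (from s b d))
    where
    to : ∀ s b d → T (okAll good s b d) → All (Good ∘ size) (block s (b , d))
    to s true  d       t = good⇒ t ∷ All.replicate⁺ d (good⇒ t)
    to s false zero    _ = []
    to s false (suc d) t = All.replicate⁺ (suc d) (good⇒ t)
    from : ∀ s b d → All (Good ∘ size) (block s (b , d)) → T (okAll good s b d)
    from s true  d       (g ∷ _) = ⇒good g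
    from s false zero    _       = tt
    from s false (suc d) (g ∷ _) = ⇒good g

-- Congruence conditions as tests on residues within a block.

∣-block : ∀ m t x → 1 ≤ x → x < m + m → (m ∣ t * m + x) ⇔ (x ≡ m)
∣-block m t x 1≤x x<2m = mk⇔ (λ d → small (∣m+n∣m⇒∣n d (n∣m*n t))) (λ { refl → ∣m∣n⇒∣m+n (n∣m*n t) ∣-refl })
  where
  small : m ∣ x → x ≡ m
  small (divides zero          refl) = contradiction 1≤x λ ()
  small (divides (suc zero)    eq)   = trans eq (ℕ.+-identityʳ m)
  small (divides (suc (suc c)) refl) = contradiction x<2m (ℕ.≤⇒≯ (subst (m + m ≤_) (ℕ.+-assoc m m (c * m)) (ℕ.m≤m+n (m + m) (c * m))))

notMultiple? : ∀ k s → Dec (¬ ((2 * k ∸ 1) ∣ s))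
notMultiple? k s = ¬? ((2 * k ∸ 1) ∣? s)

2k∸1 : ∀ k′ → 2 * suc k′ ∸ 1 ≡ suc (2 * k′)
2k∸1 k′ = ℕ.+-suc k′ (k′ + 0)

notMultiple-residues : ∀ k′ t r → r < suc (2 * k′) →
  good (notMultiple? (suc k′)) (suc (t * suc (2 * k′) + r)) ≡ not (suc r ≡ᵇ suc (2 * k′))
notMultiple-residues k′ t r r<h rewrite 2k∸1 k′ | sym (ℕ.+-suc (t * suc (2 * k′)) r) =
  cong not (does-⇔ (∣-block (suc (2 * k′)) t (suc r) (s≤s z≤n) (ℕ.≤-<-trans r<h (ℕ.m<m+n _ (s≤s z≤n)))) (_ ∣? _) (suc r ℕ.≟ suc (2 * k′)))

Unrestricted : ℕ → ℕ → ℕ → Set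
Unrestricted k i s = ¬ (s ≡ + 0 [mod 4 * k ∸ 2 ])
  × ¬ (s ≡ + (2 * i ∸ 1) [mod 4 * k ∸ 2 ])
  × ¬ (s ≡ ℤ.- (+ (2 * i ∸ 1)) [mod 4 * k ∸ 2 ])

unrestricted? : ∀ k i s → Dec (Unrestricted k i s)
unrestricted? k i s = ¬? (_ ∣? _) ×-dec ¬? (_ ∣? _) ×-dec ¬? (_ ∣? _)

4k∸2 : ∀ k′ → 4 * suc k′ ∸ 2 ≡ 2 * suc (2 * k′)
4k∸2 k′ = cong (_∸ 2) (solve 1 (λ κ → con 4 :* (con 1 :+ κ) := con 2 :+ con 2 :* (con 1 :+ con 2 :* κ)) refl k′)

congruent-neg : ∀ m s b → (s ≡ ℤ.- (+ b) [mod m ]) ⇔ (m ∣ s + b)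
congruent-neg m s b = mk⇔ (subst (m ∣_) eq) (subst (m ∣_) (sym eq))
  where
  eq : ℤ.∣ + s ℤ.- ℤ.- (+ b) ∣ ≡ s + b
  eq = cong (λ z → ℤ.∣ + s ℤ.+ z ∣) (ℤ.neg-involutive (+ b))

-- Modulo a + b, subtracting b is adding a; this moves the condition from integers to naturals.
congruent-pos : ∀ m s a b → a + b ≡ m → (s ≡ + b [mod m ]) ⇔ (m ∣ s + a)
congruent-pos m s a b refl = mk⇔
  (λ d → ℤˢ.∣⇒∣ᵤ (subst (+ m ℤˢ.∣_) shift (ℤˢ.∣m∣n⇒∣m+n (ℤˢ.∣ᵤ⇒∣ {+ m} {+ s ℤ.- + b} d) ℤˢ.∣-refl)))
  (λ d → ℤˢ.∣⇒∣ᵤ (ℤˢ.∣m+n∣n⇒∣m {m = + s ℤ.- + b} (subst (+ m ℤˢ.∣_) (sym shift) (ℤˢ.∣ᵤ⇒∣ {+ m} {+ (s + a)} d)) ℤˢ.∣-refl))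
  where
  shift : (+ s ℤ.- + b) ℤ.+ + (a + b) ≡ + (s + a)
  shift = begin
    (+ s ℤ.- + b) ℤ.+ (+ a ℤ.+ + b)          ≡⟨ cong (λ z → (+ s ℤ.- + b) ℤ.+ z) (ℤ.+-comm (+ a) (+ b)) ⟩
    (+ s ℤ.- + b) ℤ.+ (+ b ℤ.+ + a)          ≡⟨ ℤ.+-assoc (+ s) (ℤ.- + b) (+ b ℤ.+ + a) ⟩
    + s ℤ.+ (ℤ.- + b ℤ.+ (+ b ℤ.+ + a))      ≡⟨ cong (λ z → + s ℤ.+ z) (ℤ.+-assoc (ℤ.- + b) (+ b) (+ a)) ⟨
    + s ℤ.+ ((ℤ.- + b ℤ.+ + b) ℤ.+ + a)      ≡⟨ cong (λ z → + s ℤ.+ (z ℤ.+ + a)) (ℤ.+-inverseˡ (+ b)) ⟩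
    + s ℤ.+ (+ 0 ℤ.+ + a)                    ≡⟨ cong (λ z → + s ℤ.+ z) (ℤ.+-identityˡ (+ a)) ⟩
    + s ℤ.+ + a                              ∎
    where open ≡-Reasoning

-- Residues are represented by 1, ..., m, so 0 appears as m = 4k-2, and -(2i-1) as m - (2i-1) = h +
-- 2j.
unrestricted-residues : ∀ k′ i j → suc i + j ≡ suc k′ → ∀ t r → r < 2 * suc (2 * k′) →
  good (unrestricted? (suc k′) (suc i)) (suc (t * (2 * suc (2 * k′)) + r))
  ≡ not ((suc r ≡ᵇ suc (2 * k′) + 2 * j) ∨ (suc r ≡ᵇ 2 * i + 1) ∨ (suc r ≡ᵇ 2 * suc (2 * k′)))
unrestricted-residues k′ i j 1+i+j≡k t r r<m = trans (de-morgan (does zero?) (does pos?) (does neg?))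
  (cong not (cong₂ _∨_ (does-⇔ neg⇔ neg? (suc r ℕ.≟ a)) (cong₂ _∨_ (does-⇔ pos⇔ pos? (suc r ℕ.≟ b)) (does-⇔ zero⇔ zero? (suc r ℕ.≟ m)))))
  where
  s m a b : ℕ
  s = suc (t * (2 * suc (2 * k′)) + r)
  m = 2 * suc (2 * k′)
  a = suc (2 * k′) + 2 * j
  b = 2 * i + 1

  de-morgan : ∀ x y z → not x ∧ not y ∧ not z ≡ not (z ∨ y ∨ x)
  de-morgan true  true  true  = refl
  de-morgan true  true  false = refl
  de-morgan true  false true  = refl
  de-morgan true  false false = refl
  de-morgan false true  true  = refl
  de-morgan false true  false = refl
  de-morgan false false true  = refl
  de-morgan false false false = refl

  zero? : Dec (s ≡ + 0 [mod 4 * suc k′ ∸ 2 ])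
  zero? = _ ∣? _
  pos? : Dec (s ≡ + (2 * suc i ∸ 1) [mod 4 * suc k′ ∸ 2 ])
  pos? = _ ∣? _
  neg? : Dec (s ≡ ℤ.- (+ (2 * suc i ∸ 1)) [mod 4 * suc k′ ∸ 2 ])
  neg? = _ ∣? _

  2i∸1 : 2 * suc i ∸ 1 ≡ b
  2i∸1 = trans (2k∸1 i) (ℕ.+-comm 1 (2 * i))

  a+b≡m : a + b ≡ m
  a+b≡m = lemma k′ (ℕ.suc-injective 1+i+j≡k)
    where
    lemma : ∀ κ → i + j ≡ κ → suc (2 * κ) + 2 * j + b ≡ 2 * suc (2 * κ)
    lemma _ refl = solve 2 (λ i j → (con 1 :+ con 2 :* (i :+ j)) :+ con 2 :* j :+ (con 2 :* i :+ con 1) := con 2 :* (con 1 :+ con 2 :* (i :+ j))) refl i j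

  s+ : ∀ x → s + x ≡ t * m + (suc r + x)
  s+ x = trans (cong (_+ x) (sym (ℕ.+-suc (t * m) r))) (ℕ.+-assoc (t * m) (suc r) x)

  residue : ∀ x y → x + y ≡ m → 1 ≤ y → (m ∣ s + x) ⇔ (suc r ≡ y)
  residue x y x+y≡m 1≤y = mk⇔
    (λ d → ℕ.+-cancelʳ-≡ x (suc r) y (trans (Equivalence.to block⇔ (subst (m ∣_) (s+ x) d)) (trans (sym x+y≡m) (ℕ.+-comm x y))))
    (λ { refl → subst (m ∣_) (sym (s+ x)) (Equivalence.from block⇔ (trans (ℕ.+-comm y x) x+y≡m)) })
    where
    block⇔ : (m ∣ t * m + (suc r + x)) ⇔ (suc r + x ≡ m)
    block⇔ = ∣-block m t (suc r + x) (s≤s z≤n) (ℕ.+-mono-≤-< r<m (subst (x <_) x+y≡m (ℕ.m<m+n x 1≤y)))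

  infixr 5 _⨾_
  _⨾_ : ∀ {A B C : Set} → A ⇔ B → B ⇔ C → A ⇔ C
  p ⨾ q = mk⇔ (Equivalence.to q ∘ Equivalence.to p) (Equivalence.from p ∘ Equivalence.from q)

  transport : ∀ {A : Set} (P : A → Set) {x y} → x ≡ y → P x ⇔ P y
  transport P refl = mk⇔ id id

  zero⇔ : (s ≡ + 0 [mod 4 * suc k′ ∸ 2 ]) ⇔ (suc r ≡ m)
  zero⇔ = transport (s ≡ + 0 [mod_]) (4k∸2 k′) ⨾ transport (m ∣_) (cong ℤ.∣_∣ (ℤ.+-identityʳ (+ s)) ) ⨾ transport (m ∣_) (sym (ℕ.+-identityʳ s)) ⨾ residue 0 m refl (s≤s z≤n)

  pos⇔ : (s ≡ + (2 * suc i ∸ 1) [mod 4 * suc k′ ∸ 2 ]) ⇔ (suc r ≡ b)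
  pos⇔ = transport (s ≡ + (2 * suc i ∸ 1) [mod_]) (4k∸2 k′) ⨾ transport (λ x → s ≡ + x [mod m ]) 2i∸1
    ⨾ congruent-pos m s a b a+b≡m ⨾ residue a b a+b≡m (ℕ.m≤n+m 1 (2 * i))

  neg⇔ : (s ≡ ℤ.- (+ (2 * suc i ∸ 1)) [mod 4 * suc k′ ∸ 2 ]) ⇔ (suc r ≡ a)
  neg⇔ = transport (s ≡ ℤ.- (+ (2 * suc i ∸ 1)) [mod_]) (4k∸2 k′) ⨾ transport (λ x → s ≡ ℤ.- (+ x) [mod m ]) 2i∸1
    ⨾ congruent-neg m s b ⨾ residue b a (trans (ℕ.+-comm b a) a+b≡m) (s≤s z≤n)

-- Counting

lookup-injective : ∀ {a} {A : Set a} {xs : List A} → Unique xs → ∀ i j → lookup xs i ≡ lookup xs j → i ≡ j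
lookup-injective (x∉ ∷ u) Fin.zero    Fin.zero    eq = refl
lookup-injective (x∉ ∷ u) Fin.zero    (Fin.suc j) eq = contradiction eq (All.lookup x∉ (∈-lookup j))
lookup-injective (x∉ ∷ u) (Fin.suc i) Fin.zero    eq = contradiction (sym eq) (All.lookup x∉ (∈-lookup i))
lookup-injective (x∉ ∷ u) (Fin.suc i) (Fin.suc j) eq = cong Fin.suc (lookup-injective u i j eq)

-- The proof inside a refinement is irrelevant, so the position in the list cannot be read off from
-- it; `recompute` rebuilds membership from a decision procedure.
enumeration : ∀ {a p} {A : Set a} {P : A → Set p} → DecidableEquality A → (xs : List A) → Unique xs →
  (∀ x → (x ∈ xs) ⇔ P x) → Refinement A P ↔ Fin.Fin (length xs)
enumeration {A = A} {P} _≟_ xs unique ∈⇔P = mk↔ₛ′ to from to∘from from∘to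
  where
  open DecMembership _≟_ using (_∈?_)
  member : ∀ x → .(P x) → x ∈ xs
  member x p = recompute (x ∈? xs) (Equivalence.from (∈⇔P x) p)
  to : Refinement A P → Fin.Fin (length xs)
  to (x , [ p ]) = index (member x p)
  from : Fin.Fin (length xs) → Refinement A P
  from i = lookup xs i , [ Equivalence.to (∈⇔P _) (∈-lookup i) ]
  to∘from : ∀ i → to (from i) ≡ i
  to∘from i = lookup-injective unique _ i (sym (lookup-index (member (lookup xs i) (Equivalence.to (∈⇔P _) (∈-lookup i)))))
  from∘to : ∀ r → from (to r) ≡ r
  from∘to (x , [ p ]) = value-injective (sym (lookup-index (member x p)))

map-unique : ∀ {a b} {A : Set a} {B : Set b} (g : A → B) xs → (∀ {x y} → x ∈ xs → y ∈ xs → g x ≡ g y → x ≡ y) →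
  Unique xs → Unique (map g xs)
map-unique g []       inj []       = []
map-unique g (x ∷ xs) inj (x∉ ∷ u) =
  All.map⁺ (All.tabulate λ y∈ gx≡gy → All.lookup x∉ y∈ (inj (here refl) (there y∈) gx≡gy))
  ∷ map-unique g xs (λ x∈ y∈ → inj (there x∈) (there y∈)) u

cells-unique : ∀ D → Unique (cells D)
cells-unique D = Unique.cartesianProduct⁺ (((λ ()) ∷ []) ∷ [] ∷ []) (Unique.upTo⁺ D)

vectors-unique : ∀ D M → Unique (vectors D M)
vectors-unique D zero    = [] ∷ []
vectors-unique D (suc M) = Unique.cartesianProductWith⁺ _∷_ List.∷-injective (cells-unique D) (vectors-unique D M)

selected : (List Cell → Bool) → ℕ → List Cell → Bool
selected χ n v = χ v ∧ (weight 1 v ≡ᵇ n)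

solutions : (List Cell → Bool) → (n D M : ℕ) → List (List Part)
solutions χ n D M = map (decode 1) (filter (Bool.T? ∘ selected χ n) (vectors D M))

solutions-unique : ∀ χ n D M → Unique (solutions χ n D M)
solutions-unique χ n D M = map-unique (decode 1) _
  (λ {v} {v′} v∈ v′∈ → decode-injective 1 v v′ (trans (len v∈) (sym (len v′∈))))
  (Unique.filter⁺ (Bool.T? ∘ selected χ n) (vectors-unique D M))
  where
  len : ∀ {v} → v ∈ filter (Bool.T? ∘ selected χ n) (vectors D M) → length v ≡ M
  len v∈ = vectors-length D M (proj₁ (∈-filter⁻ (Bool.T? ∘ selected χ n) v∈))

size≤sum : ∀ l → All (λ p → size p ≤ sum (map size l)) l
size≤sum []      = []
size≤sum (p ∷ l) = ℕ.m≤m+n (size p) _ ∷ All.map (λ le → ℕ.≤-trans le (ℕ.m≤n+m _ (size p))) (size≤sum l)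

-- An overpartition of n has no size and no multiplicity above n, so a box with n < D and n ≤ M
-- contains them all.
solutions-complete : ∀ χ (P : List Part → Set) n D M → n < D → n ≤ M →
  (∀ v → length v ≡ M → T (χ v) ⇔ P (decode 1 v)) →
  ∀ l → (l ∈ solutions χ n D M) ⇔ (IsOverpartition n l × P l)
solutions-complete χ P n D M n<D n≤M χ⇔P l = mk⇔ to from
  where
  to : l ∈ solutions χ n D M → IsOverpartition n l × P l
  to l∈ with v , v∈ , refl ← ∈-map⁻ (decode 1) l∈
    with v∈′ , sel ← ∈-filter⁻ (Bool.T? ∘ selected χ n) v∈
    with χv , w≡n ← Equivalence.to (Bool.T-∧ {χ v}) sel
    = (decode-size 1 v , decode-linked 1 v , trans (sum-decode 1 v) (ℕ.≡ᵇ⇒≡ _ _ w≡n))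
    , Equivalence.to (χ⇔P v (vectors-length D M v∈′)) χv
  from : IsOverpartition n l × P l → l ∈ solutions χ n D M
  from ((1≤ , linked , sum≡n) , Pl)
    with v , len , refl ← decode-surjective M 1 l linked 1≤
           (All.map (λ {p} le → subst (size p <_) (ℕ.+-comm 1 M) (s≤s (ℕ.≤-trans le (ℕ.≤-trans (ℕ.≤-reflexive sum≡n) n≤M)))) (size≤sum l))
    = ∈-map⁺ (decode 1) (∈-filter⁺ (Bool.T? ∘ selected χ n)
        (subst (λ m → v ∈ vectors D m) len (vectors-complete D 1 v (s≤s z≤n) (subst (_< D) (sym w≡n) n<D)))
        (Equivalence.from Bool.T-∧ (Equivalence.from (χ⇔P v len) Pl , ℕ.≡⇒≡ᵇ _ _ w≡n)))
    where
    w≡n : weight 1 v ≡ n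
    w≡n = trans (sym (sum-decode 1 v)) sum≡n

part-≟ : DecidableEquality (List Part)
part-≟ = List.≡-dec (Product.≡-dec ℕ._≟_ Bool._≟_)

overpartitions↔Fin : ∀ χ (P : List Part → Set) n D M → n < D → n ≤ M →
  (∀ v → length v ≡ M → T (χ v) ⇔ P (decode 1 v)) →
  OverpartitionsWith n P ↔ Fin.Fin (length (solutions χ n D M))
overpartitions↔Fin χ P n D M n<D n≤M χ⇔P =
  enumeration part-≟ (solutions χ n D M) (solutions-unique χ n D M) (solutions-complete χ P n D M n<D n≤M χ⇔P)

module Counting (n k′ : ℕ) where
  open PowerSeries
  open Algebra.Properties.Semiring.Exp (CommutativeRing.semiring (truncated (suc n))) using (_^_)

  -- Coefficient n is the last one that the truncation at n + 1 retains.
  N : ℕ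
  N = suc n

  module I = GeneratingFunctionIdentities (truncated N) variable-q N (variable-q-nilpotent N) (s≤s z≤n) k′
  module GF = GeneratingFunctions (truncated N) variable-q N (variable-q-nilpotent N) I.D (ℕ.m≤m+n N (suc k′))

  -- Each accepted vector contributes one power of q, whose n-th coefficient is 1 or 0 according to
  -- whether its weight is n.
  coefficient-gf : ∀ χ M → GF.gf χ 1 M n ≡ + length (solutions χ n I.D M)
  coefficient-gf χ M = trans (count (vectors I.D M)) (cong +_ (sym (List.length-map (decode 1) (filter (Bool.T? ∘ selected χ n) (vectors I.D M)))))
    where
    count : ∀ xs → GF.sumL (λ v → GF.𝟙 (χ v) ⊛ variable-q ^ weight 1 v) xs n ≡ + length (filter (Bool.T? ∘ selected χ n) xs)
    count []       = refl
    count (v ∷ xs) with χ v | weight 1 v ≡ᵇ n in w≡ᵇn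
    ... | false | _     = trans (cong₂ ℤ._+_ (⊛-zeroˡ (variable-q ^ weight 1 v) n) (count xs)) (ℤ.+-identityˡ _)
    ... | true  | true  = cong₂ ℤ._+_ (trans (⊛-identityˡ (variable-q ^ weight 1 v) n)
      (trans (coefficient-pow N (weight 1 v) n) (cong (if_then + 1 else + 0) w≡ᵇn))) (count xs)
    ... | true  | false = trans (cong₂ ℤ._+_ (trans (⊛-identityˡ (variable-q ^ weight 1 v) n)
      (trans (coefficient-pow N (weight 1 v) n) (cong (if_then + 1 else + 0) w≡ᵇn))) (count xs)) (ℤ.+-identityˡ _)

  n<D : n < I.D
  n<D = ℕ.m≤m+n N (suc k′)

  n≤M : n ≤ I.L * 2
  n≤M = ℕ.≤-trans (ℕ.n≤1+n n) (ℕ.≤-trans I.N≤L (ℕ.m≤m*n I.L 2))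

  bijection : ∀ χ χ′ (P P′ : List Part → Set) →
    (∀ v → length v ≡ I.L * 2 → T (χ v) ⇔ P (decode 1 v)) →
    (∀ v → length v ≡ I.L * 2 → T (χ′ v) ⇔ P′ (decode 1 v)) →
    GF.gf χ 1 (I.L * 2) n ≡ GF.gf χ′ 1 (I.L * 2) n →
    OverpartitionsWith n P ↔ OverpartitionsWith n P′
  bijection χ χ′ P P′ χ⇔P χ′⇔P′ eq =
    ↔-sym (overpartitions↔Fin χ′ P′ n I.D (I.L * 2) n<D n≤M χ′⇔P′)
    ↔-∘ subst (λ m → OverpartitionsWith n P ↔ Fin.Fin m) lengths (overpartitions↔Fin χ P n I.D (I.L * 2) n<D n≤M χ⇔P)
    where
    lengths : length (solutions χ n I.D (I.L * 2)) ≡ length (solutions χ′ n I.D (I.L * 2))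
    lengths = ℤ.+-injective (trans (sym (coefficient-gf χ (I.L * 2))) (trans eq (coefficient-gf χ′ (I.L * 2))))

theorem1p7 : (k i n : ℕ) → 1 ≤ i → i ≤ k →
    (i < k → OverpartitionsWith n (OCond k i) ↔ OverpartitionsWith n (PCondLt k i))
    × (i ≡ k → OverpartitionsWith n (OCond k i) ↔ OverpartitionsWith n (PCondEq k))
theorem1p7 (suc k′) (suc i) n _ i≤k = unequal , equal
  where
  open Counting n k′
  k : ℕ
  k = suc k′

  unequal : suc i < k → OverpartitionsWith n (OCond k (suc i)) ↔ OverpartitionsWith n (PCondLt k (suc i))
  unequal i<k = bijection _ _ _ _
    (λ v → admissible⇔OCond I.L v (s≤s z≤n) i≤k)
    (λ v _ → okNonOverlined⇔All (unrestricted? k (suc i)) 1 v)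
    -- In this clause `suc i` is the i of the statement, and j = k - `suc i` is positive because
    -- `suc i` < k.
    (I.gf-admissible≈gf-okNonOverlined i (k ∸ suc i) i+j≡k (ℕ.m<n⇒0<n∸m i<k) (good (unrestricted? k (suc i)))
      (unrestricted-residues k′ i (k ∸ suc i) i+j≡k) n ℕ.≤-refl)
    where
    i+j≡k : suc i + (k ∸ suc i) ≡ k
    i+j≡k = ℕ.m+[n∸m]≡n i≤k

  equal : suc i ≡ k → OverpartitionsWith n (OCond k (suc i)) ↔ OverpartitionsWith n (PCondEq k)
  equal refl = bijection _ _ _ _
    (λ v → admissible⇔OCond I.L v (s≤s z≤n) ℕ.≤-refl)
    (λ v _ → okAll⇔All (notMultiple? k) 1 v)
    (I.gf-admissible≈gf-okAll (good (notMultiple? k)) (notMultiple-residues k′) n ℕ.≤-refl)
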